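{- Let $n \geq r \geq 3$ be integers and let $H$ be an $n$-vertex $r$-uniform hypergraph. Suppose that one of the following holds: (1) $r \leq n/2$ and $\delta(H) \geq \binom{\lfloor n/2 \rfloor}{r-1} + 1$; or (2) $r > n/2 \geq 3$ and $\delta(H) \geq r-1$; or (3) $r = 3$, $n = 5$ and $\delta(H) \geq 3$. Then $H$ is hamiltonian-connected, i.e., for any two distinct vertices $x,y \in V(H)$, $H$ contains a hamiltonian Berge path from $x$ to $y$.
   Context: An $r$-uniform hypergraph ($r$-graph) is a hypergraph all of whose edges have exactly $r$ vertices. The degree $d_H(v)$ of a vertex $v$ is the number of edges containing $v$, and $\delta(H)$ is the minimum degree over all vertices. A Berge path of length $\ell$ is a list $v_1, e_1, v_2, \ldots, e_\ell, v_{\ell+1}$ of $\ell+1$ distinct vertices and $\ell$ distinct edges with $\{v_i, v_{i+1}\} \subseteq e_i$ for all $1 \leq i \leq \ell$; it is an $x,y$-path if $v_1 = x$ and $v_{\ell+1} = y$, and it is hamiltonian if its vertex list $\{v_1,\dots,v_{\ell+1}\}$ is all of $V(H)$ (edges may contain further vertices). A hypergraph is hamiltonian-connected if for any two distinct vertices $x,y$ it contains a hamiltonian Berge $x,y$-path. -}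

module Defs where

open import Data.Nat using (ℕ; suc; _≤_)
open import Data.Fin using (Fin; inject₁) renaming (suc to fsuc)
open import Data.Fin.Subset using (Subset; _∈_; ∣_∣)
open import Data.Fin.Subset.Properties using (_∈?_)
open import Data.List using (List; length; filter)
open import Data.List.Relation.Unary.All using (All)
open import Data.List.Relation.Unary.Unique.Propositional using (Unique)
import Data.List.Membership.Propositional as LM
open import Data.Product using (Σ; _×_; ∃)
open import Function using (Injective)
open import Relation.Binary.PropositionalEquality using (_≡_; _≢_)

record UniformHypergraph (n r : ℕ) : Set where
  field
    edges   : List (Subset n)
    simple  : Unique edges
    uniform : All (λ e → ∣ e ∣ ≡ r) edges
open UniformHypergraph public

degree : ∀ {n r} → UniformHypergraph n r → Fin n → ℕ
degree H v = length (filter (λ e → v ∈? e) (edges H))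

MinDegreeAtLeast : ∀ {n r} → UniformHypergraph n r → ℕ → Set
MinDegreeAtLeast {n} H k = (v : Fin n) → k ≤ degree H v

record BergePath {n r : ℕ} (H : UniformHypergraph n r) (ℓ : ℕ) : Set where
  field
    vert     : Fin (suc ℓ) → Fin n
    edge     : Fin ℓ → Subset n
    vertInj  : Injective _≡_ _≡_ vert
    edgeInj  : Injective _≡_ _≡_ edge
    edgeInH  : (i : Fin ℓ) → edge i LM.∈ edges H
    leftIn   : (i : Fin ℓ) → vert (inject₁ i) ∈ edge i
    rightIn  : (i : Fin ℓ) → vert (fsuc i) ∈ edge i
open BergePath public

HamiltonianPath : ∀ {n r} → UniformHypergraph n r → Fin n → Fin n → Set
HamiltonianPath {n} H x y =
  Σ ℕ λ ℓ → Σ (BergePath H ℓ) λ P →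
    (vert P Data.Fin.zero ≡ x) × (vert P (Data.Fin.fromℕ ℓ) ≡ y)
    × ((w : Fin n) → ∃ λ i → vert P i ≡ w)

HamiltonianConnected : ∀ {n r} → UniformHypergraph n r → Set
HamiltonianConnected {n} H = (x y : Fin n) → x ≢ y → HamiltonianPath H x y

{-# OPTIONS --safe #-}
module Submission where

-- A hamiltonian x,y-path is a hamiltonian cycle through an extra link between x and y.  It exists once enough
-- r-sets are added as edges, and these are taken away again one at a time: if the cycle uses the edge removed,
-- it opens to a path of links with a gap between its ends w and u, and the remaining edges are used or free.
-- Assume that no cycle exists.  A free edge at a vertex outside a cycle on all the others would allow it to be
-- inserted.  If both ends of the path have free edges, also allowing for relabelling, let U and W be the
-- vertices these reach.  As in Pósa's and Dirac's arguments, no link leads from U to W, nor does the path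
-- close up by leaving out one inner vertex, so that the degree of an end is at most C(m, r − 1) up to the few
-- links outside both classes.  The degree condition leaves exactly one such link, with m vertices reached from
-- each end, and a rotation of an end changes its class: a contradiction.  If only one end has a free edge g,
-- rotations along g and along the labels make every vertex outside a rooted edge the root of that edge, and
-- counting incidences shows that there are too few edges.

open import Defs
open import Data.Nat using (ℕ; zero; suc; _+_; _*_; _∸_; _≤_; _<_; _/_; _%_; z≤n; s≤s; s≤s⁻¹; _≤?_; _<?_)
import Data.Nat as ℕ
open import Data.Nat.Properties
open import Data.Nat.DivMod using (m≡m%n+[m/n]*n; m%n<n)
open import Data.Nat.Combinatorics using (_C_; nCn≡1; nC1≡n; nCk+nC[k+1]≡[n+1]C[k+1]; k>n⇒nCk≡0)
open import Data.Nat.Tactic.RingSolver using (solve-∀)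
import Data.Bool as Bool
open import Data.Fin using (Fin; inject₁; fromℕ)
import Data.Fin as F
import Data.Fin.Properties as F
open import Data.Nat.ListAction using (sum)
open import Data.Nat.ListAction.Properties using (sum-↭)
open import Data.Fin.Subset using (Subset; inside; outside; _∈_; ∣_∣; ⊥; ⊤; ⁅_⁆; ∁; _⊆_; _∪_)
open import Data.Fin.Subset.Properties using (_∈?_; ∉⊥; drop-there; ⊆-antisym; x∈p∪q⁻; x∈p∪q⁺; x∈⁅x⁆; x∈⁅y⁆⇒x≡y; x∈p⇒x∉∁p; x∉p⇒x∈∁p; ∣∁p∣≡n∸∣p∣; ∣p∣≡n⇒p≡⊤)
open import Data.Vec using ([]; _∷_; here; there)
open import Data.Vec.Properties using (≡-dec)
open import Data.Maybe using (Maybe; just; nothing)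
open import Data.Maybe.Properties using (just-injective)
open import Data.List using (List; []; _∷_; _++_; length; filter; map; allFin; [_]; concatMap; tabulate)
open import Data.List.Properties using (length-++; map-++; map-∘; ++-assoc; ++-identityʳ; ∷-injective; length-map; length-tabulate; filter-accept; filter-reject; filter-all; filter-none; filter-++; length-filter)
open import Data.List.Relation.Unary.All as All using (All; []; _∷_)
import Data.List.Relation.Unary.All.Properties as All
open import Data.List.Relation.Unary.Any as Any using (Any; here; there)
import Data.List.Relation.Unary.AllPairs.Properties as AllPairs
import Data.List.Relation.Unary.AllPairs as AllPairs
open import Data.List.Relation.Unary.AllPairs using ([]; _∷_)
open import Data.List.Relation.Unary.Unique.Propositional using (Unique)
import Data.List.Relation.Unary.Unique.Propositional.Properties as Unique
open import Data.List.Membership.Propositional using (find; lose) renaming (_∈_ to _∈ₗ_; _∉_ to _∉ₗ_)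
open import Data.List.Membership.Propositional.Properties using (∈-++⁺ˡ; ∈-++⁺ʳ; ∈-++⁻; ∈-filter⁺; ∈-filter⁻; ∈-map⁺; ∈-map⁻; ∈-∃++; ∈-allFin)
open import Data.List.Relation.Binary.Permutation.Propositional using (_↭_; prep; ↭-refl; ↭-sym; ↭-trans; ↭-reflexive)
import Data.List.Relation.Binary.Permutation.Propositional as Perm
open import Data.List.Relation.Binary.Permutation.Propositional.Properties using (∈-resp-↭; All-resp-↭; ↭-length; drop-∷; shift; filter-↭; ++-commutativeMonoid) renaming (map⁺ to ↭-map⁺; ++⁺ to ↭-++⁺; ++⁺ˡ to ↭-++⁺ˡ; ++⁺ʳ to ↭-++⁺ʳ; ++-comm to ↭-++-comm)
open import Data.Product using (Σ; ∃; ∃₂; _×_; _,_; proj₁; proj₂)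
open import Data.Sum using (_⊎_; inj₁; inj₂; [_,_]′; swap)
open import Data.Empty renaming (⊥ to Empty; ⊥-elim to absurd)
open import Function using (_∘_; id; case_of_)
open import Relation.Nullary using (¬_; Dec; yes; no; contradiction; ¬?; _×-dec_; _⊎-dec_; decidable-stable)
open import Relation.Nullary.Decidable using (_→-dec_)
open import Relation.Unary using (Decidable)
open import Relation.Binary.PropositionalEquality using (_≡_; _≢_; refl; sym; trans; cong; cong₂; subst; subst₂; module ≡-Reasoning)

-- An edge labels at most one link, so a neighbour of an end along an edge in use does not count as
-- it would in a graph. A label containing the end helps only if another edge at the same end can
-- take over its link. Every edge involved contains the end in question and, as long as no cycle
-- exists, misses the opposite end; therefore the relabellings for the two ends do not disturb each
-- other, and both can be carried out before a crossing. With m = ⌊n/2⌋ and n odd, two classes of m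
-- positions leave exactly one position over, and the degree may exceed C(m, r - 1) by exactly one.
-- Counting alone then gives no contradiction, and the position of the link left over has to be
-- studied. The sets of reached vertices are obtained only under double negation. This is harmless,
-- because the existence of a hamiltonian path is decided at the end by a finite search.

module ↭Solver {A : Set} where
  open import Algebra.Solver.CommutativeMonoid (++-commutativeMonoid {A = A}) public

-- Labelled paths and their reversal

Label : ℕ → Set
Label n = Maybe (Subset n)

record Link (n : ℕ) : Set where
  constructor _⟨_⟩_
  field
    tail  : Fin n
    label : Label n
    head  : Fin n
open Link public

flip : ∀ {n} → Link n → Link n
flip (a ⟨ ℓ ⟩ b) = b ⟨ ℓ ⟩ a

heads tails : ∀ {n} → List (Link n) → List (Fin n)
heads = map head
tails = map tail

labels : ∀ {n} → List (Link n) → List (Label n)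
labels = map label

rev : ∀ {n} → List (Link n) → List (Link n)
rev []       = []
rev (l ∷ ls) = rev ls ++ [ flip l ]

module _ {n : ℕ} where
  heads-++ : (xs ys : List (Link n)) → heads (xs ++ ys) ≡ heads xs ++ heads ys
  heads-++ = map-++ head

  labels-++ : (xs ys : List (Link n)) → labels (xs ++ ys) ≡ labels xs ++ labels ys
  labels-++ = map-++ label

  labels-rev : (ls : List (Link n)) → labels (rev ls) ↭ labels ls
  labels-rev [] = ↭-refl
  labels-rev (l ∷ ls) rewrite labels-++ (rev ls) [ flip l ] =
    ↭-trans (↭-++-comm (labels (rev ls)) _) (prep _ (labels-rev ls))

-- The pair {x , y} is joined by a special label, nothing: a hamiltonian x,y-path closes up
-- to a hamiltonian cycle through this extra link, and both are treated as such cycles.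
module Chains {n : ℕ} (x y : Fin n) where

  Joins : Fin n → Label n → Fin n → Set
  Joins a (just e) b = a ∈ e × b ∈ e
  Joins a nothing  b = (a ≡ x × b ≡ y) ⊎ (a ≡ y × b ≡ x)

  Joins-sym : ∀ {a} ℓ {b} → Joins a ℓ b → Joins b ℓ a
  Joins-sym (just e) (p , q) = q , p
  Joins-sym nothing (inj₁ (p , q)) = inj₂ (q , p)
  Joins-sym nothing (inj₂ (p , q)) = inj₁ (q , p)

  infixr 5 _∷_
  data Chain : Fin n → List (Link n) → Fin n → Set where
    []  : ∀ {a} → Chain a [] a
    _∷_ : ∀ {a ℓ b ls c} → Joins a ℓ b → Chain b ls c → Chain a (a ⟨ ℓ ⟩ b ∷ ls) c

  infixr 5 _⋆_
  _⋆_ : ∀ {a ls b ms c} → Chain a ls b → Chain b ms c → Chain a (ls ++ ms) c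
  []      ⋆ d = d
  (j ∷ c) ⋆ d = j ∷ (c ⋆ d)

  split : ∀ {a d} ls {ms} → Chain a (ls ++ ms) d → ∃ λ b → Chain a ls b × Chain b ms d
  split []       c       = _ , [] , c
  split (_ ∷ ls) (j ∷ c) with split ls c
  ... | b , c₁ , c₂ = b , j ∷ c₁ , c₂

  split-at : ∀ {a d b ℓ c} ls {ms} → Chain a (ls ++ b ⟨ ℓ ⟩ c ∷ ms) d →
             Chain a ls b × Joins b ℓ c × Chain c ms d
  split-at ls ch with split ls ch
  ... | _ , c₁ , j ∷ c₂ = c₁ , j , c₂

  rev-chain : ∀ {a ls b} → Chain a ls b → Chain b (rev ls) a
  rev-chain []                    = []
  rev-chain (_∷_ {ℓ = ℓ} j c) = rev-chain c ⋆ (Joins-sym ℓ j ∷ [])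

  -- `heads` leaves out the first vertex of a path, and reversal changes which vertex that is. Hence
  -- the extra vertex on both sides.
  heads-rev : ∀ {a ls b} → Chain a ls b → b ∷ heads (rev ls) ↭ a ∷ heads ls
  heads-rev [] = ↭-refl
  heads-rev (_∷_ {a} {ℓ} {b} {ls} {c} j ch) rewrite heads-++ (rev ls) [ b ⟨ ℓ ⟩ a ] =
    ↭-trans (↭-++-comm (c ∷ heads (rev ls)) [ a ]) (prep a (heads-rev ch))

  tails-chain : ∀ {a ls b} → Chain a ls b → tails ls ++ [ b ] ≡ a ∷ heads ls
  tails-chain []      = refl
  tails-chain (j ∷ c) = cong (_ ∷_) (tails-chain c)

  cut : ∀ {a ls} → Chain a ls a → nothing ∈ₗ labels ls →
        ∃ λ p → ∃ λ q → ∃ λ ms → Chain p ms q × Joins q nothing p ×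
          (p ∷ heads ms ↭ heads ls) × (nothing ∷ labels ms ↭ labels ls)
  cut c nothing∈ with ∈-map⁻ label nothing∈
  ... | (q ⟨ _ ⟩ p) , l∈ , refl with ∈-∃++ l∈
  ... | xs , ys , refl with split-at xs c
  ... | c₁ , j , c₂ = p , q , ys ++ xs , c₂ ⋆ c₁ , j , perm₁ , perm₂
    where
    open ↭Solver
    perm₁ : p ∷ heads (ys ++ xs) ↭ heads (xs ++ q ⟨ nothing ⟩ p ∷ ys)
    perm₁ rewrite heads-++ ys xs | heads-++ xs (q ⟨ nothing ⟩ p ∷ ys) =
      solve 3 (λ u v w → u ⊕ (v ⊕ w) ⊜ w ⊕ (u ⊕ v)) ↭-refl [ p ] (heads ys) (heads xs)
    perm₂ : nothing ∷ labels (ys ++ xs) ↭ labels (xs ++ q ⟨ nothing ⟩ p ∷ ys)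
    perm₂ rewrite labels-++ ys xs | labels-++ xs (q ⟨ nothing ⟩ p ∷ ys) =
      solve 3 (λ u v w → u ⊕ (v ⊕ w) ⊜ w ⊕ (u ⊕ v)) ↭-refl [ nothing ] (labels ys) (labels xs)

  -- Cycles, paths with a gap, and the moves between them

  module States (E : List (Subset n)) where

    -- F lists the edges of E that label no link.
    Uses : List (Link n) → List (Subset n) → Set
    Uses ls F = labels ls ++ map just F ↭ nothing ∷ map just E

    -- What remains of a cycle when one link is taken out. The special link is still among the n - 1
    -- links, so n - 2 edges of `E` are in use.
    Gap : Fin n → Fin n → List (Link n) → List (Subset n) → Set
    Gap w u ls F = Chain w ls u × (w ∷ heads ls ↭ allFin n) × Uses ls F

    Cycle : Set
    Cycle = ∃ λ a → ∃ λ ls → ∃ λ F → Chain a ls a × (heads ls ↭ allFin n) × Uses ls F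

    CycleBut : Fin n → List (Subset n) → Set
    CycleBut z F = ∃ λ a → ∃ λ ls → Chain a ls a × (z ∷ heads ls ↭ allFin n) × Uses ls F

    -- A cycle opened at its special link, which is kept only as the condition `Joins q nothing p`.
    -- All links in the list are then ordinary, as suits the insertion of a vertex.
    Line : Fin n → Fin n → List (Link n) → List (Subset n) → Set
    Line p q ls F = Chain p ls q × Joins q nothing p × (labels ls ++ map just F ↭ map just E)

    Ham : Set
    Ham = ∃ λ p → ∃ λ q → ∃ λ ls → ∃ λ F → Line p q ls F × (p ∷ heads ls ↭ allFin n)

    LineBut : Fin n → Fin n → Fin n → List (Link n) → List (Subset n) → Set
    LineBut z p q ls F = Line p q ls F × (z ∷ p ∷ heads ls ↭ allFin n)

    nothing∉just : (F : List (Subset n)) → nothing ∉ₗ map just F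
    nothing∉just F p with ∈-map⁻ just p
    ... | _ , _ , ()

    cut-line : ∀ {a ls F} → Chain a ls a → Uses ls F →
               ∃ λ p → ∃ λ q → ∃ λ ms → Line p q ms F × (p ∷ heads ms ↭ heads ls)
    cut-line {ls = ls} {F} c uses with ∈-++⁻ (labels ls) (∈-resp-↭ (↭-sym uses) (here refl))
    ... | inj₂ p = absurd (nothing∉just F p)
    ... | inj₁ p with cut c p
    ... | p , q , ms , c′ , j , hs , lb =
      p , q , ms , (c′ , j , drop-∷ (↭-trans (↭-++⁺ʳ (map just F) lb) uses)) , hs

    Cycle⇒Ham : Cycle → Ham
    Cycle⇒Ham (a , ls , F , c , vs , uses) with cut-line c uses
    ... | p , q , ms , line , hs = p , q , ms , F , line , ↭-trans hs vs

    CycleBut⇒LineBut : ∀ {z F} → CycleBut z F → ∃ λ p → ∃ λ q → ∃ λ ms → LineBut z p q ms F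
    CycleBut⇒LineBut (a , ls , c , vs , uses) with cut-line c uses
    ... | p , q , ms , line , hs = p , q , ms , line , ↭-trans (prep _ hs) vs

    pick : ∀ {e : Subset n} {F} → e ∈ₗ F → ∃ λ F′ → F ↭ e ∷ F′
    pick e∈ with ∈-∃++ e∈
    ... | xs , ys , refl = xs ++ ys , shift _ xs ys

    Gap-flip : ∀ {w u ls F} → Gap w u ls F → Gap u w (rev ls) F
    Gap-flip {ls = ls} (c , vs , uses) =
      rev-chain c , ↭-trans (heads-rev c) vs , ↭-trans (↭-++⁺ʳ _ (labels-rev ls)) uses

    -- In the form `e ∷ F ↭ f ∷ F′` the new label `f` may be a free edge or `e` itself. All moves
    -- below take this form, so that a rotation along a free edge and one along the label of the
    -- link are the same move.
    uses-swap : ∀ l₁ {a b e f l₂ F F′} → Uses (l₁ ++ a ⟨ just e ⟩ b ∷ l₂) F →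
                e ∷ F ↭ f ∷ F′ → Uses (l₁ ++ a ⟨ just f ⟩ b ∷ l₂) F′
    uses-swap l₁ {a} {b} {e} {f} {l₂} {F} {F′} uses p = ↭-trans eq uses
      where
      open ↭Solver
      eq : labels (l₁ ++ a ⟨ just f ⟩ b ∷ l₂) ++ map just F′ ↭ labels (l₁ ++ a ⟨ just e ⟩ b ∷ l₂) ++ map just F
      eq rewrite labels-++ l₁ (a ⟨ just f ⟩ b ∷ l₂) | labels-++ l₁ (a ⟨ just e ⟩ b ∷ l₂) =
        ↭-trans (solve 4 (λ u v w z → (u ⊕ (v ⊕ w)) ⊕ z ⊜ (u ⊕ w) ⊕ (v ⊕ z)) ↭-refl
                  (labels l₁) [ just f ] (labels l₂) (map just F′))
        (↭-trans (↭-++⁺ˡ (labels l₁ ++ labels l₂) (↭-map⁺ just (↭-sym p)))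
                 (solve 4 (λ u v w z → (u ⊕ w) ⊕ (v ⊕ z) ⊜ (u ⊕ (v ⊕ w)) ⊕ z) ↭-refl
                  (labels l₁) [ just e ] (labels l₂) (map just F)))

    Gap-swap : ∀ l₁ {w u a b e f l₂ F F′} → Gap w u (l₁ ++ a ⟨ just e ⟩ b ∷ l₂) F →
               e ∷ F ↭ f ∷ F′ → a ∈ f → b ∈ f → Gap w u (l₁ ++ a ⟨ just f ⟩ b ∷ l₂) F′
    Gap-swap l₁ {f = f} {l₂} (c , vs , uses) p af bf with split-at l₁ c
    ... | c₁ , j , c₂ = c₁ ⋆ (af , bf) ∷ c₂ ,
      subst (λ h → _ ∷ h ↭ _) (trans (heads-++ l₁ _) (sym (heads-++ l₁ _))) vs ,
      uses-swap l₁ {l₂ = l₂} uses p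

    -- Pósa's rotation: w ... a b ... u becomes w ... a u ... b. With `f` equal to `e`, the free
    -- edges stay the same.
    rotateᵘ : ∀ l₁ {w u a b e f l₂ F F′} → Gap w u (l₁ ++ a ⟨ just e ⟩ b ∷ l₂) F →
              e ∷ F ↭ f ∷ F′ → a ∈ f → u ∈ f →
              Gap w b (l₁ ++ a ⟨ just f ⟩ u ∷ rev l₂) F′
    rotateᵘ l₁ {w} {u} {a} {b} {e} {f} {l₂} {F} {F′} (c , vs , uses) p af uf with split-at l₁ c
    ... | c₁ , j , c₂ = c₁ ⋆ (af , uf) ∷ rev-chain c₂ , ↭-trans perm₁ vs , ↭-trans perm₂ (uses-swap l₁ uses p)
      where
      perm₁ : w ∷ heads (l₁ ++ a ⟨ just f ⟩ u ∷ rev l₂) ↭ w ∷ heads (l₁ ++ a ⟨ just e ⟩ b ∷ l₂)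
      perm₁ rewrite heads-++ l₁ (a ⟨ just f ⟩ u ∷ rev l₂) | heads-++ l₁ (a ⟨ just e ⟩ b ∷ l₂) =
        prep w (↭-++⁺ˡ (heads l₁) (heads-rev c₂))
      perm₂ : labels (l₁ ++ a ⟨ just f ⟩ u ∷ rev l₂) ++ map just F′ ↭ labels (l₁ ++ a ⟨ just f ⟩ b ∷ l₂) ++ map just F′
      perm₂ rewrite labels-++ l₁ (a ⟨ just f ⟩ u ∷ rev l₂) | labels-++ l₁ (a ⟨ just f ⟩ b ∷ l₂) =
        ↭-++⁺ʳ _ (↭-++⁺ˡ (labels l₁) (prep _ (labels-rev l₂)))

    -- The mirror image at the other end: w ... a b ... u becomes a ... w b ... u.
    rotateʷ : ∀ l₁ {w u a b e g l₂ F F′} → Gap w u (l₁ ++ a ⟨ just e ⟩ b ∷ l₂) F →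
              e ∷ F ↭ g ∷ F′ → w ∈ g → b ∈ g →
              Gap a u (rev l₁ ++ w ⟨ just g ⟩ b ∷ l₂) F′
    rotateʷ l₁ {w} {u} {a} {b} {e} {g} {l₂} {F} {F′} (c , vs , uses) p wg bg with split-at l₁ c
    ... | c₁ , j , c₂ = rev-chain c₁ ⋆ (wg , bg) ∷ c₂ , ↭-trans perm₁ vs , ↭-trans perm₂ (uses-swap l₁ uses p)
      where
      perm₁ : a ∷ heads (rev l₁ ++ w ⟨ just g ⟩ b ∷ l₂) ↭ w ∷ heads (l₁ ++ a ⟨ just e ⟩ b ∷ l₂)
      perm₁ rewrite heads-++ (rev l₁) (w ⟨ just g ⟩ b ∷ l₂) | heads-++ l₁ (a ⟨ just e ⟩ b ∷ l₂) =
        ↭-++⁺ʳ (b ∷ heads l₂) (heads-rev c₁)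
      perm₂ : labels (rev l₁ ++ w ⟨ just g ⟩ b ∷ l₂) ++ map just F′ ↭ labels (l₁ ++ a ⟨ just g ⟩ b ∷ l₂) ++ map just F′
      perm₂ rewrite labels-++ (rev l₁) (w ⟨ just g ⟩ b ∷ l₂) | labels-++ l₁ (a ⟨ just g ⟩ b ∷ l₂) =
        ↭-++⁺ʳ _ (↭-++⁺ʳ (just g ∷ labels l₂) (labels-rev l₁))

    close : ∀ {w u ls F g F′} → Gap w u ls F → F ↭ g ∷ F′ → u ∈ g → w ∈ g → Cycle
    close {w} {u} {ls} {F} {g} {F′} (c , vs , uses) p ug wg =
      w , ls ++ [ u ⟨ just g ⟩ w ] , F′ , c ⋆ (ug , wg) ∷ [] , ↭-trans perm₁ vs , ↭-trans perm₂ uses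
      where
      open ↭Solver
      perm₁ : heads (ls ++ [ u ⟨ just g ⟩ w ]) ↭ w ∷ heads ls
      perm₁ rewrite heads-++ ls [ u ⟨ just g ⟩ w ] = ↭-++-comm (heads ls) [ w ]
      perm₂ : labels (ls ++ [ u ⟨ just g ⟩ w ]) ++ map just F′ ↭ labels ls ++ map just F
      perm₂ rewrite labels-++ ls [ u ⟨ just g ⟩ w ] =
        ↭-trans (solve 3 (λ a b c → (a ⊕ b) ⊕ c ⊜ a ⊕ (b ⊕ c)) ↭-refl (labels ls) [ just g ] (map just F′))
                (↭-++⁺ˡ (labels ls) (↭-map⁺ just (↭-sym p)))

    -- Dirac's crossing argument: a rotation along `f` makes `b` the end, and `g` joins it to `w`.
    -- One of `f` and `g` may be the old label `e`.
    cross : ∀ l₁ {w u a b e f g l₂ F F′} → Gap w u (l₁ ++ a ⟨ just e ⟩ b ∷ l₂) F →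
            e ∷ F ↭ f ∷ g ∷ F′ → a ∈ f → u ∈ f → w ∈ g → b ∈ g → Cycle
    cross l₁ s p af uf wg bg = close (rotateᵘ l₁ s p af uf) ↭-refl bg wg

    -- Leaving out b, the path  w … a b c … u  closes up to  w … a u … c w.
    bypass : ∀ l₁ {w u a b c e e′ f g l₂ F F′} →
             Gap w u (l₁ ++ a ⟨ just e ⟩ b ∷ b ⟨ just e′ ⟩ c ∷ l₂) F →
             e ∷ e′ ∷ F ↭ f ∷ g ∷ F′ → a ∈ f → u ∈ f → w ∈ g → c ∈ g → CycleBut b F′
    bypass l₁ {w} {u} {a} {b} {c} {e} {e′} {f} {g} {l₂} {F} {F′} (ch , vs , uses) p af uf wg cg
      with split-at l₁ ch
    ... | c₁ , _ , (_ ∷ c₂) = w , l₁ ++ a ⟨ just f ⟩ u ∷ (rev l₂ ++ [ c ⟨ just g ⟩ w ]) ,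
        c₁ ⋆ (af , uf) ∷ (rev-chain c₂ ⋆ (cg , wg) ∷ []) , ↭-trans perm₁ vs , ↭-trans perm₂ uses
      where
      open ↭Solver
      perm₁ : b ∷ heads (l₁ ++ a ⟨ just f ⟩ u ∷ (rev l₂ ++ [ c ⟨ just g ⟩ w ])) ↭
              w ∷ heads (l₁ ++ a ⟨ just e ⟩ b ∷ b ⟨ just e′ ⟩ c ∷ l₂)
      perm₁ rewrite heads-++ l₁ (a ⟨ just f ⟩ u ∷ (rev l₂ ++ [ c ⟨ just g ⟩ w ]))
                  | heads-++ (rev l₂) [ c ⟨ just g ⟩ w ]
                  | heads-++ l₁ (a ⟨ just e ⟩ b ∷ b ⟨ just e′ ⟩ c ∷ l₂) =
        ↭-trans (solve 5 (λ b l u r w → b ⊕ (l ⊕ (u ⊕ (r ⊕ w))) ⊜ (w ⊕ (l ⊕ b)) ⊕ (u ⊕ r)) ↭-refl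
                  [ b ] (heads l₁) [ u ] (heads (rev l₂)) [ w ])
        (↭-trans (↭-++⁺ˡ (w ∷ heads l₁ ++ [ b ]) (heads-rev c₂))
                 (solve 5 (λ b l c r w → (w ⊕ (l ⊕ b)) ⊕ (c ⊕ r) ⊜ w ⊕ (l ⊕ (b ⊕ (c ⊕ r)))) ↭-refl
                  [ b ] (heads l₁) [ c ] (heads l₂) [ w ]))
      perm₂ : labels (l₁ ++ a ⟨ just f ⟩ u ∷ (rev l₂ ++ [ c ⟨ just g ⟩ w ])) ++ map just F′ ↭
              labels (l₁ ++ a ⟨ just e ⟩ b ∷ b ⟨ just e′ ⟩ c ∷ l₂) ++ map just F
      perm₂ rewrite labels-++ l₁ (a ⟨ just f ⟩ u ∷ (rev l₂ ++ [ c ⟨ just g ⟩ w ]))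
                  | labels-++ (rev l₂) [ c ⟨ just g ⟩ w ]
                  | labels-++ l₁ (a ⟨ just e ⟩ b ∷ b ⟨ just e′ ⟩ c ∷ l₂) =
        ↭-trans (solve 5 (λ l f r g F → (l ⊕ (f ⊕ (r ⊕ g))) ⊕ F ⊜ (l ⊕ r) ⊕ (f ⊕ (g ⊕ F))) ↭-refl
                  (labels l₁) [ just f ] (labels (rev l₂)) [ just g ] (map just F′))
        (↭-trans (↭-++⁺ (↭-++⁺ˡ (labels l₁) (labels-rev l₂)) (↭-map⁺ just (↭-sym p)))
                 (solve 5 (λ l f r g F → (l ⊕ r) ⊕ (f ⊕ (g ⊕ F)) ⊜ (l ⊕ (f ⊕ (g ⊕ r))) ⊕ F) ↭-refl
                  (labels l₁) [ just e ] (labels l₂) [ just e′ ] (map just F)))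

    -- The last label is turned from `u` to `w`. No free edge is spent, so `F` is unchanged.
    bypass-last : ∀ l₁ {w u a e F} → Gap w u (l₁ ++ [ a ⟨ just e ⟩ u ]) F → w ∈ e → CycleBut u F
    bypass-last l₁ {w} {u} {a} {e} {F} (ch , vs , uses) we with split-at l₁ ch
    ... | c₁ , (ae , _) , _ = w , l₁ ++ [ a ⟨ just e ⟩ w ] , c₁ ⋆ (ae , we) ∷ [] , ↭-trans perm₁ vs , perm₂
      where
      open ↭Solver
      perm₁ : u ∷ heads (l₁ ++ [ a ⟨ just e ⟩ w ]) ↭ w ∷ heads (l₁ ++ [ a ⟨ just e ⟩ u ])
      perm₁ rewrite heads-++ l₁ [ a ⟨ just e ⟩ w ] | heads-++ l₁ [ a ⟨ just e ⟩ u ] =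
        solve 3 (λ u l w → u ⊕ (l ⊕ w) ⊜ w ⊕ (l ⊕ u)) ↭-refl [ u ] (heads l₁) [ w ]
      perm₂ : Uses (l₁ ++ [ a ⟨ just e ⟩ w ]) F
      perm₂ = subst (λ h → h ++ map just F ↭ _) (trans (labels-++ l₁ _) (sym (labels-++ l₁ _))) uses

    -- z is appended after v, which opens the link from v to v′.
    place : ∀ l₁ {z p q v e v′ h l₂ F F′} → LineBut z p q (l₁ ++ v ⟨ just e ⟩ v′ ∷ l₂) F →
            F ↭ h ∷ F′ → z ∈ h → v ∈ h →
            Gap v′ z (l₂ ++ q ⟨ nothing ⟩ p ∷ (l₁ ++ [ v ⟨ just h ⟩ z ])) (e ∷ F′)
    place l₁ {z} {p} {q} {v} {e} {v′} {h} {l₂} {F} {F′} ((c , j , uses) , vs) perm zh vh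
      with split-at l₁ c
    ... | c₁ , _ , c₂ = c₂ ⋆ j ∷ (c₁ ⋆ (vh , zh) ∷ []) , ↭-trans perm₁ vs , ↭-trans perm₂ (prep nothing uses)
      where
      open ↭Solver
      perm₁ : v′ ∷ heads (l₂ ++ q ⟨ nothing ⟩ p ∷ (l₁ ++ [ v ⟨ just h ⟩ z ])) ↭
              z ∷ p ∷ heads (l₁ ++ v ⟨ just e ⟩ v′ ∷ l₂)
      perm₁ rewrite heads-++ l₂ (q ⟨ nothing ⟩ p ∷ (l₁ ++ [ v ⟨ just h ⟩ z ]))
                  | heads-++ l₁ [ v ⟨ just h ⟩ z ]
                  | heads-++ l₁ (v ⟨ just e ⟩ v′ ∷ l₂) =
        solve 5 (λ v r p l z → v ⊕ (r ⊕ (p ⊕ (l ⊕ z))) ⊜ z ⊕ (p ⊕ (l ⊕ (v ⊕ r)))) ↭-refl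
          [ v′ ] (heads l₂) [ p ] (heads l₁) [ z ]
      perm₂ : labels (l₂ ++ q ⟨ nothing ⟩ p ∷ (l₁ ++ [ v ⟨ just h ⟩ z ])) ++ map just (e ∷ F′) ↭
              nothing ∷ labels (l₁ ++ v ⟨ just e ⟩ v′ ∷ l₂) ++ map just F
      perm₂ rewrite labels-++ l₂ (q ⟨ nothing ⟩ p ∷ (l₁ ++ [ v ⟨ just h ⟩ z ]))
                  | labels-++ l₁ [ v ⟨ just h ⟩ z ]
                  | labels-++ l₁ (v ⟨ just e ⟩ v′ ∷ l₂) =
        ↭-trans (solve 6 (λ r s l h e F → (r ⊕ (s ⊕ (l ⊕ h))) ⊕ (e ⊕ F) ⊜ s ⊕ (l ⊕ (e ⊕ (r ⊕ (h ⊕ F))))) ↭-refl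
                  (labels l₂) [ nothing ] (labels l₁) [ just h ] [ just e ] (map just F′))
        (↭-trans (prep nothing (↭-++⁺ˡ (labels l₁) (prep (just e) (↭-++⁺ˡ (labels l₂) (↭-map⁺ just (↭-sym perm))))))
                 (solve 5 (λ s l e r F → s ⊕ (l ⊕ (e ⊕ (r ⊕ F))) ⊜ s ⊕ ((l ⊕ (e ⊕ r)) ⊕ F)) ↭-refl
                  [ nothing ] (labels l₁) [ just e ] (labels l₂) (map just F)))

    insert : ∀ l₁ {z p q v e v′ f g l₂ F F′} → LineBut z p q (l₁ ++ v ⟨ just e ⟩ v′ ∷ l₂) F →
             e ∷ F ↭ f ∷ g ∷ F′ → v ∈ f → z ∈ f → z ∈ g → v′ ∈ g → Ham
    insert l₁ {z} {p} {q} {v} {e} {v′} {f} {g} {l₂} {F} {F′} ((c , j , uses) , vs) perm vf zf zg v′g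
      with split-at l₁ c
    ... | c₁ , _ , c₂ = p , q , l₁ ++ v ⟨ just f ⟩ z ∷ z ⟨ just g ⟩ v′ ∷ l₂ , F′ ,
        (c₁ ⋆ (vf , zf) ∷ (zg , v′g) ∷ c₂ , j , ↭-trans perm₂ uses) , ↭-trans perm₁ vs
      where
      open ↭Solver
      perm₁ : p ∷ heads (l₁ ++ v ⟨ just f ⟩ z ∷ z ⟨ just g ⟩ v′ ∷ l₂) ↭ z ∷ p ∷ heads (l₁ ++ v ⟨ just e ⟩ v′ ∷ l₂)
      perm₁ rewrite heads-++ l₁ (v ⟨ just f ⟩ z ∷ z ⟨ just g ⟩ v′ ∷ l₂)
                  | heads-++ l₁ (v ⟨ just e ⟩ v′ ∷ l₂) =
        solve 4 (λ p l z r → p ⊕ (l ⊕ (z ⊕ r)) ⊜ z ⊕ (p ⊕ (l ⊕ r))) ↭-refl [ p ] (heads l₁) [ z ] (v′ ∷ heads l₂)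
      perm₂ : labels (l₁ ++ v ⟨ just f ⟩ z ∷ z ⟨ just g ⟩ v′ ∷ l₂) ++ map just F′ ↭
              labels (l₁ ++ v ⟨ just e ⟩ v′ ∷ l₂) ++ map just F
      perm₂ rewrite labels-++ l₁ (v ⟨ just f ⟩ z ∷ z ⟨ just g ⟩ v′ ∷ l₂)
                  | labels-++ l₁ (v ⟨ just e ⟩ v′ ∷ l₂) =
        ↭-trans (solve 5 (λ l f g r F → (l ⊕ (f ⊕ (g ⊕ r))) ⊕ F ⊜ (l ⊕ r) ⊕ (f ⊕ (g ⊕ F))) ↭-refl
                  (labels l₁) [ just f ] [ just g ] (labels l₂) (map just F′))
        (↭-trans (↭-++⁺ˡ (labels l₁ ++ labels l₂) (↭-map⁺ just (↭-sym perm)))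
                 (solve 4 (λ l e r F → (l ⊕ r) ⊕ (e ⊕ F) ⊜ (l ⊕ (e ⊕ r)) ⊕ F) ↭-refl
                  (labels l₁) [ just e ] (labels l₂) (map just F)))

    -- A dummy special link is put in front to apply `uses-swap`, and dropped afterwards.
    line-uses-swap : ∀ l₁ {a b e f l₂ F F′} →
      labels (l₁ ++ a ⟨ just e ⟩ b ∷ l₂) ++ map just F ↭ map just E → e ∷ F ↭ f ∷ F′ →
      labels (l₁ ++ a ⟨ just f ⟩ b ∷ l₂) ++ map just F′ ↭ map just E
    line-uses-swap l₁ {a} {b} {l₂ = l₂} uses p = drop-∷ (uses-swap (a ⟨ nothing ⟩ b ∷ l₁) {l₂ = l₂} (prep nothing uses) p)

    LineBut-swap : ∀ l₁ {z p q a b e f l₂ F F′} → LineBut z p q (l₁ ++ a ⟨ just e ⟩ b ∷ l₂) F →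
                   e ∷ F ↭ f ∷ F′ → a ∈ f → b ∈ f → LineBut z p q (l₁ ++ a ⟨ just f ⟩ b ∷ l₂) F′
    LineBut-swap l₁ {l₂ = l₂} ((c , j , uses) , vs) perm af bf with split-at l₁ c
    ... | c₁ , _ , c₂ = (c₁ ⋆ (af , bf) ∷ c₂ , j , line-uses-swap l₁ {l₂ = l₂} uses perm) ,
      subst (λ h → _ ∷ _ ∷ h ↭ _) (trans (heads-++ l₁ _) (sym (heads-++ l₁ _))) vs

    Line-flip : ∀ {p q ls F} → Line p q ls F → Line q p (rev ls) F
    Line-flip {ls = ls} (c , j , uses) =
      rev-chain c , Joins-sym nothing j , ↭-trans (↭-++⁺ʳ _ (labels-rev ls)) uses

    LineBut-flip : ∀ {z p q ls F} → LineBut z p q ls F → LineBut z q p (rev ls) F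
    LineBut-flip (line , vs) = Line-flip line , ↭-trans (prep _ (heads-rev (proj₁ line))) vs

-- Double negation and counting in lists

em : (P : Set) → ¬ ¬ Dec P
em P k = k (no λ p → k (yes p))

-- The vertices reached from an end are given by an existential statement that is never decided.
-- Under double negation they still form a `Subset`, in which membership is decidable and can be
-- counted.
¬¬-comprehension : ∀ {n} (P : Fin n → Set) →
                   ¬ ¬ (Σ (Subset n) λ U → ∀ v → (v ∈ U → P v) × (P v → v ∈ U))
¬¬-comprehension {zero} P k = k ([] , λ ())
¬¬-comprehension {suc n} P k = ¬¬-comprehension (P ∘ F.suc) λ { (U , h) → em (P F.zero) λ
  { (yes p) → k (inside ∷ U , λ { F.zero → (λ _ → p) , (λ _ → here)
                                ; (F.suc v) → proj₁ (h v) ∘ drop-there , there ∘ proj₂ (h v) })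
  ; (no ¬p) → k (outside ∷ U , λ { F.zero → (λ ()) , (λ p → absurd (¬p p))
                                 ; (F.suc v) → proj₁ (h v) ∘ drop-there , there ∘ proj₂ (h v) }) } }

module _ {A : Set} where

  Unique-resp-↭ : {xs ys : List A} → xs ↭ ys → Unique xs → Unique ys
  Unique-resp-↭ Perm.refl u = u
  Unique-resp-↭ (Perm.prep x p) (x∉ ∷ u) = All-resp-↭ p x∉ ∷ Unique-resp-↭ p u
  Unique-resp-↭ (Perm.swap x y p) ((x≢y ∷ x∉) ∷ (y∉ ∷ u)) =
    ((x≢y ∘ sym) ∷ All-resp-↭ p y∉) ∷ (All-resp-↭ p x∉ ∷ Unique-resp-↭ p u)
  Unique-resp-↭ (Perm.trans p q) u = Unique-resp-↭ q (Unique-resp-↭ p u)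

  ∉-head : ∀ {x} {xs : List A} → Unique (x ∷ xs) → x ∉ₗ xs
  ∉-head (x∉ ∷ _) x∈ = All.lookup x∉ x∈ refl

  Unique-∷ : ∀ {x} {xs : List A} → x ∉ₗ xs → Unique xs → Unique (x ∷ xs)
  Unique-∷ x∉ u = All.tabulate (λ { y∈ refl → x∉ y∈ }) ∷ u

  Unique-++ˡ : ∀ xs {ys : List A} → Unique (xs ++ ys) → Unique xs
  Unique-++ˡ [] u = []
  Unique-++ˡ (x ∷ xs) (x∉ ∷ u) = All.++⁻ˡ xs x∉ ∷ Unique-++ˡ xs u

  Unique-++ʳ : ∀ xs {ys : List A} → Unique (xs ++ ys) → Unique ys
  Unique-++ʳ [] u = u
  Unique-++ʳ (x ∷ xs) (x∉ ∷ u) = Unique-++ʳ xs u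

  length-⊆ : {xs ys : List A} → Unique xs → (∀ {v} → v ∈ₗ xs → v ∈ₗ ys) → length xs ≤ length ys
  length-⊆ {[]} u sub = z≤n
  length-⊆ {x ∷ xs} {ys} u@(_ ∷ uxs) sub with ∈-∃++ (sub (here refl))
  ... | as , bs , refl = ≤-trans (s≤s (length-⊆ uxs sub′)) (≤-reflexive (sym (↭-length (shift x as bs))))
    where
    sub′ : ∀ {v} → v ∈ₗ xs → v ∈ₗ as ++ bs
    sub′ {v} v∈ with ∈-resp-↭ (shift x as bs) (sub (there v∈))
    ... | here refl = absurd (∉-head u v∈)
    ... | there p   = p

  module _ {P : A → Set} (P? : Decidable P) where

    count : List A → ℕ
    count xs = length (filter P? xs)

    count-yes : ∀ {x xs} → P x → count (x ∷ xs) ≡ suc (count xs)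
    count-yes p = cong length (filter-accept P? p)

    count-no : ∀ {x xs} → ¬ P x → count (x ∷ xs) ≡ count xs
    count-no p = cong length (filter-reject P? p)

    count-++ : ∀ xs ys → count (xs ++ ys) ≡ count xs + count ys
    count-++ xs ys = trans (cong length (filter-++ P? xs ys)) (length-++ (filter P? xs))

    count-↭ : ∀ {xs ys} → xs ↭ ys → count xs ≡ count ys
    count-↭ p = ↭-length (filter-↭ P? p)

    count-none : ∀ {xs} → (∀ {x} → x ∈ₗ xs → ¬ P x) → count xs ≡ 0
    count-none h = cong length (filter-none P? (All.tabulate h))

    count-all : ∀ {xs} → (∀ {x} → x ∈ₗ xs → P x) → count xs ≡ length xs
    count-all h = cong length (filter-all P? (All.tabulate h))

    count-pos : ∀ {x xs} → x ∈ₗ xs → P x → 1 ≤ count xs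
    count-pos x∈ p = nonempty (∈-filter⁺ P? x∈ p)
      where
      nonempty : ∀ {x} {ys : List A} → x ∈ₗ ys → 1 ≤ length ys
      nonempty (here _) = s≤s z≤n
      nonempty (there _) = s≤s z≤n

    count-witness : ∀ xs → 1 ≤ count xs → ∃ λ x → x ∈ₗ xs × P x
    count-witness xs h with filter P? xs in eq
    ... | x ∷ _ = x , ∈-filter⁻ P? {xs = xs} (subst (x ∈ₗ_) (sym eq) (here refl))

    count-≤-length : ∀ xs → count xs ≤ length xs
    count-≤-length [] = z≤n
    count-≤-length (x ∷ xs) with P? x
    ... | yes _ = s≤s (count-≤-length xs)
    ... | no  _ = m≤n⇒m≤1+n (count-≤-length xs)

    count-all⁻ : ∀ xs → length xs ≤ count xs → All P xs
    count-all⁻ [] _ = []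
    count-all⁻ (x ∷ xs) h with P? x
    ... | yes p = p ∷ count-all⁻ xs (s≤s⁻¹ h)
    ... | no _  = contradiction h (<⇒≱ (s≤s (count-≤-length xs)))

  module _ {P Q : A → Set} (P? : Decidable P) (Q? : Decidable Q) where

    count-mono : ∀ xs → (∀ {x} → x ∈ₗ xs → P x → Q x) → count P? xs ≤ count Q? xs
    count-mono [] h = z≤n
    count-mono (x ∷ xs) h with P? x | Q? x
    ... | yes p | yes q = s≤s (count-mono xs (h ∘ there))
    ... | yes p | no ¬q = absurd (¬q (h (here refl) p))
    ... | no _  | yes q = m≤n⇒m≤1+n (count-mono xs (h ∘ there))
    ... | no _  | no _  = count-mono xs (h ∘ there)

    count-disjoint : ∀ xs → (∀ {x} → x ∈ₗ xs → P x → ¬ Q x) → count P? xs + count Q? xs ≤ length xs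
    count-disjoint [] h = z≤n
    count-disjoint (x ∷ xs) h with P? x | Q? x
    ... | yes p | yes q = absurd (h (here refl) p q)
    ... | yes p | no _  = s≤s (count-disjoint xs (h ∘ there))
    ... | no _  | yes q = ≤-trans (≤-reflexive (+-suc _ _)) (s≤s (count-disjoint xs (h ∘ there)))
    ... | no _  | no _  = m≤n⇒m≤1+n (count-disjoint xs (h ∘ there))

    module _ {R : A → Set} (R? : Decidable R) where

      count-⊎-≤ : ∀ xs → (∀ {x} → x ∈ₗ xs → R x → P x ⊎ Q x) → count R? xs ≤ count P? xs + count Q? xs
      count-⊎-≤ [] h = z≤n
      count-⊎-≤ (x ∷ xs) h with R? x | P? x | Q? x
      ... | no _ | no _  | no _ = count-⊎-≤ xs (h ∘ there)
      ... | no _ | no _  | yes _ = ≤-trans (count-⊎-≤ xs (h ∘ there)) (+-monoʳ-≤ (count P? xs) (n≤1+n _))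
      ... | no _ | yes _ | no _  = m≤n⇒m≤1+n (count-⊎-≤ xs (h ∘ there))
      ... | no _ | yes _ | yes _ = m≤n⇒m≤1+n (≤-trans (count-⊎-≤ xs (h ∘ there)) (+-monoʳ-≤ (count P? xs) (n≤1+n _)))
      ... | yes r | yes _ | no _ = s≤s (count-⊎-≤ xs (h ∘ there))
      ... | yes r | yes _ | yes _ = s≤s (≤-trans (count-⊎-≤ xs (h ∘ there)) (+-monoʳ-≤ (count P? xs) (n≤1+n _)))
      ... | yes r | no _ | yes _ = ≤-trans (s≤s (count-⊎-≤ xs (h ∘ there))) (≤-reflexive (sym (+-suc _ _)))
      ... | yes r | no ¬p | no ¬q = absurd ([ ¬p , ¬q ]′ (h (here refl) r))

      count-⊎-≥ : ∀ xs → (∀ {x} → x ∈ₗ xs → P x → R x) → (∀ {x} → x ∈ₗ xs → Q x → R x) →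
                  (∀ {x} → x ∈ₗ xs → P x → ¬ Q x) → count P? xs + count Q? xs ≤ count R? xs
      count-⊎-≥ [] h k d = z≤n
      count-⊎-≥ (x ∷ xs) h k d with P? x | Q? x | R? x
      ... | yes p | yes q | _ = absurd (d (here refl) p q)
      ... | yes p | no _  | yes _ = s≤s (count-⊎-≥ xs (h ∘ there) (k ∘ there) (d ∘ there))
      ... | yes p | no _  | no ¬r = absurd (¬r (h (here refl) p))
      ... | no _ | yes q | yes _ = ≤-trans (≤-reflexive (+-suc _ _)) (s≤s (count-⊎-≥ xs (h ∘ there) (k ∘ there) (d ∘ there)))
      ... | no _ | yes q | no ¬r = absurd (¬r (k (here refl) q))
      ... | no _ | no _ | yes _ = m≤n⇒m≤1+n (count-⊎-≥ xs (h ∘ there) (k ∘ there) (d ∘ there))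
      ... | no _ | no _ | no _ = count-⊎-≥ xs (h ∘ there) (k ∘ there) (d ∘ there)

  count-¬ : ∀ {P : A → Set} (P? : Decidable P) xs → count P? xs + count (¬? ∘ P?) xs ≡ length xs
  count-¬ P? [] = refl
  count-¬ P? (x ∷ xs) with P? x
  ... | yes _ = cong suc (count-¬ P? xs)
  ... | no _  = trans (+-suc _ _) (cong suc (count-¬ P? xs))

count-map : ∀ {A B : Set} {P : B → Set} (P? : Decidable P) (f : A → B) xs →
            count P? (map f xs) ≡ count (P? ∘ f) xs
count-map P? f [] = refl
count-map P? f (x ∷ xs) with P? (f x)
... | yes _ = cong suc (count-map P? f xs)
... | no _  = count-map P? f xs

module _ {A : Set} where
  sum-≥ : ∀ {f : A → ℕ} {k} xs → (∀ {x} → x ∈ₗ xs → k ≤ f x) → length xs * k ≤ sum (map f xs)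
  sum-≥ [] h = z≤n
  sum-≥ (x ∷ xs) h = +-mono-≤ (h (here refl)) (sum-≥ xs (h ∘ there))

  sum-≤ : ∀ {f : A → ℕ} {k} xs → (∀ {x} → x ∈ₗ xs → f x ≤ k) → sum (map f xs) ≤ length xs * k
  sum-≤ [] h = z≤n
  sum-≤ (x ∷ xs) h = +-mono-≤ (h (here refl)) (sum-≤ xs (h ∘ there))

+-left-comm : ∀ a b c → a + (b + c) ≡ b + (a + c)
+-left-comm = solve-∀

module _ {A B : Set} {R : A → B → Set} (R? : ∀ a b → Dec (R a b)) where
  private
    col : ∀ x xs ys → sum (map (λ b → count (λ a → R? a b) (x ∷ xs)) ys) ≡
                      count (R? x) ys + sum (map (λ b → count (λ a → R? a b) xs) ys)
    col x xs [] = refl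
    col x xs (y ∷ ys) with R? x y
    ... | yes _ = cong suc (trans (cong (count (λ a → R? a y) xs +_) (col x xs ys)) (+-left-comm (count (λ a → R? a y) xs) (count (R? x) ys) _))
    ... | no _ = trans (cong (count (λ a → R? a y) xs +_) (col x xs ys)) (+-left-comm (count (λ a → R? a y) xs) (count (R? x) ys) _)

  double-count : ∀ xs ys → sum (map (λ a → count (R? a) ys) xs) ≡ sum (map (λ b → count (λ a → R? a b) xs) ys)
  double-count [] ys = sym (zeros ys)
    where
    zeros : ∀ ys → sum (map (λ (b : B) → 0) ys) ≡ 0
    zeros [] = refl
    zeros (_ ∷ ys) = zeros ys
  double-count (x ∷ xs) ys = trans (cong (count (R? x) ys +_) (double-count xs ys)) (sym (col x xs ys))

-- Families of subsets and binomial coefficients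

elements : ∀ {n} → Subset n → List (Fin n)
elements [] = []
elements (inside ∷ S)  = F.zero ∷ map F.suc (elements S)
elements (outside ∷ S) = map F.suc (elements S)

length-elements : ∀ {n} (S : Subset n) → length (elements S) ≡ ∣ S ∣
length-elements [] = refl
length-elements (inside ∷ S) = cong suc (trans (length-map F.suc (elements S)) (length-elements S))
length-elements (outside ∷ S) = trans (length-map F.suc (elements S)) (length-elements S)

∈-elements⁺ : ∀ {n} (S : Subset n) {v} → v ∈ S → v ∈ₗ elements S
∈-elements⁺ (inside ∷ S) here = here refl
∈-elements⁺ (inside ∷ S) (there v∈) = there (∈-map⁺ F.suc (∈-elements⁺ S v∈))
∈-elements⁺ (outside ∷ S) (there v∈) = ∈-map⁺ F.suc (∈-elements⁺ S v∈)

∈-elements⁻ : ∀ {n} (S : Subset n) {v} → v ∈ₗ elements S → v ∈ S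
∈-elements⁻ (inside ∷ S) (here refl) = here
∈-elements⁻ (inside ∷ S) (there v∈) with ∈-map⁻ F.suc v∈
... | _ , w∈ , refl = there (∈-elements⁻ S w∈)
∈-elements⁻ (outside ∷ S) v∈ with ∈-map⁻ F.suc v∈
... | _ , w∈ , refl = there (∈-elements⁻ S w∈)

Unique-elements : ∀ {n} (S : Subset n) → Unique (elements S)
Unique-elements [] = []
Unique-elements (inside ∷ S) = Unique-∷ zero∉ (Unique.map⁺ F.suc-injective (Unique-elements S))
  where
  zero∉ : F.zero ∉ₗ map F.suc (elements S)
  zero∉ p with ∈-map⁻ F.suc p
  ... | _ , _ , ()
Unique-elements (outside ∷ S) = Unique.map⁺ F.suc-injective (Unique-elements S)

module _ {n : ℕ} where

  size-≤ : (S : Subset n) {L : List (Fin n)} → (∀ {v} → v ∈ S → v ∈ₗ L) → ∣ S ∣ ≤ length L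
  size-≤ S {L} sub = subst (_≤ length L) (length-elements S) (length-⊆ (Unique-elements S) (sub ∘ ∈-elements⁻ S))

  size-≥ : (S : Subset n) {L : List (Fin n)} → Unique L → (∀ {v} → v ∈ₗ L → v ∈ S) → length L ≤ ∣ S ∣
  size-≥ S {L} u sub = subst (length L ≤_) (length-elements S) (length-⊆ u (∈-elements⁺ S ∘ sub))

  count-∈ : (S : Subset n) {L : List (Fin n)} → Unique L → (∀ {v} → v ∈ S → v ∈ₗ L) → count (_∈? S) L ≡ ∣ S ∣
  count-∈ S {L} u sub = ≤-antisym
    (size-≥ S (Unique.filter⁺ (_∈? S) u) (proj₂ ∘ ∈-filter⁻ (_∈? S) {xs = L}))
    (size-≤ S λ v∈ → ∈-filter⁺ (_∈? S) (sub v∈) v∈)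

  Unique-allFin : Unique (allFin n)
  Unique-allFin = Unique.allFin⁺ n

  length-allFin : length (allFin n) ≡ n
  length-allFin = length-tabulate id

  fromList : List (Fin n) → Subset n
  fromList [] = ⊥
  fromList (v ∷ L) = ⁅ v ⁆ ∪ fromList L

  ∈-fromList⁺ : ∀ {v} L → v ∈ₗ L → v ∈ fromList L
  ∈-fromList⁺ (v ∷ L) (here refl) = x∈p∪q⁺ (inj₁ (x∈⁅x⁆ v))
  ∈-fromList⁺ (v ∷ L) (there p) = x∈p∪q⁺ (inj₂ (∈-fromList⁺ L p))

  ∈-fromList⁻ : ∀ {v} L → v ∈ fromList L → v ∈ₗ L
  ∈-fromList⁻ [] p = absurd (∉⊥ p)
  ∈-fromList⁻ (w ∷ L) p with x∈p∪q⁻ ⁅ w ⁆ (fromList L) p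
  ... | inj₁ q = here (x∈⁅y⁆⇒x≡y w q)
  ... | inj₂ q = there (∈-fromList⁻ L q)

  size-fromList : ∀ {L} → Unique L → ∣ fromList L ∣ ≡ length L
  size-fromList {L} u = ≤-antisym (size-≤ (fromList L) (∈-fromList⁻ L)) (size-≥ (fromList L) u (∈-fromList⁺ L))

  subset-between : ∀ X Z {k} → Unique (X ++ Z) → length X ≤ k → k ≤ length X + length Z →
    Σ (Subset n) λ S → (∣ S ∣ ≡ k) × (∀ {v} → v ∈ₗ X → v ∈ S) × (∀ {v} → v ∈ S → v ∈ₗ X ++ Z)
  subset-between X [] {k} u lo hi = fromList X ,
    trans (size-fromList (Unique-++ˡ X u)) (≤-antisym lo (subst (k ≤_) (+-identityʳ _) hi)) ,
    ∈-fromList⁺ X , ∈-++⁺ˡ ∘ ∈-fromList⁻ X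
  subset-between X (z ∷ Z) {k} u lo hi with m≤n⇒m<n∨m≡n lo
  ... | inj₂ refl = fromList X , size-fromList (Unique-++ˡ X u) , ∈-fromList⁺ X , ∈-++⁺ˡ ∘ ∈-fromList⁻ X
  ... | inj₁ lt with subset-between (z ∷ X) Z (Unique-resp-↭ (shift z X Z) u) lt (subst (k ≤_) (+-suc _ _) hi)
  ... | S , sz , sub , sup = S , sz , sub ∘ there , ∈-resp-↭ (↭-sym (shift z X Z)) ∘ sup

  -- Induction on `L`: the family is split by whether a member contains the first vertex `z`, and
  -- the two bounds add up by Pascal's rule. Vertices of `L` that lie in `X` or are repeated only
  -- make the bound weaker.
  family-bound : ∀ {r} X L {Es : List (Subset n)} → Unique Es → Unique X →
    (∀ {e} → e ∈ₗ Es → ∣ e ∣ ≡ r × (∀ {v} → v ∈ₗ X → v ∈ e) × (∀ {v} → v ∈ e → v ∈ₗ X ++ L)) →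
    length Es ≤ length L C (r ∸ length X)
  family-bound X L {[]} u uX h = z≤n
  family-bound {r} X [] {e ∷ Es} u uX h with h (here refl)
  ... | sz , sub , sup = subst (λ k → suc (length Es) ≤ 0 C k) (sym (m≤n⇒m∸n≡0 r≤)) (one Es u (h ∘ there))
    where
    r≤ : r ≤ length X
    r≤ = subst₂ _≤_ sz (cong length (++-identityʳ X)) (size-≤ e sup)
    one : ∀ Es → Unique (e ∷ Es) →
          (∀ {e} → e ∈ₗ Es → ∣ e ∣ ≡ r × (∀ {v} → v ∈ₗ X → v ∈ e) × (∀ {v} → v ∈ e → v ∈ₗ X ++ [])) →
          suc (length Es) ≤ 1
    one [] _ _ = s≤s z≤n
    one (e′ ∷ _) ((e≢ ∷ _) ∷ _) k with k (here refl)
    ... | _ , sub′ , sup′ = absurd (e≢ (⊆-antisym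
        (λ {v} v∈ → sub′ (subst (v ∈ₗ_) (++-identityʳ X) (sup v∈)))
        (λ {v} v∈ → sub (subst (v ∈ₗ_) (++-identityʳ X) (sup′ v∈)))))
  family-bound {r} X (z ∷ L) {Es@(e₀ ∷ _)} u uX h with Any.any? (z F.≟_) X
  ... | yes z∈X = ≤-trans (family-bound X L u uX λ e∈ → let sz , sub , sup = h e∈ in sz , sub , drop-z ∘ sup)
                    (C-mono (length L) (r ∸ length X))
    where
    drop-z : ∀ {v} → v ∈ₗ X ++ z ∷ L → v ∈ₗ X ++ L
    drop-z {v} p with ∈-++⁻ X p
    ... | inj₁ q = ∈-++⁺ˡ q
    ... | inj₂ (here refl) = ∈-++⁺ˡ z∈X
    ... | inj₂ (there q) = ∈-++⁺ʳ X q
    C-mono : ∀ a k → a C k ≤ suc a C k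
    C-mono a zero = ≤-refl
    C-mono a (suc k) = subst (a C suc k ≤_) (nCk+nC[k+1]≡[n+1]C[k+1] a k) (m≤n+m _ _)
  ... | no z∉X = subst (_≤ suc (length L) C (r ∸ length X)) (count-¬ (z ∈?_) Es) bound
    where
    with-z : ∀ {e} → e ∈ₗ filter (z ∈?_) Es → ∣ e ∣ ≡ r × (∀ {v} → v ∈ₗ z ∷ X → v ∈ e) × (∀ {v} → v ∈ e → v ∈ₗ (z ∷ X) ++ L)
    with-z {e} e∈ with ∈-filter⁻ (z ∈?_) {xs = Es} e∈
    ... | e∈Es , z∈e with h e∈Es
    ... | sz , sub , sup = sz , (λ { (here refl) → z∈e ; (there p) → sub p }) , ∈-resp-↭ (shift z X L) ∘ sup
    without-z : ∀ {e} → e ∈ₗ filter (¬? ∘ (z ∈?_)) Es → ∣ e ∣ ≡ r × (∀ {v} → v ∈ₗ X → v ∈ e) × (∀ {v} → v ∈ e → v ∈ₗ X ++ L)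
    without-z {e} e∈ with ∈-filter⁻ (¬? ∘ (z ∈?_)) {xs = Es} e∈
    ... | e∈Es , z∉e with h e∈Es
    ... | sz , sub , sup = sz , sub , λ {v} v∈ → case ∈-resp-↭ (shift z X L) (sup v∈) of λ
            { (here refl) → absurd (z∉e v∈) ; (there p) → p }
    b₁ : count (¬? ∘ (z ∈?_)) Es ≤ length L C (r ∸ length X)
    b₁ = family-bound X L (Unique.filter⁺ (¬? ∘ (z ∈?_)) u) uX without-z
    b₀ : count (z ∈?_) Es ≤ length L C (r ∸ suc (length X))
    b₀ = family-bound (z ∷ X) L (Unique.filter⁺ (z ∈?_) u) (Unique-∷ z∉X uX) with-z
    bound : count (z ∈?_) Es + count (¬? ∘ (z ∈?_)) Es ≤ suc (length L) C (r ∸ length X)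
    bound with r ∸ length X in eq | b₁
    ... | suc k | b₁′ = subst (_ ≤_) (nCk+nC[k+1]≡[n+1]C[k+1] (length L) k)
          (+-mono-≤ (subst (λ j → _ ≤ length L C j) (trans (sym (pred[m∸n]≡m∸[1+n] r (length X))) (cong ℕ.pred eq)) b₀) b₁′)
    ... | zero | b₁′ = ≤-trans (≤-reflexive (cong (_+ count (¬? ∘ (z ∈?_)) Es) (count-none (z ∈?_) {Es} none))) b₁′
      where
      none : ∀ {e} → e ∈ₗ Es → ¬ (z ∈ e)
      none {e} e∈ z∈e with h e∈
      ... | sz , sub , _ = <-irrefl refl (≤-trans (s≤s (m∸n≡0⇒m≤n eq))
            (subst (suc (length X) ≤_) sz (size-≥ e (Unique-∷ z∉X uX) λ { (here refl) → z∈e ; (there p) → sub p })))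

C-mono : ∀ a k → a C k ≤ suc a C k
C-mono a zero = ≤-refl
C-mono a (suc k) = subst (a C suc k ≤_) (nCk+nC[k+1]≡[n+1]C[k+1] a k) (m≤n+m _ _)

C-mono-≤ : ∀ {a b} k → a ≤ b → a C k ≤ b C k
C-mono-≤ {a} k a≤b with m≤n⇒∃[o]m+o≡n a≤b
... | o , refl = go o
  where
  go : ∀ o → a C k ≤ (a + o) C k
  go zero = ≤-reflexive (cong (_C k) (sym (+-identityʳ a)))
  go (suc o) = ≤-trans (go o) (subst (λ c → (a + o) C k ≤ c C k) (sym (+-suc a o)) (C-mono (a + o) k))

C-linear : ∀ a k → 1 ≤ k → k < a → a ≤ a C k
C-linear (suc a) (suc zero) _ _ = ≤-reflexive (sym (nC1≡n (suc a)))
C-linear (suc a) (suc (suc k)) _ (s≤s k<a) =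
  subst (suc a ≤_) (nCk+nC[k+1]≡[n+1]C[k+1] a (suc k))
    (subst (_≤ a C suc k + a C suc (suc k)) (+-comm a 1) (+-mono-≤ (C-linear a (suc k) (s≤s z≤n) k<a) rest))
  where
  rest : 1 ≤ a C suc (suc k)
  rest with m≤n⇒m<n∨m≡n k<a
  ... | inj₁ lt = ≤-trans (≤-trans (s≤s z≤n) k<a) (C-linear a (suc (suc k)) (s≤s z≤n) lt)
  ... | inj₂ refl = ≤-reflexive (sym (nCn≡1 a))

-- Pascal's rule, where C(j, ρ - 1) ≥ j because 1 ≤ ρ - 1 < j.
C-step : ∀ j ρ → 2 ≤ ρ → ρ ≤ j → j C ρ + j ≤ suc j C ρ
C-step j (suc k) (s≤s 1≤k) k<j = subst (j C suc k + j ≤_) (trans (+-comm (j C suc k) _) (nCk+nC[k+1]≡[n+1]C[k+1] j k))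
  (+-monoʳ-≤ (j C suc k) (C-linear j k 1≤k k<j))

-- This makes small sets of reached vertices lose: with `d` vertices fewer, about 2d more links are
-- available to carry an end in their labels, but at least 2d sets are lost.
C-growth : ∀ a d ρ → 2 ≤ ρ → ρ ≤ a → a C ρ + 2 * d ≤ (a + d) C ρ
C-growth a zero ρ _ _ = ≤-reflexive (trans (+-identityʳ _) (cong (_C ρ) (sym (+-identityʳ a))))
C-growth a (suc d) ρ 2≤ρ ρ≤a = begin
  a C ρ + 2 * suc d     ≡⟨ lem (a C ρ) d ⟩
  (a C ρ + 2 * d) + 2   ≤⟨ +-mono-≤ (C-growth a d ρ 2≤ρ ρ≤a) (≤-trans 2≤ρ (≤-trans ρ≤a (m≤m+n a d))) ⟩
  (a + d) C ρ + (a + d) ≤⟨ C-step (a + d) ρ 2≤ρ (≤-trans ρ≤a (m≤m+n a d)) ⟩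
  suc (a + d) C ρ       ≡⟨ cong (_C ρ) (sym (+-suc a d)) ⟩
  (a + suc d) C ρ ∎
  where
  open ≤-Reasoning
  lem : ∀ c d → c + 2 * suc d ≡ (c + 2 * d) + 2
  lem = solve-∀

-- Vertices in labels

module _ {n : ℕ} where

  infix 4 _∈ˡ_
  -- The special label contains no vertex, so that counting labels through a vertex counts edges
  -- only.
  _∈ˡ_ : Fin n → Label n → Set
  v ∈ˡ just e  = v ∈ e
  v ∈ˡ nothing = Empty

  _∈ˡ?_ : ∀ v (ℓ : Label n) → Dec (v ∈ˡ ℓ)
  v ∈ˡ? just e  = v ∈? e
  v ∈ˡ? nothing = no λ ()

  on? : ∀ v (l : Link n) → Dec (v ∈ˡ label l)
  on? v l = v ∈ˡ? label l

  -- `L` has at least n - r vertices, so an r-set that misses all of them is the complement of `L`.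
  complement-unique : ∀ {r L} {e e′ : Subset n} → Unique L → n ≤ length L + r → ∣ e ∣ ≡ r → ∣ e′ ∣ ≡ r →
    (∀ {v} → v ∈ₗ L → ¬ v ∈ e) → (∀ {v} → v ∈ₗ L → ¬ v ∈ e′) → e ≡ e′
  complement-unique {r} {L} u n≤ sz sz′ d d′ = ⊆-antisym (sub _ _ sz′ d′ d) (sub _ _ sz d d′)
    where
    sub : ∀ e e′ → ∣ e′ ∣ ≡ r → (∀ {v} → v ∈ₗ L → ¬ v ∈ e′) → (∀ {v} → v ∈ₗ L → ¬ v ∈ e) → e ⊆ e′
    sub e e′ sz′ d′ d {v} v∈e with v ∈? e′
    ... | yes v∈e′ = v∈e′
    ... | no v∉e′ = contradiction (≤-trans too-many (≤-trans n≤ (≤-reflexive (+-comm (length L) r)))) (<⇒≱ ≤-refl)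
      where
      U : Unique (v ∷ elements e′ ++ L)
      U = Unique-∷ (λ p → [ v∉e′ ∘ ∈-elements⁻ e′ , (λ q → d q v∈e) ]′ (∈-++⁻ (elements e′) p))
            (Unique.++⁺ (Unique-elements e′) u λ (p , q) → d′ q (∈-elements⁻ e′ p))
      too-many : suc (r + length L) ≤ n
      too-many = subst₂ _≤_ (cong suc (trans (length-++ (elements e′)) (cong (_+ length L) (trans (length-elements e′) sz′))))
                   length-allFin (length-⊆ U (λ _ → ∈-allFin _))

  labels-distinct : ∀ {P : Link n → Set} (P? : Decidable P) {ls : List (Link n)} → Unique (labels ls) → 2 ≤ count P? ls →
    ∃₂ λ l l′ → (l ∈ₗ ls × P l) × (l′ ∈ₗ ls × P l′) × label l ≢ label l′
  labels-distinct P? {ls} u two with filter P? ls in eq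
  labels-distinct P? {ls} u (s≤s ()) | _ ∷ []
  ... | l ∷ l′ ∷ _ = l , l′ , ∈-filter⁻ P? {xs = ls} (subst (l ∈ₗ_) (sym eq) (here refl)) ,
    ∈-filter⁻ P? {xs = ls} (subst (l′ ∈ₗ_) (sym eq) (there (here refl))) , distinct (subst (λ zs → Unique (labels zs)) eq uf)
    where
    uf : Unique (labels (filter P? ls))
    uf = AllPairs.map⁺ (AllPairs.filter⁺ P? (AllPairs.map⁻ u))
    distinct : ∀ {zs} → Unique (labels (l ∷ l′ ∷ zs)) → label l ≢ label l′
    distinct ((≢ ∷ _) ∷ _) = ≢

  ∈-head-link : ∀ {t} {ls : List (Link n)} → t ∈ₗ heads ls → ∃₂ λ a ℓ → a ⟨ ℓ ⟩ t ∈ₗ ls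
  ∈-head-link p with ∈-map⁻ head p
  ... | (a ⟨ ℓ ⟩ _) , l∈ , refl = a , ℓ , l∈

  ∈-tail-link : ∀ {t} {ls : List (Link n)} → t ∈ₗ tails ls → ∃₂ λ ℓ b → t ⟨ ℓ ⟩ b ∈ₗ ls
  ∈-tail-link p with ∈-map⁻ tail p
  ... | (_ ⟨ ℓ ⟩ b) , l∈ , refl = ℓ , b , l∈

  ∈-rev : ∀ {l : Link n} {ls} → l ∈ₗ ls → flip l ∈ₗ rev ls
  ∈-rev {ls = k ∷ ls} (here refl) = ∈-++⁺ʳ (rev ls) (here refl)
  ∈-rev {ls = k ∷ ls} (there p) = ∈-++⁺ˡ (∈-rev p)

  count-rev : ∀ {P : Link n → Set} (P? : Decidable P) ls → count P? (rev ls) ≡ count (P? ∘ flip) ls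
  count-rev P? [] = refl
  count-rev P? (l ∷ ls) = trans (count-++ P? (rev ls) [ flip l ])
    (trans (cong (_+ count P? [ flip l ]) (count-rev P? ls)) (last (P? (flip l)) refl))
    where
    last : ∀ d → d ≡ P? (flip l) → count (P? ∘ flip) ls + count P? [ flip l ] ≡ count (P? ∘ flip) (l ∷ ls)
    last (yes p) _ = trans (cong (count (P? ∘ flip) ls +_) (count-yes P? {xs = []} p))
      (trans (+-comm _ 1) (sym (count-yes (P? ∘ flip) {xs = ls} p)))
    last (no ¬p) _ = trans (cong (count (P? ∘ flip) ls +_) (count-no P? {xs = []} ¬p))
      (trans (+-identityʳ _) (sym (count-no (P? ∘ flip) {xs = ls} ¬p)))

module _ {A : Set} where
  pick₂ : ∀ {f g : A} {F} → f ∈ₗ F → g ∈ₗ F → f ≢ g → ∃ λ F′ → F ↭ f ∷ g ∷ F′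
  pick₂ {f} {g} f∈ g∈ f≢g with ∈-∃++ f∈
  ... | xs , ys , refl with ∈-resp-↭ (shift f xs ys) g∈
  ... | here eq = absurd (f≢g (sym eq))
  ... | there g∈′ with ∈-∃++ g∈′
  ... | us , vs , eq = us ++ vs , ↭-trans (shift f xs ys) (prep f (↭-trans (↭-reflexive eq) (shift g us vs)))

  two-of : ∀ {P : A → Set} (P? : Decidable P) {xs} → Unique xs → 2 ≤ count P? xs → (≟ : ∀ (a b : A) → Dec (a ≡ b)) → ∀ h →
    ∃ λ h′ → h′ ∈ₗ xs × P h′ × h′ ≢ h
  two-of P? {xs} u two _≟_ h with filter P? xs in eq
  two-of P? {xs} u (s≤s ()) _≟_ h | _ ∷ []
  ... | a ∷ b ∷ _ with a ≟ h | ∈-filter⁻ P? {xs = xs} (subst (a ∈ₗ_) (sym eq) (here refl))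
                           | ∈-filter⁻ P? {xs = xs} (subst (b ∈ₗ_) (sym eq) (there (here refl)))
  ... | no a≢h | a∈ , pa | _ = a , a∈ , pa , a≢h
  ... | yes refl | _ | b∈ , pb = b , b∈ , pb , λ b≡a → distinct (subst Unique eq (Unique.filter⁺ P? u)) (sym b≡a)
    where
    distinct : ∀ {zs} → Unique (a ∷ b ∷ zs) → a ≢ b
    distinct ((≢ ∷ _) ∷ _) = ≢

_≟ˢ_ : ∀ {n} (e f : Subset n) → Dec (e ≡ f)
_≟ˢ_ = ≡-dec Bool._≟_

module Edges {n ρ : ℕ} (x y : Fin n) (E : List (Subset n)) (uniq : Unique E)
             (unif : ∀ {e} → e ∈ₗ E → ∣ e ∣ ≡ suc ρ) where
  open Chains x y public
  open States E public

  just⁻ : ∀ {e : Subset n} {F} → just e ∈ₗ map just F → e ∈ₗ F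
  just⁻ p with ∈-map⁻ just p
  ... | _ , q , refl = q

  module _ {ls : List (Link n)} {F : List (Subset n)} (uses : labels ls ++ map just F ↭ map just E) where

    line-label : ∀ {l} → l ∈ₗ ls → ∃ λ e → label l ≡ just e × e ∈ₗ E
    line-label l∈ with ∈-map⁻ just (∈-resp-↭ uses (∈-++⁺ˡ (∈-map⁺ label l∈)))
    ... | e , e∈ , eq = e , eq , e∈

    free∈E : ∀ {f} → f ∈ₗ F → f ∈ₗ E
    free∈E f∈ = just⁻ (∈-resp-↭ uses (∈-++⁺ʳ (labels ls) (∈-map⁺ just f∈)))

    E-cases : ∀ {e} → e ∈ₗ E → (∃₂ λ a b → a ⟨ just e ⟩ b ∈ₗ ls) ⊎ (e ∈ₗ F)
    E-cases e∈ with ∈-++⁻ (labels ls) (∈-resp-↭ (↭-sym uses) (∈-map⁺ just e∈))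
    ... | inj₂ p = inj₂ (just⁻ p)
    ... | inj₁ p with ∈-map⁻ label p
    ... | (a ⟨ _ ⟩ b) , l∈ , refl = inj₁ (a , b , l∈)

    line-unique : Unique (labels ls ++ map just F)
    line-unique = Unique-resp-↭ (↭-sym uses) (Unique.map⁺ just-injective uniq)

    free-unique : Unique F
    free-unique = Unique.map⁻ (Unique-++ʳ (labels ls) line-unique)

    degree-split : ∀ v → count (on? v) ls + count (v ∈?_) F ≡ count (v ∈?_) E
    degree-split v = trans (sym (cong₂ _+_ (count-map (v ∈ˡ?_) label ls) (count-map (v ∈ˡ?_) just F)))
      (trans (sym (count-++ (v ∈ˡ?_) (labels ls) (map just F)))
      (trans (count-↭ (v ∈ˡ?_) uses) (count-map (v ∈ˡ?_) just E)))

  module _ {z p q ls F} (L : LineBut z p q ls F) where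
    private
      c = proj₁ (proj₁ L)
      uses = proj₂ (proj₂ (proj₁ L))
      vs = proj₂ L

    spine-unique : Unique (z ∷ p ∷ heads ls)
    spine-unique = Unique-resp-↭ (↭-sym vs) Unique-allFin

    spine∌z : z ∉ₗ p ∷ heads ls
    spine∌z = ∉-head spine-unique

    spine-complete : ∀ {v} → v ≢ z → v ∈ₗ p ∷ heads ls
    spine-complete {v} v≢z with ∈-resp-↭ (↭-sym vs) (∈-allFin v)
    ... | here eq = absurd (v≢z eq)
    ... | there v∈ = v∈

    line-length : suc (suc (length ls)) ≡ n
    line-length = trans (cong (suc ∘ suc) (sym (length-map head ls))) (trans (↭-length vs) length-allFin)

    module _ {P : Fin n → Set} (P? : Decidable P) where
      count-tails : count (P? ∘ tail) ls + count P? [ q ] ≡ count P? (p ∷ heads ls)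
      count-tails = trans (cong (_+ count P? [ q ]) (sym (count-map P? tail ls)))
        (trans (sym (count-++ P? (tails ls) [ q ])) (cong (count P?) (tails-chain c)))

      count-heads : count P? [ p ] + count (P? ∘ head) ls ≡ count P? (p ∷ heads ls)
      count-heads = trans (cong (count P? [ p ] +_) (sym (count-map P? head ls))) (sym (count-++ P? [ p ] (heads ls)))

  insert∈ : ∀ {z p q ls F v e v′ f g F′} → LineBut z p q ls F → v ⟨ just e ⟩ v′ ∈ₗ ls →
            e ∷ F ↭ f ∷ g ∷ F′ → v ∈ f → z ∈ f → z ∈ g → v′ ∈ g → Ham
  insert∈ L l∈ perm a b c d with ∈-∃++ l∈
  ... | l₁ , l₂ , refl = insert l₁ L perm a b c d

  cross∈ : ∀ {w u ls F a e b f g F′} → Gap w u ls F → a ⟨ just e ⟩ b ∈ₗ ls →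
           e ∷ F ↭ f ∷ g ∷ F′ → a ∈ f → u ∈ f → w ∈ g → b ∈ g → Ham
  cross∈ G l∈ perm a b c d with ∈-∃++ l∈
  ... | l₁ , l₂ , refl = Cycle⇒Ham (cross l₁ G perm a b c d)

  -- Only the link into `v′` is opened, and along a path a link is determined by its head. Every
  -- other link therefore survives in the new path.
  place∈ : ∀ {z p q ls F v e v′ h F′} → LineBut z p q ls F → v ⟨ just e ⟩ v′ ∈ₗ ls →
           F ↭ h ∷ F′ → z ∈ h → v ∈ h →
           ∃ λ ms → Gap v′ z ms (e ∷ F′) × (∀ {l} → l ∈ₗ ls → head l ≢ v′ → l ∈ₗ ms)
  place∈ {q = q} L l∈ perm zh vh with ∈-∃++ l∈
  ... | l₁ , l₂ , refl = _ , place l₁ L perm zh vh , λ {l} → keep {l}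
    where
    keep : ∀ {l} → l ∈ₗ l₁ ++ _ ∷ l₂ → head l ≢ _ → l ∈ₗ l₂ ++ q ⟨ nothing ⟩ _ ∷ (l₁ ++ _)
    keep p hd≢ with ∈-++⁻ l₁ p
    ... | inj₁ q = ∈-++⁺ʳ l₂ (there (∈-++⁺ˡ q))
    ... | inj₂ (here refl) = absurd (hd≢ refl)
    ... | inj₂ (there q) = ∈-++⁺ˡ q

-- H is (1 + ρ)-uniform and m = ⌊n/2⌋; all three cases of the theorem satisfy these bounds on the degree δ.
record Counterexample : Set where
  field
    {n ρ m δ} : ℕ
    x y   : Fin n
    E     : List (Subset n)
    uniq  : Unique E
    unif  : ∀ {e} → e ∈ₗ E → ∣ e ∣ ≡ suc ρ
    ¬ham  : ¬ Chains.States.Ham x y E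
    deg   : ∀ v → δ ≤ count (v ∈?_) E
    2≤ρ   : 2 ≤ ρ
    ρ<n   : suc ρ < n
    n≤    : n ≤ suc (2 * m)
    C<δ   : m C ρ < δ
    n≤δ+r : n ≤ δ + suc ρ
    ρ≤δ   : ρ ≤ δ
    enough : n ≤ suc (length E)
    slack : ρ < m ⊎ suc (m C ρ) < δ

-- Relabelling the links of a path

∈-rev⁻ : ∀ {n} {l : Link n} ls → l ∈ₗ rev ls → flip l ∈ₗ ls
∈-rev⁻ (k ∷ ls) p with ∈-++⁻ (rev ls) p
... | inj₁ q = there (∈-rev⁻ ls q)
... | inj₂ (here refl) = here refl

-- The difference is C(a - 1, b - 1), the number of b-sets through a fixed one of `a` elements, and
-- this is at least a - 1 ≥ 2. It yields the second free edge demanded in `Covered`.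
C-drop : ∀ a b → 2 ≤ b → b < a → 2 + ℕ.pred a C b ≤ a C b
C-drop (suc a) (suc b) (s≤s 1≤b) (s≤s b<a) = subst (2 + a C suc b ≤_) (nCk+nC[k+1]≡[n+1]C[k+1] a b)
  (+-monoˡ-≤ (a C suc b) (≤-trans (s≤s 1≤b) (≤-trans b<a (C-linear a b 1≤b b<a))))

length-one : ∀ {A : Set} {xs : List A} {a b} → length xs ≡ 1 → a ∈ₗ xs → b ∈ₗ xs → a ≡ b
length-one {xs = _ ∷ []} _ (here refl) (here refl) = refl

-- The vertices, their order and the place of the special link agree, while ordinary labels may
-- differ. After relabelling, a link required later is still found at its position, with some label.
data Similar {n : ℕ} : List (Link n) → List (Link n) → Set where
  []      : Similar [] []
  ordinary : ∀ {a e e′ b ls ms} → Similar ls ms → Similar (a ⟨ just e ⟩ b ∷ ls) (a ⟨ just e′ ⟩ b ∷ ms)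
  special : ∀ {a b ls ms} → Similar ls ms → Similar (a ⟨ nothing ⟩ b ∷ ls) (a ⟨ nothing ⟩ b ∷ ms)

module _ {n : ℕ} where
  Similar-refl : (ls : List (Link n)) → Similar ls ls
  Similar-refl [] = []
  Similar-refl (a ⟨ just e ⟩ b ∷ ls) = ordinary (Similar-refl ls)
  Similar-refl (a ⟨ nothing ⟩ b ∷ ls) = special (Similar-refl ls)

  Similar-trans : {ks ls ms : List (Link n)} → Similar ks ls → Similar ls ms → Similar ks ms
  Similar-trans [] [] = []
  Similar-trans (ordinary s) (ordinary t) = ordinary (Similar-trans s t)
  Similar-trans (special s) (special t) = special (Similar-trans s t)

  Similar-at : ∀ l₁ {a e f b} {l₂ : List (Link n)} → Similar (l₁ ++ a ⟨ just e ⟩ b ∷ l₂) (l₁ ++ a ⟨ just f ⟩ b ∷ l₂)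
  Similar-at [] = ordinary (Similar-refl _)
  Similar-at (c ⟨ just _ ⟩ d ∷ l₁) = ordinary (Similar-at l₁)
  Similar-at (c ⟨ nothing ⟩ d ∷ l₁) = special (Similar-at l₁)

  Similar-split : ∀ l₁ {l₂ ms : List (Link n)} → Similar (l₁ ++ l₂) ms →
                  ∃₂ λ m₁ m₂ → ms ≡ m₁ ++ m₂ × tails m₁ ≡ tails l₁ × Similar l₂ m₂
  Similar-split [] s = [] , _ , refl , refl , s
  Similar-split (_ ∷ l₁) (ordinary s) with Similar-split l₁ s
  ... | m₁ , m₂ , refl , eq , t = _ ∷ m₁ , m₂ , refl , cong (_ ∷_) eq , t
  Similar-split (_ ∷ l₁) (special s) with Similar-split l₁ s
  ... | m₁ , m₂ , refl , eq , t = _ ∷ m₁ , m₂ , refl , cong (_ ∷_) eq , t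

  Similar-∈ : ∀ {a e b} {ls ms : List (Link n)} → Similar ls ms → a ⟨ just e ⟩ b ∈ₗ ls → ∃ λ e′ → a ⟨ just e′ ⟩ b ∈ₗ ms
  Similar-∈ (ordinary s) (here refl) = _ , here refl
  Similar-∈ (ordinary s) (there p) with Similar-∈ s p
  ... | e′ , q = e′ , there q
  Similar-∈ (special s) (there p) with Similar-∈ s p
  ... | e′ , q = e′ , there q

-- Edges at t that can be made free by relabelling at most two links within the edges at t.
data Freeable {n : ℕ} (t : Fin n) (ls : List (Link n)) (F : List (Subset n)) : Subset n → Set where
  now   : ∀ {e} → e ∈ₗ F → t ∈ e → Freeable t ls F e
  once  : ∀ {a e b f} → a ⟨ just e ⟩ b ∈ₗ ls → t ∈ e → f ∈ₗ F → t ∈ f → a ∈ f → b ∈ f → Freeable t ls F e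
  twice : ∀ {a e b a′ e′ b′ f} → a ⟨ just e ⟩ b ∈ₗ ls → t ∈ e → a′ ⟨ just e′ ⟩ b′ ∈ₗ ls → t ∈ e′ → e ≢ e′ →
          f ∈ₗ F → t ∈ f → a′ ∈ f → b′ ∈ f → a ∈ e′ → b ∈ e′ → Freeable t ls F e

Freeable-∋ : ∀ {n} {t : Fin n} {ls F e} → Freeable t ls F e → t ∈ e
Freeable-∋ (now _ te) = te
Freeable-∋ (once _ te _ _ _ _) = te
Freeable-∋ (twice _ te _ _ _ _ _ _ _ _ _) = te

-- Free edges and labels occur in `Freeable` only if they contain `t`, so it suffices to transport
-- those. A reversed link does no harm, since both of its ends are subject to the same condition.
Freeable-map : ∀ {n} {t : Fin n} {ls F ls′ F′ e} → (∀ {f} → f ∈ₗ F → t ∈ f → f ∈ₗ F′) →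
  (∀ {a e b} → a ⟨ just e ⟩ b ∈ₗ ls → t ∈ e → a ⟨ just e ⟩ b ∈ₗ ls′ ⊎ b ⟨ just e ⟩ a ∈ₗ ls′) →
  Freeable t ls F e → Freeable t ls′ F′ e
Freeable-map φ ψ (now e∈ te) = now (φ e∈ te) te
Freeable-map φ ψ (once l∈ te f∈ tf af bf) with ψ l∈ te
... | inj₁ l = once l te (φ f∈ tf) tf af bf
... | inj₂ l = once l te (φ f∈ tf) tf bf af
Freeable-map φ ψ (twice l∈ te l′∈ te′ ne f∈ tf af bf ae be) with ψ l∈ te | ψ l′∈ te′
... | inj₁ l | inj₁ l′ = twice l te l′ te′ ne (φ f∈ tf) tf af bf ae be
... | inj₁ l | inj₂ l′ = twice l te l′ te′ ne (φ f∈ tf) tf bf af ae be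
... | inj₂ l | inj₁ l′ = twice l te l′ te′ ne (φ f∈ tf) tf af bf be ae
... | inj₂ l | inj₂ l′ = twice l te l′ te′ ne (φ f∈ tf) tf bf af be ae

C-pred : ∀ {a} k → 1 ≤ a → ℕ.pred a C suc k + ℕ.pred a C k ≡ a C suc k
C-pred {suc a} k _ = trans (+-comm (a C suc k) _) (nCk+nC[k+1]≡[n+1]C[k+1] a k)

-- Sets of a fixed size that avoid a pair

module _ {n : ℕ} where
  edgesOf : List (Link n) → List (Subset n)
  edgesOf [] = []
  edgesOf (_ ⟨ just e ⟩ _ ∷ ls) = e ∷ edgesOf ls
  edgesOf (_ ⟨ nothing ⟩ _ ∷ ls) = edgesOf ls

  ∈-edgesOf⁻ : ∀ {e} ls → e ∈ₗ edgesOf ls → ∃₂ λ a b → a ⟨ just e ⟩ b ∈ₗ ls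
  ∈-edgesOf⁻ (a ⟨ just e ⟩ b ∷ ls) (here refl) = a , b , here refl
  ∈-edgesOf⁻ (_ ⟨ just _ ⟩ _ ∷ ls) (there p) with ∈-edgesOf⁻ ls p
  ... | a , b , q = a , b , there q
  ∈-edgesOf⁻ (_ ⟨ nothing ⟩ _ ∷ ls) p with ∈-edgesOf⁻ ls p
  ... | a , b , q = a , b , there q

  labels-edgesOf : ∀ ls → (∀ {k} → k ∈ₗ ls → ∃ λ e → label k ≡ just e) → map just (edgesOf ls) ≡ labels ls
  labels-edgesOf [] h = refl
  labels-edgesOf (_ ⟨ just e ⟩ _ ∷ ls) h = cong (just e ∷_) (labels-edgesOf ls (h ∘ there))
  labels-edgesOf (_ ⟨ nothing ⟩ _ ∷ ls) h with h (here refl)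
  ... | _ , ()

  Avoiding : ∀ u L (a b : Fin n) r → List (Subset n) → Set
  Avoiding u L a b r 𝓖 = Unique 𝓖 × (∀ {g} → g ∈ₗ 𝓖 → ∣ g ∣ ≡ r × u ∈ g × (∀ {v} → v ∈ g → v ∈ₗ u ∷ L) × ¬ (a ∈ g × b ∈ g))

  without : ∀ {v : Fin n} {L} → v ∈ₗ L → ∃ λ L′ → L ↭ v ∷ L′
  without v∈ with ∈-∃++ v∈
  ... | L₁ , L₂ , refl = L₁ ++ L₂ , shift _ L₁ L₂

  -- All members contain `u`, so avoiding the pair of `a` and `u` means missing `a`.
  avoid-end : ∀ {ρ u L a 𝓖} → a ∈ₗ L → Avoiding u L a u (suc ρ) 𝓖 → length 𝓖 ≤ ℕ.pred (length L) C ρ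
  avoid-end {ρ} {u} {L} {a} {𝓖} a∈ (u𝓖 , h) with without a∈
  ... | L′ , perm = subst (λ k → length 𝓖 ≤ k C ρ) (cong ℕ.pred (sym (↭-length perm)))
      (family-bound [ u ] L′ u𝓖 ([] ∷ []) λ g∈ → let sz , ug , sub , ¬ab = h g∈ in
        sz , (λ { (here refl) → ug }) , λ v∈ → case ∈-resp-↭ (prep u perm) (sub v∈) of λ
          { (here eq) → here eq ; (there (here refl)) → absurd (¬ab (v∈ , ug)) ; (there (there p)) → there p })

  -- The summand `l C ρ` is the number of sets of size ρ + 3 through `u`, `a` and `b` inside u ∪ L;
  -- none of them is in the family.
  avoid-inner : ∀ {ρ u L a b 𝓖} → Unique (u ∷ L) → a ∈ₗ L → b ∈ₗ L → a ≢ b → Avoiding u L a b (3 + ρ) 𝓖 →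
    ∃ λ l → length L ≡ suc (suc l) × length 𝓖 + l C ρ ≤ length L C (2 + ρ)
  avoid-inner {ρ} {u} {L} {a} {b} {𝓖} uL a∈ b∈ a≢b (u𝓖 , h) with without a∈
  ... | L₁ , perm₁ with ∈-resp-↭ perm₁ b∈
  ... | here eq = absurd (a≢b (sym eq))
  ... | there b∈₁ with without b∈₁
  ... | L₂ , perm₂ = length L₂ , len , bound
    where
    perm : L ↭ a ∷ b ∷ L₂
    perm = ↭-trans perm₁ (prep a perm₂)
    len : length L ≡ suc (suc (length L₂))
    len = ↭-length perm
    l = length L₂
    a≢u : a ≢ u
    a≢u refl = ∉-head uL a∈
    with-a : count (a ∈?_) 𝓖 ≤ l C (1 + ρ)
    with-a = family-bound (a ∷ u ∷ []) L₂ (Unique.filter⁺ (a ∈?_) u𝓖) ((a≢u ∷ []) ∷ [] ∷ []) λ g∈ →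
      let g∈𝓖 , ag = ∈-filter⁻ (a ∈?_) {xs = 𝓖} g∈ ; sz , ug , sub , ¬ab = h g∈𝓖 in
      sz , (λ { (here refl) → ag ; (there (here refl)) → ug }) , λ v∈ → case ∈-resp-↭ (prep u perm) (sub v∈) of λ
        { (here eq) → there (here eq) ; (there (here eq)) → here eq
        ; (there (there (here refl))) → absurd (¬ab (ag , v∈)) ; (there (there (there p))) → there (there p) }
    without-a : count (¬? ∘ (a ∈?_)) 𝓖 ≤ suc l C (2 + ρ)
    without-a = family-bound [ u ] (b ∷ L₂) (Unique.filter⁺ (¬? ∘ (a ∈?_)) u𝓖) ([] ∷ []) λ g∈ →
      let g∈𝓖 , a∉g = ∈-filter⁻ (¬? ∘ (a ∈?_)) {xs = 𝓖} g∈ ; sz , ug , sub , _ = h g∈𝓖 in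
      sz , (λ { (here refl) → ug }) , λ v∈ → case ∈-resp-↭ (prep u perm) (sub v∈) of λ
        { (here eq) → here eq ; (there (here refl)) → absurd (a∉g v∈) ; (there (there p)) → there p }
    bound : length 𝓖 + l C ρ ≤ length L C (2 + ρ)
    bound = begin
      length 𝓖 + l C ρ  ≡⟨ cong (_+ l C ρ) (sym (count-¬ (a ∈?_) 𝓖)) ⟩
      count (a ∈?_) 𝓖 + count (¬? ∘ (a ∈?_)) 𝓖 + l C ρ ≤⟨ +-monoˡ-≤ (l C ρ) (+-mono-≤ with-a without-a) ⟩
      l C (1 + ρ) + suc l C (2 + ρ) + l C ρ  ≡⟨ lem (l C (1 + ρ)) (suc l C (2 + ρ)) (l C ρ) ⟩
      (l C ρ + l C (1 + ρ)) + suc l C (2 + ρ) ≡⟨ cong (_+ suc l C (2 + ρ)) (nCk+nC[k+1]≡[n+1]C[k+1] l ρ) ⟩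
      suc l C (1 + ρ) + suc l C (2 + ρ)      ≡⟨ nCk+nC[k+1]≡[n+1]C[k+1] (suc l) (1 + ρ) ⟩
      suc (suc l) C (2 + ρ)                  ≡⟨ cong (_C (2 + ρ)) (sym len) ⟩
      length L C (2 + ρ) ∎
      where
      open ≤-Reasoning
      lem : ∀ p q r → p + q + r ≡ (r + p) + q
      lem = solve-∀

  set-avoiding : ∀ {k u L t} X → Unique X → (∀ {v} → v ∈ₗ X → v ∈ₗ u ∷ L) → Unique (u ∷ L) → t ∉ₗ X → length X ≤ k → k ≤ length L →
    Σ (Subset n) λ S → (∣ S ∣ ≡ k) × (∀ {v} → v ∈ₗ X → v ∈ S) × (∀ {v} → v ∈ S → v ∈ₗ u ∷ L) × ¬ t ∈ S
  set-avoiding {k} {u} {L} {t} X uX X⊆ uL t∉X lo hi =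
    let S , sz , sub , sup = subset-between X Z uXZ lo (≤-trans hi room)
    in S , sz , sub , XZ⊆ ∘ sup , λ t∈ → [ t∉X , (λ t∈Z → proj₂ (proj₂ (∈-filter⁻ P? {xs = u ∷ L} t∈Z)) refl) ]′ (∈-++⁻ X (sup t∈))
    where
    P? : ∀ v → Dec (v ∉ₗ X × v ≢ t)
    P? v = ¬? (Any.any? (v F.≟_) X) ×-dec ¬? (v F.≟ t)
    Z = filter P? (u ∷ L)
    uXZ : Unique (X ++ Z)
    uXZ = Unique.++⁺ uX (Unique.filter⁺ P? uL) λ (v∈X , v∈Z) → proj₁ (proj₂ (∈-filter⁻ P? {xs = u ∷ L} v∈Z)) v∈X
    XZ⊆ : ∀ {v} → v ∈ₗ X ++ Z → v ∈ₗ u ∷ L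
    XZ⊆ v∈ = [ X⊆ , (λ p → proj₁ (∈-filter⁻ P? {xs = u ∷ L} p)) ]′ (∈-++⁻ X v∈)
    room : length L ≤ length X + length Z
    room = s≤s⁻¹ (≤-trans (length-⊆ {ys = t ∷ X ++ Z} uL cover) (≤-reflexive (cong suc (length-++ X))))
      where
      cover : ∀ {v} → v ∈ₗ u ∷ L → v ∈ₗ t ∷ X ++ Z
      cover {v} v∈ with v F.≟ t | Any.any? (v F.≟_) X
      ... | yes eq | _ = here eq
      ... | no _ | yes v∈X = there (∈-++⁺ˡ v∈X)
      ... | no v≢t | no v∉X = there (∈-++⁺ʳ X (∈-filter⁺ P? v∈ (v∉X , v≢t)))

-- Edges at u inside u ∪ L, counted together with links inside u ∪ L whose labels contain u.  A label
-- sticking out of u ∪ L blocks all sets above its link, and those outnumber the blocked links.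
module Relabelling {n ρ : ℕ} {u : Fin n} {L : List (Fin n)} {𝓕 : List (Subset n)} {Ks : List (Link n)}
  (uL : Unique (u ∷ L)) (u𝓕 : Unique 𝓕) (uK : Unique (labels Ks))
  (free : ∀ {f} → f ∈ₗ 𝓕 → ∣ f ∣ ≡ 3 + ρ × u ∈ f × (∀ {v} → v ∈ f → v ∈ₗ u ∷ L))
  (links : ∀ {k} → k ∈ₗ Ks → (∃ λ e → label k ≡ just e × ∣ e ∣ ≡ 3 + ρ × u ∈ e × (¬ e ∈ₗ 𝓕) × tail k ∈ e × head k ∈ e) ×
           tail k ∈ₗ L × head k ∈ₗ u ∷ L × tail k ≢ head k)
  (unique-tail : ∀ {k l} → k ∈ₗ Ks → l ∈ₗ Ks → tail k ≡ tail l → k ≡ l)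
  (no-loop : ∀ {k l} → k ∈ₗ Ks → l ∈ₗ Ks → tail k ≡ head l → head k ≢ tail l)
  (few : length Ks < length L)
  (S₁ : ∀ {a e b f} → a ⟨ just e ⟩ b ∈ₗ Ks → f ∈ₗ 𝓕 → a ∈ f → b ∈ f → ∀ {v} → v ∈ e → v ∈ₗ u ∷ L)
  (S₂ : ∀ {a e b a′ e′ b′ f} → a ⟨ just e ⟩ b ∈ₗ Ks → a′ ⟨ just e′ ⟩ b′ ∈ₗ Ks → f ∈ₗ 𝓕 → a′ ∈ f → b′ ∈ f →
        a ∈ e′ → b ∈ e′ → ∀ {v} → v ∈ e → v ∈ₗ u ∷ L)
  (some : ∃ λ f → f ∈ₗ 𝓕) where

  labelled : ∀ {Js} → (∀ {k} → k ∈ₗ Js → k ∈ₗ Ks) → ∀ {k} → k ∈ₗ Js → ∃ λ e → label k ≡ just e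
  labelled sub k∈ with links (sub k∈)
  ... | (e , eq , _) , _ = e , eq

  module _ {P : Link n → Set} (P? : Decidable P) where
    Js = filter P? Ks
    sub : ∀ {k} → k ∈ₗ Js → k ∈ₗ Ks
    sub = proj₁ ∘ ∈-filter⁻ P? {xs = Ks}

    family-unique : Unique (𝓕 ++ edgesOf Js)
    family-unique = Unique.++⁺ u𝓕 (Unique.map⁻ (subst Unique (sym (labels-edgesOf Js (labelled sub)))
        (AllPairs.map⁺ (AllPairs.filter⁺ P? (AllPairs.map⁻ uK))))) disjoint
      where
      disjoint : ∀ {e} → ¬ (e ∈ₗ 𝓕 × e ∈ₗ edgesOf Js)
      disjoint (e∈ , p) with ∈-edgesOf⁻ Js p
      ... | a , b , k∈ with links (sub k∈)
      ... | (_ , refl , _ , _ , e∉ , _) , _ = e∉ e∈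

    family-length : length (𝓕 ++ edgesOf Js) ≡ length 𝓕 + length Js
    family-length = trans (length-++ 𝓕) (cong (length 𝓕 +_)
      (trans (sym (length-map just (edgesOf Js))) (trans (cong length (labels-edgesOf Js (labelled sub))) (length-map label Js))))

    family-cases : ∀ {g} → g ∈ₗ 𝓕 ++ edgesOf Js → g ∈ₗ 𝓕 ⊎ (∃₂ λ a b → a ⟨ just g ⟩ b ∈ₗ Ks × P (a ⟨ just g ⟩ b))
    family-cases g∈ with ∈-++⁻ 𝓕 g∈
    ... | inj₁ p = inj₁ p
    ... | inj₂ p with ∈-edgesOf⁻ Js p
    ... | a , b , k∈ = inj₂ (a , b , ∈-filter⁻ P? {xs = Ks} k∈)

  size-u : ∀ {a g b} → a ⟨ just g ⟩ b ∈ₗ Ks → ∣ g ∣ ≡ 3 + ρ × u ∈ g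
  size-u k∈ with links k∈
  ... | (_ , refl , sz , ug , _) , _ = sz , ug

  inside? : ∀ (k : Link n) → Dec (∀ v → v ∈ˡ label k → v ∈ₗ u ∷ L)
  inside? k = F.all? λ v → (v ∈ˡ? label k) →-dec Any.any? (v F.≟_) (u ∷ L)

  covered? : ∀ (k : Link n) → Dec (Any (λ f → tail k ∈ f × head k ∈ f) 𝓕)
  covered? k = Any.any? (λ f → (tail k ∈? f) ×-dec (head k ∈? f)) 𝓕

  -- If a free edge contained both `a` and `b`, then `e` could be set free and would lie inside, by
  -- `S₁`. If the label of a covered link contained both, the same would follow by `S₂`. So free
  -- edges and labels of covered links all avoid the pair, and it remains to weigh the sets through
  -- the pair against the uncovered links.
  module Outside {a e b} (k∈ : a ⟨ just e ⟩ b ∈ₗ Ks) (out : ¬ (∀ v → v ∈ e → v ∈ₗ u ∷ L)) where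
    uncovered : ∀ {f} → f ∈ₗ 𝓕 → ¬ (a ∈ f × b ∈ f)
    uncovered f∈ (af , bf) = out λ v → S₁ k∈ f∈ af bf

    Kc = filter covered? Ks
    𝓖 = 𝓕 ++ edgesOf Kc
    Ku = filter (¬? ∘ covered?) Ks

    avoiding : Avoiding u L a b (3 + ρ) 𝓖
    avoiding = family-unique covered? , λ g∈ → go (family-cases covered? g∈)
      where
      go : ∀ {g} → g ∈ₗ 𝓕 ⊎ (∃₂ λ a b → a ⟨ just g ⟩ b ∈ₗ Ks × Any (λ f → a ∈ f × b ∈ f) 𝓕) →
           ∣ g ∣ ≡ 3 + ρ × u ∈ g × (∀ {v} → v ∈ g → v ∈ₗ u ∷ L) × ¬ (a ∈ g × b ∈ g)
      go (inj₁ g∈) = let sz , ug , sub = free g∈ in sz , ug , sub , uncovered g∈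
      go (inj₂ (a′ , b′ , j∈ , cov)) with find cov
      ... | f , f∈ , af , bf = proj₁ (size-u j∈) , proj₂ (size-u j∈) , S₁ j∈ f∈ af bf ,
        λ (ag , bg) → out λ v → S₂ k∈ j∈ f∈ af bf ag bg

    a∈L : a ∈ₗ L
    a∈L = proj₁ (proj₂ (links k∈))
    b∈ : b ∈ₗ u ∷ L
    b∈ = proj₁ (proj₂ (proj₂ (links k∈)))
    a≢b : a ≢ b
    a≢b = proj₂ (proj₂ (proj₂ (links k∈)))

    ρ<L : 3 + ρ ≤ length L
    ρ<L = let f , f∈ = some in go f∈ (a ∈? f)
      where
      room : ∀ {f x} → f ∈ₗ 𝓕 → x ∈ₗ u ∷ L → ¬ x ∈ f → 3 + ρ ≤ length L
      room {f} f∈ x∈ x∉ with without x∈ | free f∈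
      ... | M , perm | sz , _ , sub = subst₂ _≤_ sz (cong ℕ.pred (sym (↭-length perm)))
            (size-≤ f λ v∈ → case ∈-resp-↭ perm (sub v∈) of λ { (here refl) → absurd (x∉ v∈) ; (there p) → p })
      go : ∀ {f} → f ∈ₗ 𝓕 → Dec (a ∈ f) → 3 + ρ ≤ length L
      go f∈ (no a∉f) = room f∈ (there a∈L) a∉f
      go f∈ (yes af) = room f∈ b∈ λ bf → uncovered f∈ (af , bf)

    total : length 𝓕 + length Ks ≡ length 𝓖 + length Ku
    total = trans (cong (length 𝓕 +_) (sym (count-¬ covered? Ks)))
      (trans (sym (+-assoc (length 𝓕) _ _)) (cong (_+ length Ku) (sym (family-length covered?))))

    finish : ∀ {D} → length 𝓖 + D ≤ length L C (2 + ρ) → length Ku ≤ D → length 𝓕 + length Ks ≤ length L C (2 + ρ)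
    finish {D} h le = ≤-trans (≤-reflexive total) (≤-trans (+-monoʳ-≤ (length 𝓖) le) h)

    -- The sets lost are those through `u` and `a`. There are at least |L| - 1 of them, which is
    -- enough for all links.
    at-end : b ≡ u → length 𝓕 + length Ks ≤ length L C (2 + ρ)
    at-end refl = finish {ℕ.pred (length L) C (1 + ρ)} (≤-trans (+-monoˡ-≤ _ (avoid-end a∈L avoiding))
        (≤-reflexive (C-pred (1 + ρ) (≤-trans (s≤s z≤n) ρ<L))))
        (≤-trans (count-≤-length (¬? ∘ covered?) Ks) (≤-trans (≤-pred′ few) (C-linear (ℕ.pred (length L)) (1 + ρ) (s≤s z≤n) (≤-pred′ ρ<L))))
      where
      ≤-pred′ : ∀ {i k} → suc i ≤ k → i ≤ ℕ.pred k
      ≤-pred′ (s≤s p) = p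

    module Inner (b∈L : b ∈ₗ L) where
      ∈L⇒≢u : ∀ {v} → v ∈ₗ L → v ≢ u
      ∈L⇒≢u v∈ refl = ∉-head uL v∈

      -- For sets of size 3 the label would consist of `u`, `a` and `b`, which lie inside.
      0<ρ : 0 < ρ
      0<ρ = n≢0⇒n>0 λ eq → out λ v ve → within eq v ve (Any.any? (v F.≟_) (u ∷ L))
        where
        within : ρ ≡ 0 → ∀ v → v ∈ e → Dec (v ∈ₗ u ∷ L) → v ∈ₗ u ∷ L
        within eq v ve (yes p) = p
        within eq v ve (no v∉) with links k∈
        ... | (_ , refl , sz , ue , _ , ae , be) , _ = contradiction
          (size-≥ e {v ∷ u ∷ a ∷ b ∷ []}
            (((λ { refl → v∉ (here refl) }) ∷ (λ { refl → v∉ (there a∈L) }) ∷ (λ { refl → v∉ b∈ }) ∷ []) ∷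
             ((∈L⇒≢u a∈L ∘ sym) ∷ (∈L⇒≢u b∈L ∘ sym) ∷ []) ∷ (a≢b ∷ []) ∷ [] ∷ [])
            λ { (here refl) → ve ; (there (here refl)) → ue ; (there (there (here refl))) → ae
              ; (there (there (there (here refl)))) → be })
          (<⇒≱ (s≤s (≤-reflexive (trans sz (cong (3 +_) eq)))))

      inner = avoid-inner uL a∈L b∈L a≢b avoiding
      l = proj₁ inner
      len : length L ≡ suc (suc l)
      len = proj₁ (proj₂ inner)
      ρ<l : ρ < l
      ρ<l = s≤s⁻¹ (s≤s⁻¹ (subst (3 + ρ ≤_) len ρ<L))
      l≤D : l ≤ l C ρ
      l≤D = C-linear l ρ 0<ρ ρ<l
      Ks≤ : length Ks ≤ suc l
      Ks≤ = s≤s⁻¹ (subst (length Ks <_) len few)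

      other : 2 ≤ length Ks → ∃ λ j → j ∈ₗ Ks × tail j ≢ a
      other = go refl
        where
        go : ∀ {Js} → Js ≡ Ks → 2 ≤ length Js → ∃ λ j → j ∈ₗ Ks × tail j ≢ a
        go {_ ∷ []} _ (s≤s ())
        go {j ∷ j′ ∷ _} refl _ with tail j F.≟ a | tail j′ F.≟ a
        ... | no ≢a | _ = j , here refl , ≢a
        ... | yes _ | no ≢a = j′ , there (here refl) , ≢a
        ... | yes eq | yes eq′ with unique-tail (here refl) (there (here refl)) (trans eq (sym eq′))
        ... | refl = absurd (∉-head uK (here refl))

      -- For l + 1 uncovered links the l sets guaranteed so far fall short by one. A set above
      -- another link that leaves out `a` or `b` is not in `𝓕`, because that link is uncovered, and
      -- it can be added to the family without meeting the pair; this gains the missing one.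
      extra : (∀ {j} → j ∈ₗ Ks → ¬ Any (λ f → tail j ∈ f × head j ∈ f) 𝓕) → ∃ (λ j → j ∈ₗ Ks × tail j ≢ a) →
              suc (length 𝓕) + l C ρ ≤ length L C (2 + ρ)
      extra none ((a′ ⟨ ℓ ⟩ b′) , j∈ , a′≢a) with links j∈
      ... | (e′ , refl , _) , a′∈ , b′∈ , a′≢b′ = subst (λ l → suc (length 𝓕) + l C ρ ≤ _) l≡ bound
        where
        -- An end of the first link that is not on the second one: two links cannot join the same
        -- two vertices in opposite directions, by `no-loop`.
        pick-t : ∃ λ t → t ∈ₗ L × t ≢ a′ × t ≢ b′ × (∀ {S : Subset n} → ¬ t ∈ S → ¬ (a ∈ S × b ∈ S))
        pick-t with a F.≟ b′
        ... | no a≢b′ = a , a∈L , a′≢a ∘ sym , a≢b′ , λ a∉ (aS , _) → a∉ aS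
        ... | yes refl = b , b∈L , no-loop k∈ j∈ refl , a≢b ∘ sym , λ b∉ (_ , bS) → b∉ bS
        t = proj₁ pick-t
        pick-X : ∃ λ X → Unique X × (∀ {v} → v ∈ₗ X → v ∈ₗ u ∷ L) × t ∉ₗ X × length X ≤ 3 + ρ × u ∈ₗ X × a′ ∈ₗ X × b′ ∈ₗ X
        pick-X with pick-t | b′ F.≟ u
        ... | t , t∈ , t≢a′ , t≢b′ , _ | yes refl = u ∷ a′ ∷ [] , ((∈L⇒≢u a′∈ ∘ sym) ∷ []) ∷ [] ∷ [] ,
          (λ { (here eq) → here eq ; (there (here refl)) → there a′∈ }) ,
          (λ { (here eq) → ∈L⇒≢u t∈ eq ; (there (here eq)) → t≢a′ eq }) , s≤s (s≤s z≤n) , here refl , there (here refl) , here refl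
        ... | t , t∈ , t≢a′ , t≢b′ , _ | no b′≢u = u ∷ a′ ∷ b′ ∷ [] ,
          ((∈L⇒≢u a′∈ ∘ sym) ∷ (b′≢u ∘ sym) ∷ []) ∷ (a′≢b′ ∷ []) ∷ [] ∷ [] ,
          (λ { (here eq) → here eq ; (there (here refl)) → there a′∈ ; (there (there (here refl))) → b′∈ }) ,
          (λ { (here eq) → ∈L⇒≢u t∈ eq ; (there (here eq)) → t≢a′ eq ; (there (there (here eq))) → t≢b′ eq }) ,
          s≤s (s≤s (s≤s z≤n)) , here refl , there (here refl) , there (there (here refl))
        X = proj₁ pick-X
        made : Σ (Subset n) λ S → (∣ S ∣ ≡ 3 + ρ) × (∀ {v} → v ∈ₗ X → v ∈ S) × (∀ {v} → v ∈ S → v ∈ₗ u ∷ L) × ¬ t ∈ S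
        made = let _ , uX , X⊆ , t∉X , lo , _ = pick-X in set-avoiding X uX X⊆ uL t∉X lo ρ<L
        S = proj₁ made
        X⊆S : ∀ {v} → v ∈ₗ X → v ∈ S
        X⊆S = proj₁ (proj₂ (proj₂ made))
        uX = proj₁ (proj₂ (proj₂ (proj₂ (proj₂ (proj₂ pick-X)))))
        a′X = proj₁ (proj₂ (proj₂ (proj₂ (proj₂ (proj₂ (proj₂ pick-X))))))
        b′X = proj₂ (proj₂ (proj₂ (proj₂ (proj₂ (proj₂ (proj₂ pick-X))))))
        new : Avoiding u L a b (3 + ρ) (S ∷ 𝓕)
        new = Unique-∷ (λ S∈ → none j∈ (lose S∈ (X⊆S a′X , X⊆S b′X))) u𝓕 , λ
          { (here refl) → proj₁ (proj₂ made) , X⊆S uX , proj₁ (proj₂ (proj₂ (proj₂ made))) ,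
              proj₂ (proj₂ (proj₂ (proj₂ pick-t))) (proj₂ (proj₂ (proj₂ (proj₂ made))))
          ; (there g∈) → let sz , ug , sub = free g∈ in sz , ug , sub , uncovered g∈ }
        again = avoid-inner uL a∈L b∈L a≢b new
        l≡ : proj₁ again ≡ l
        l≡ = suc-injective (suc-injective (trans (sym (proj₁ (proj₂ again))) len))
        bound = proj₂ (proj₂ again)

      done : length 𝓕 + length Ks ≤ length L C (2 + ρ)
      done with length Ks ≤? l | count covered? Ks in eq
      ... | yes p | _ = finish (proj₂ (proj₂ inner)) (≤-trans (count-≤-length (¬? ∘ covered?) Ks) (≤-trans p l≤D))
      ... | no _ | suc c = finish (proj₂ (proj₂ inner)) (≤-trans (s≤s⁻¹ (≤-trans (s≤s (m≤n+m (length Ku) c))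
              (≤-trans (≤-reflexive (trans (cong (_+ length Ku) (sym eq)) (count-¬ covered? Ks))) Ks≤))) l≤D)
      ... | no big | zero = ≤-trans (+-monoʳ-≤ (length 𝓕) (≤-trans Ks≤ (s≤s l≤D)))
          (≤-trans (≤-reflexive (+-suc (length 𝓕) _))
            (extra (λ j∈ cov → contradiction (count-pos covered? j∈ cov) (<⇒≱ (s≤s (≤-reflexive eq))))
                   (other (≤-trans (s≤s (≤-trans (s≤s z≤n) ρ<l)) (≰⇒> big)))))

    conclude : length 𝓕 + length Ks ≤ length L C (2 + ρ)
    conclude with b∈
    ... | here eq = at-end eq
    ... | there b∈L = Inner.done b∈L

  -- If no label sticks out, free edges and labels together are distinct sets through `u` inside u ∪
  -- L.
  bound : length 𝓕 + length Ks ≤ length L C (2 + ρ)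
  bound with Any.any? (¬? ∘ inside?) Ks
  ... | yes some-out with find some-out
  ...   | (a ⟨ ℓ ⟩ b) , k∈ , out with links k∈
  ...   | (e , refl , _) , _ = Outside.conclude k∈ out
  bound | no ¬out = subst (_≤ length L C (2 + ρ))
      (trans (family-length yes?) (cong (length 𝓕 +_) (count-all yes? {Ks} (λ _ → tt))))
      (family-bound [ u ] L (family-unique yes?) ([] ∷ []) λ g∈ → go (family-cases yes? g∈))
    where
    open import Data.Unit using (tt) renaming (⊤ to Unit)
    yes? : ∀ (k : Link n) → Dec Unit
    yes? _ = yes tt
    go : ∀ {g} → g ∈ₗ 𝓕 ⊎ (∃₂ λ a b → a ⟨ just g ⟩ b ∈ₗ Ks × Unit) →
         ∣ g ∣ ≡ 3 + ρ × (∀ {v} → v ∈ₗ [ u ] → v ∈ g) × (∀ {v} → v ∈ g → v ∈ₗ u ∷ L)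
    go (inj₁ g∈) = let sz , ug , sub = free g∈ in sz , (λ { (here refl) → ug }) , sub
    go (inj₂ (a , b , k∈ , _)) with inside? (a ⟨ just _ ⟩ b)
    ... | yes sub = proj₁ (size-u k∈) , (λ { (here refl) → proj₂ (size-u k∈) }) , λ {v} → sub v
    ... | no out = absurd (¬out (lose k∈ out))

module _ {A : Set} {P Q : A → Set} (P? : Decidable P) (Q? : Decidable Q) where
  private
    tail′ : List A → List A
    tail′ [] = []
    tail′ (_ ∷ xs) = xs

    count-tail : ∀ xs → count Q? (tail′ xs) ≤ count Q? xs
    count-tail [] = z≤n
    count-tail (x ∷ xs) with Q? x
    ... | yes _ = n≤1+n _
    ... | no _ = ≤-refl

    go : ∀ xs → (∀ l₁ {k l₂} → xs ≡ l₁ ++ k ∷ l₂ → P k → ∃₂ λ k′ l₃ → l₂ ≡ k′ ∷ l₃ × Q k′) → count P? xs ≤ count Q? (tail′ xs)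
    go [] h = z≤n
    go (x ∷ xs) h with P? x | go xs (λ l₁ eq → h (x ∷ l₁) (cong (x ∷_) eq))
    ... | no _  | ih = ≤-trans ih (count-tail xs)
    ... | yes p | ih with h [] refl p
    ... | k′ , l₃ , refl , q = subst (suc (count P? (k′ ∷ l₃)) ≤_) (sym (count-yes Q? q)) (s≤s ih)

  count-next : ∀ xs → (∀ l₁ {k l₂} → xs ≡ l₁ ++ k ∷ l₂ → P k → ∃₂ λ k′ l₃ → l₂ ≡ k′ ∷ l₃ × Q k′) → count P? xs ≤ count Q? xs
  count-next xs h = ≤-trans (go xs h) (count-tail xs)

module _ {A : Set} {P : A → Set} (P? : Decidable P) where
  split-unique : ∀ as cs {p q bs ds} → count P? (as ++ p ∷ bs) ≡ 1 → as ++ p ∷ bs ≡ cs ++ q ∷ ds → P p → P q →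
                 as ≡ cs × p ≡ q × bs ≡ ds
  split-unique [] [] _ refl _ _ = refl , refl , refl
  split-unique [] (_ ∷ cs) {q = q} {ds = ds} one refl pp pq = contradiction (≤-trans
    (s≤s (count-pos P? (∈-++⁺ʳ cs (here refl)) pq)) (≤-trans (≤-reflexive (sym (count-yes P? pp))) (≤-reflexive one))) λ { (s≤s ()) }
  split-unique (_ ∷ as) [] {p = p} {bs = bs} one refl pp pq = contradiction (≤-trans
    (s≤s (count-pos P? (∈-++⁺ʳ as (here refl)) pp)) (≤-trans (≤-reflexive (sym (count-yes P? pq))) (≤-reflexive one))) λ { (s≤s ()) }
  split-unique (a ∷ as) (c ∷ cs) {p} {q} {bs} {ds} one eq pp pq with ∷-injective eq
  ... | refl , eq′ with split-unique as cs (smaller (P? a)) eq′ pp pq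
    where
    smaller : Dec (P a) → count P? (as ++ p ∷ bs) ≡ 1
    smaller (no ¬p) = trans (sym (count-no P? ¬p)) one
    smaller (yes pa) = contradiction (≤-trans (s≤s (count-pos P? (∈-++⁺ʳ as (here refl)) pp))
      (≤-trans (≤-reflexive (sym (count-yes P? pa))) (≤-reflexive one))) λ { (s≤s ()) }
  ... | refl , refl , refl = refl , refl , refl

rev-++ : ∀ {n} (xs ys : List (Link n)) → rev (xs ++ ys) ≡ rev ys ++ rev xs
rev-++ [] ys = sym (++-identityʳ _)
rev-++ (x ∷ xs) ys = trans (cong (_++ [ flip x ]) (rev-++ xs ys)) (++-assoc (rev ys) (rev xs) _)

rev-rev : ∀ {n} (xs : List (Link n)) → rev (rev xs) ≡ xs
rev-rev [] = refl
rev-rev (x ∷ xs) = trans (rev-++ (rev xs) [ flip x ]) (cong (x ∷_) (rev-rev xs))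

-- If δ > ρ, the right side is 2. If δ = ρ, it is ρ + 2, so that ρ = 2, n = 5 and m ≥ 2; then m = 2
-- contradicts `slack`, and a larger m contradicts C(m, 2) < 2.
too-few : ∀ {ρ δ n m} → 2 ≤ ρ → ρ ≤ δ → δ + suc ρ ≡ n → n ≤ suc (2 * m) → m C ρ < δ → ρ < m ⊎ suc (m C ρ) < δ →
          ¬ δ + ρ ≤ 1 + suc ρ C (suc ρ ∸ δ)
too-few {ρ} {δ} {n} {m} 2≤ρ ρ≤δ δ+r n≤ C<δ slack few with m≤n⇒m<n∨m≡n ρ≤δ
... | inj₁ ρ<δ = contradiction (≤-trans few (≤-reflexive (cong (λ k → 1 + suc ρ C k) (m≤n⇒m∸n≡0 ρ<δ))))
      (<⇒≱ (+-mono-≤ (≤-trans 2≤ρ ρ≤δ) (≤-trans (s≤s z≤n) 2≤ρ)))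
... | inj₂ refl with ≤-antisym (+-cancelʳ-≤ ρ ρ 2 (≤-trans few (≤-reflexive (cong suc one)))) 2≤ρ
  where
  one : suc ρ C (suc ρ ∸ ρ) ≡ suc ρ
  one = trans (cong (suc ρ C_) (m+n∸n≡m 1 ρ)) (nC1≡n (suc ρ))
... | refl = cases m (subst (_≤ suc (2 * m)) (sym δ+r) n≤) C<δ slack
  where
  cases : ∀ k → 5 ≤ suc (2 * k) → k C 2 < 2 → 2 < k ⊎ suc (k C 2) < 2 → Empty
  cases 0 (s≤s ()) _ _
  cases 1 (s≤s (s≤s (s≤s ()))) _ _
  cases 2 _ _ (inj₁ (s≤s (s≤s ())))
  cases 2 _ _ (inj₂ (s≤s (s≤s ())))
  cases (suc (suc (suc k))) _ c _ = contradiction (≤-trans (s≤s (C-linear (3 + k) 2 (s≤s z≤n) (s≤s (s≤s (s≤s z≤n))))) c)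
    (<⇒≱ (s≤s (s≤s (s≤s z≤n))))

-- A vertex left out by a cycle, with a single free edge

module Contradiction (K : Counterexample) where
  open Counterexample K
  open Edges {ρ = ρ} x y E uniq unif

  subset-of-equal : ∀ {e e′ : Subset n} {L} → (∀ {v} → v ∈ e → v ∈ₗ L) → (∀ {v} → v ∈ e′ → v ∈ₗ L) →
                    length L ≤ ∣ e ∣ → length L ≤ ∣ e′ ∣ → e ≡ e′
  subset-of-equal {e} {e′} {L} s s′ le le′ = ⊆-antisym (sub e e′ s s′ le′) (sub e′ e s′ s le)
    where
    sub : ∀ e e′ → (∀ {v} → v ∈ e → v ∈ₗ L) → (∀ {v} → v ∈ e′ → v ∈ₗ L) → length L ≤ ∣ e′ ∣ → e ⊆ e′
    sub e e′ s s′ le {v} v∈e with v ∈? e′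
    ... | yes v∈e′ = v∈e′
    ... | no v∉e′ = contradiction
      (length-⊆ (Unique-∷ (v∉e′ ∘ ∈-elements⁻ e′) (Unique-elements e′))
        λ { (here refl) → s v∈e ; (there w∈) → s′ (∈-elements⁻ e′ w∈) })
      (<⇒≱ (s≤s (≤-trans le (≤-reflexive (sym (length-elements e′))))))

  link-joins : ∀ {a ls b l} → Chain a ls b → l ∈ₗ ls → Joins (tail l) (label l) (head l)
  link-joins (j ∷ c) (here refl) = j
  link-joins (j ∷ c) (there p) = link-joins c p

  unique-head : ∀ {ls : List (Link n)} {k l} → Unique (heads ls) → k ∈ₗ ls → l ∈ₗ ls → head k ≡ head l → k ≡ l
  unique-head u (here refl) (here refl) eq = refl
  unique-head (x∉ ∷ u) (here refl) (there q) eq = absurd (All.lookup x∉ (∈-map⁺ head q) eq)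
  unique-head (x∉ ∷ u) (there p) (here refl) eq = absurd (All.lookup x∉ (∈-map⁺ head p) (sym eq))
  unique-head (x∉ ∷ u) (there p) (there q) eq = unique-head u p q eq

  module _ {z p q ls F} (L : LineBut z p q ls F) where
    private
      c = proj₁ (proj₁ L)
      uses = proj₂ (proj₂ (proj₁ L))
    spine-joins : ∀ {v e v′} → v ⟨ just e ⟩ v′ ∈ₗ ls → v ∈ e × v′ ∈ e
    spine-joins l∈ = link-joins c l∈

    heads-unique : Unique (heads ls)
    heads-unique with spine-unique L
    ... | _ ∷ _ ∷ u = u

    z∉heads : z ∉ₗ heads ls
    z∉heads = spine∌z L ∘ there

    -- Otherwise `e` and `f` together would insert `z` between `v` and `v′`.
    on-avoids : ∀ {v e v′ f} → v ⟨ just e ⟩ v′ ∈ₗ ls → z ∈ e → f ∈ₗ F → z ∈ f → ¬ (v ∈ f) × ¬ (v′ ∈ f)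
    on-avoids l∈ ze f∈ zf with pick f∈ | spine-joins l∈
    ... | F′ , perm | ve , v′e =
      (λ vf → ¬ham (insert∈ L l∈ (↭-trans (prep _ perm) (Perm.swap _ _ ↭-refl)) vf zf ze v′e)) ,
      (λ v′f → ¬ham (insert∈ L l∈ (prep _ perm) ve ze zf v′f))

    no-two-hits : ∀ {v e v′ f g} → v ⟨ just e ⟩ v′ ∈ₗ ls → f ∈ₗ F → g ∈ₗ F →
                  z ∈ f → v ∈ f → z ∈ g → v′ ∈ g → f ≡ g
    no-two-hits {f = f} {g} l∈ f∈ g∈ zf vf zg v′g with f ≟ˢ g
    ... | yes eq = eq
    ... | no f≢g with pick₂ f∈ g∈ f≢g
    ... | F′ , perm = absurd (¬ham (insert∈ L l∈
            (↭-trans (prep _ perm) (↭-trans (Perm.swap _ _ ↭-refl) (prep _ (Perm.swap _ _ ↭-refl)))) vf zf zg v′g))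

    -- z, placed after v, is joined to a by e′, so that e cannot join v′ to b.
    off-heads : ∀ {v e v′ h a e′ b} → v ⟨ just e ⟩ v′ ∈ₗ ls → h ∈ₗ F → z ∈ h → v ∈ h →
                a ⟨ just e′ ⟩ b ∈ₗ ls → z ∈ e′ → ¬ (b ∈ e)
    off-heads {v′ = v′} {b = b} l∈ h∈ zh vh k∈ ze′ b∈e with b F.≟ v′
    ... | yes refl with unique-head heads-unique l∈ k∈ refl
    ...   | refl = proj₁ (on-avoids l∈ ze′ h∈ zh) vh
    off-heads {v′ = v′} {b = b} l∈ h∈ zh vh k∈ ze′ b∈e | no b≢v′ with pick h∈
    ... | F′ , perm with place∈ L l∈ perm zh vh
    ... | ms , G , keep = ¬ham (cross∈ G (keep k∈ b≢v′) ↭-refl (proj₁ (spine-joins k∈)) ze′ (proj₂ (spine-joins l∈)) b∈e)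

    -- A link leaving h is labelled by the complement of z and the heads of the links with z in their label.
    few-tails : ∀ {h} → h ∈ₗ F → z ∈ h → count (z ∈?_) F ≡ 1 → ¬ (2 ≤ count ((_∈? h) ∘ tail) ls)
    few-tails {h} h∈ zh one two with labels-distinct ((_∈? h) ∘ tail) (Unique-++ˡ (labels ls) (line-unique {ls} {F} uses)) two
    ... | (a ⟨ ℓ ⟩ b) , (a′ ⟨ ℓ′ ⟩ b′) , (l∈ , ah) , (l′∈ , a′h) , ℓ≢ℓ′ with line-label {ls} {F} uses l∈ | line-label {ls} {F} uses l′∈
    ... | e , refl , e∈ | e′ , refl , e′∈ = ℓ≢ℓ′ (cong just
      (complement-unique W-unique n≤W (unif e∈) (unif e′∈) (avoids l∈ ah) (avoids l′∈ a′h)))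
      where
      on = filter (on? z) ls
      W = z ∷ heads on
      W-unique : Unique W
      W-unique = Unique-∷ z∉ (AllPairs.map⁺ (AllPairs.filter⁺ (on? z) (AllPairs.map⁻ heads-unique)))
        where
        z∉ : z ∉ₗ heads on
        z∉ p with ∈-map⁻ head p
        ... | l , l∈ , eq = z∉heads (subst (_∈ₗ heads ls) (sym eq) (∈-map⁺ head (proj₁ (∈-filter⁻ (on? z) {xs = ls} l∈))))
      n≤W : n ≤ length W + suc ρ
      n≤W = ≤-trans n≤δ+r (+-monoˡ-≤ (suc ρ) (≤-trans (deg z) (≤-reflexive
              (trans (sym (degree-split {ls} {F} uses z)) (trans (cong (count (on? z) ls +_) one)
                (trans (+-comm (count (on? z) ls) 1) (cong suc (sym (length-map head on)))))))))
      avoids : ∀ {a e b} → a ⟨ just e ⟩ b ∈ₗ ls → a ∈ h → ∀ {v} → v ∈ₗ W → ¬ v ∈ e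
      avoids l∈ ah (here refl) ze = proj₁ (on-avoids l∈ ze h∈ zh) ah
      avoids l∈ ah (there p) v∈e with ∈-map⁻ head p
      ... | (c ⟨ ℓ ⟩ d) , k∈ , refl with ∈-filter⁻ (on? z) {xs = ls} k∈
      ... | k∈ls , z∈ℓ with line-label {ls} {F} uses k∈ls
      ... | e″ , refl , _ = off-heads l∈ h∈ zh ah k∈ls z∈ℓ v∈e

  spine-count : ∀ {z p q ls F h} → LineBut z p q ls F → h ∈ₗ E → z ∈ h → count (_∈? h) (p ∷ heads ls) ≡ ρ
  spine-count {z} {p} {q} {ls} {F} {h} L h∈ zh = suc-injective (trans (sym (count-yes (_∈? h) zh))
    (trans (count-∈ h (spine-unique L) (λ {v} _ → all v)) (unif h∈)))
    where
    all : ∀ v → v ∈ₗ z ∷ p ∷ heads ls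
    all v with v F.≟ z
    ... | yes refl = here refl
    ... | no v≢z = there (spine-complete L v≢z)

  -- Only ρ = 2 and h = {z , p , q} escapes few-tails.
  single-end : ∀ {z p q ls F h} → LineBut z p q ls F → h ∈ₗ F → z ∈ h → count (z ∈?_) F ≡ 1 → ρ ≡ 2 × q ∈ h
  single-end {z} {p} {q} {ls} {F} {h} L h∈ zh one with q ∈? h | count-tails L (_∈? h) | few-tails L h∈ zh one
    | spine-count L (free∈E {ls} {F} (proj₂ (proj₂ (proj₁ L))) h∈) zh
  ... | yes qh | eq | few | sc = ≤-antisym
      (≤-trans (≤-reflexive (trans (sym sc) (sym eq)))
         (+-mono-≤ (s≤s⁻¹ (≰⇒> few)) (≤-refl {1}))) 2≤ρ , qh
  ... | no q∉h | eq | few | sc = absurd (few (≤-trans 2≤ρ (≤-reflexive (trans (sym sc) (trans (sym eq)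
      (+-identityʳ _))))))

  single-ends : ∀ {z p q ls F h} → LineBut z p q ls F → h ∈ₗ F → z ∈ h → count (z ∈?_) F ≡ 1 →
                ρ ≡ 2 × p ∈ h × q ∈ h
  single-ends L h∈ zh one with single-end L h∈ zh one | single-end (LineBut-flip L) h∈ zh one
  ... | ρ≡2 , qh | _ , ph = ρ≡2 , ph , qh

  unique-free : ∀ {z F} {h f : Subset n} → Unique F → count (z ∈?_) F ≡ 1 → h ∈ₗ F → z ∈ h → f ∈ₗ F → z ∈ f → f ≡ h
  unique-free {z} {F} {h} {f} u one h∈ zh f∈ zf with f ≟ˢ h
  ... | yes eq = eq
  ... | no f≢h = contradiction (≤-reflexive one) (<⇒≱ (length-⊆ {xs = f ∷ h ∷ []} ((f≢h ∷ []) ∷ [] ∷ [])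
        λ { (here refl) → ∈-filter⁺ (z ∈?_) f∈ zf ; (there (here refl)) → ∈-filter⁺ (z ∈?_) h∈ zh }))

  small : ∀ k → 6 + 2 * k ≤ (4 + k) C 2
  small k = C-growth 4 k 2 ≤-refl (s≤s (s≤s z≤n))

  -- Only the seven vertices of m = 3 leave room for three links that avoid both ends.
  seven : ρ ≡ 2 → 3 + δ ≤ n → n ≡ 7 × 4 ≤ δ
  seven ρ≡2 lo = go m refl n≤ C<δ slack
    where
    go : ∀ k → k ≡ m → n ≤ suc (2 * k) → k C ρ < δ → ρ < k ⊎ suc (k C ρ) < δ → n ≡ 7 × 4 ≤ δ
    go k k≡ hi c s rewrite ρ≡2 = cases k hi c s
      where
      cases : ∀ k → n ≤ suc (2 * k) → k C 2 < δ → 2 < k ⊎ suc (k C 2) < δ → n ≡ 7 × 4 ≤ δ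
      cases 3 hi c _ = ≤-antisym hi (≤-trans (+-monoʳ-≤ 3 c) lo) , c
      cases 0 hi c (inj₂ s) = contradiction (≤-trans (+-monoʳ-≤ 3 s) (≤-trans lo hi)) λ { (s≤s ()) }
      cases 1 hi c (inj₂ s) = contradiction (≤-trans (+-monoʳ-≤ 3 s) (≤-trans lo hi)) λ { (s≤s (s≤s (s≤s ()))) }
      cases 2 hi c (inj₂ s) = contradiction (≤-trans (+-monoʳ-≤ 3 s) (≤-trans lo hi))
        λ { (s≤s (s≤s (s≤s (s≤s (s≤s ()))))) }
      cases 1 hi c (inj₁ (s≤s ()))
      cases 2 hi c (inj₁ (s≤s (s≤s ())))
      cases (suc (suc (suc (suc k)))) hi c _ = contradiction
        (≤-trans (+-monoʳ-≤ 3 (≤-trans (s≤s (small k)) c)) (≤-trans lo hi))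
        (<⇒≱ (≤-reflexive (lem k)))
        where
        lem : ∀ k → suc (suc (2 * (4 + k))) ≡ 3 + suc (6 + 2 * k)
        lem = solve-∀

  data Snoc {A : Set} : List A → Set where
    empty : Snoc []
    snoc  : ∀ xs x → Snoc (xs ++ [ x ])

  toSnoc : ∀ {A : Set} (xs : List A) → Snoc xs
  toSnoc [] = empty
  toSnoc (x ∷ xs) with toSnoc xs
  ... | empty = snoc [] x
  ... | snoc ys y = snoc (x ∷ ys) y

  -- The configuration left over for r = 3 and n = 7. Since `z` lies in `e₂` and `e₃`, it can change
  -- places with `v₃` without any change of labels. Now `v₃` is left out, and it has two free edges;
  -- these turn out to be equal.
  module Seven {z p q F h v₂ v₃ v₄ v₅ e₁ e₂ e₃ e₄ e₅}
    (L : LineBut z p q (p ⟨ just e₁ ⟩ v₂ ∷ v₂ ⟨ just e₂ ⟩ v₃ ∷ v₃ ⟨ just e₃ ⟩ v₄ ∷ v₄ ⟨ just e₄ ⟩ v₅ ∷ v₅ ⟨ just e₅ ⟩ q ∷ []) F)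
    (ρ≡2 : ρ ≡ 2) (h∈ : h ∈ₗ F) (zh : z ∈ h) (ph : p ∈ h) (qh : q ∈ h)
    (unique : ∀ {f} → f ∈ₗ F → z ∈ f → f ≡ h)
    (ze₂ : z ∈ e₂) (ze₃ : z ∈ e₃) (ze₄ : z ∈ e₄) (4≤δ : 4 ≤ δ) where

    ls : List (Link n)
    ls = p ⟨ just e₁ ⟩ v₂ ∷ v₂ ⟨ just e₂ ⟩ v₃ ∷ v₃ ⟨ just e₃ ⟩ v₄ ∷ v₄ ⟨ just e₄ ⟩ v₅ ∷ v₅ ⟨ just e₅ ⟩ q ∷ []
    uses : labels ls ++ map just F ↭ map just E
    uses = proj₂ (proj₂ (proj₁ L))

    i₁ : p ⟨ just e₁ ⟩ v₂ ∈ₗ ls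
    i₁ = here refl
    i₂ : v₂ ⟨ just e₂ ⟩ v₃ ∈ₗ ls
    i₂ = there (here refl)
    i₃ : v₃ ⟨ just e₃ ⟩ v₄ ∈ₗ ls
    i₃ = there (there (here refl))
    i₄ : v₄ ⟨ just e₄ ⟩ v₅ ∈ₗ ls
    i₄ = there (there (there (here refl)))
    i₅ : v₅ ⟨ just e₅ ⟩ q ∈ₗ ls
    i₅ = there (there (there (there (here refl))))

    three : ∀ {e} → e ∈ₗ E → ∣ e ∣ ≡ 3
    three e∈ = trans (unif e∈) (cong suc ρ≡2)

    too-big : ∀ {e} → e ∈ₗ E → ∀ {a b c d} → Unique (a ∷ b ∷ c ∷ d ∷ []) → a ∈ e → b ∈ e → c ∈ e → d ∈ e → Empty
    too-big {e} e∈ u ae be ce de = contradiction (size-≥ e u λ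
      { (here refl) → ae ; (there (here refl)) → be ; (there (there (here refl))) → ce ; (there (there (there (here refl)))) → de })
      (<⇒≱ (s≤s (≤-reflexive (three e∈))))

    lab∈ : ∀ {a e b} → a ⟨ just e ⟩ b ∈ₗ ls → e ∈ₗ E
    lab∈ l∈ with line-label {ls} {F} uses l∈
    ... | _ , refl , e∈ = e∈

    free∈ : ∀ {f} → f ∈ₗ F → f ∈ₗ E
    free∈ = free∈E {ls} {F} uses

    distinct : Unique (z ∷ p ∷ v₂ ∷ v₃ ∷ v₄ ∷ v₅ ∷ q ∷ [])
    distinct = spine-unique L

    v₃≢ : Unique (v₃ ∷ z ∷ v₄ ∷ v₅ ∷ []) × Unique (v₃ ∷ z ∷ p ∷ q ∷ [])
    v₃≢ with distinct
    ... | (zp ∷ z2 ∷ z3 ∷ z4 ∷ z5 ∷ zq ∷ []) ∷ (p2 ∷ p3 ∷ p4 ∷ p5 ∷ pq ∷ []) ∷ _ ∷ (c4 ∷ c5 ∷ cq ∷ []) ∷ (d5 ∷ _) ∷ _ =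
      ((z3 ∘ sym) ∷ c4 ∷ c5 ∷ []) ∷ (z4 ∷ z5 ∷ []) ∷ (d5 ∷ []) ∷ [] ∷ [] ,
      ((z3 ∘ sym) ∷ (p3 ∘ sym) ∷ cq ∷ []) ∷ (zp ∷ zq ∷ []) ∷ (pq ∷ []) ∷ [] ∷ []

    v₃∉e₄ : ¬ v₃ ∈ e₄
    v₃∉e₄ v = too-big (lab∈ i₄) (proj₁ v₃≢) v ze₄ (proj₁ (spine-joins L i₄)) (proj₂ (spine-joins L i₄))

    v₃∉h : ¬ v₃ ∈ h
    v₃∉h v = too-big (free∈ h∈) (proj₂ v₃≢) v zh ph qh

    v₃∉e₁ : ¬ v₃ ∈ e₁
    v₃∉e₁ = off-heads L i₁ h∈ zh ph i₂ ze₂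

    v₃∉e₅ : ¬ v₃ ∈ e₅
    v₃∉e₅ = off-heads (LineBut-flip L) (∈-rev i₅) h∈ zh qh (∈-rev i₃) ze₃

    -- z and v₃ change places.
    ls′ : List (Link n)
    ls′ = p ⟨ just e₁ ⟩ v₂ ∷ v₂ ⟨ just e₂ ⟩ z ∷ z ⟨ just e₃ ⟩ v₄ ∷ v₄ ⟨ just e₄ ⟩ v₅ ∷ v₅ ⟨ just e₅ ⟩ q ∷ []

    i₂′ : v₂ ⟨ just e₂ ⟩ z ∈ₗ ls′
    i₂′ = there (here refl)
    i₃′ : z ⟨ just e₃ ⟩ v₄ ∈ₗ ls′
    i₃′ = there (there (here refl))
    i₅′ : v₅ ⟨ just e₅ ⟩ q ∈ₗ ls′
    i₅′ = there (there (there (there (here refl))))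

    L′ : LineBut v₃ p q ls′ F
    L′ = exchange L
      where
      open ↭Solver
      exchange : LineBut z p q ls F → LineBut v₃ p q ls′ F
      exchange ((j₁ ∷ (v₂e , _) ∷ (_ , v₄e) ∷ c , j , u) , vs) = (j₁ ∷ (v₂e , ze₂) ∷ (ze₃ , v₄e) ∷ c , j , u) ,
        ↭-trans (solve 5 (λ a b c d r → a ⊕ (b ⊕ (c ⊕ (d ⊕ r))) ⊜ d ⊕ (b ⊕ (c ⊕ (a ⊕ r)))) ↭-refl
                  [ v₃ ] [ p ] [ v₂ ] [ z ] (v₄ ∷ v₅ ∷ q ∷ [])) vs

    -- Of the five labels only `e₂` and `e₃` can contain `v₃`, while its degree is at least 4.
    two-free : 2 ≤ count (v₃ ∈?_) F
    two-free = +-cancelˡ-≤ 2 2 _ (≤-trans 4≤δ (≤-trans (deg v₃) (≤-trans (≤-reflexive (sym (degree-split {ls} {F} uses v₃)))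
      (+-monoˡ-≤ _ labelled))))
      where
      labelled : count (on? v₃) ls ≤ 2
      labelled = subst (_≤ 2) (sym (trans (count-no (on? v₃) {p ⟨ just e₁ ⟩ v₂} {inner ++ outer} v₃∉e₁)
        (trans (count-++ (on? v₃) inner outer) (cong (count (on? v₃) inner +_) (count-none (on? v₃) {outer} outside-e)))))
        (subst (_≤ 2) (sym (+-identityʳ _)) (count-≤-length (on? v₃) inner))
        where
        inner outer : List (Link n)
        inner = v₂ ⟨ just e₂ ⟩ v₃ ∷ v₃ ⟨ just e₃ ⟩ v₄ ∷ []
        outer = v₄ ⟨ just e₄ ⟩ v₅ ∷ v₅ ⟨ just e₅ ⟩ q ∷ []
        outside-e : ∀ {l} → l ∈ₗ outer → ¬ v₃ ∈ˡ label l
        outside-e (here refl) = v₃∉e₄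
        outside-e (there (here refl)) = v₃∉e₅

    -- In the new path `v₂` and `v₄` are joined to `z` by labels containing `v₃`, so `on-avoids`
    -- excludes them. The only free edge at `z` is `h`, and it misses `v₃`.
    inside-of : ∀ {φ} → φ ∈ₗ F → v₃ ∈ φ → ∀ {v} → v ∈ φ → v ∈ₗ v₃ ∷ p ∷ v₅ ∷ q ∷ []
    inside-of {φ} φ∈ v₃φ {v} vφ with ∈-resp-↭ (↭-sym (proj₂ L)) (∈-allFin v)
    ... | here refl = absurd (v₃∉h (subst (v₃ ∈_) (unique φ∈ vφ) v₃φ))
    ... | there (here refl) = there (here refl)
    ... | there (there (here refl)) = absurd (proj₁ (on-avoids L′ i₂′ (proj₂ (spine-joins L i₂)) φ∈ v₃φ) vφ)
    ... | there (there (there (here refl))) = here refl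
    ... | there (there (there (there (here refl)))) =
      absurd (proj₂ (on-avoids L′ i₃′ (proj₁ (spine-joins L i₃)) φ∈ v₃φ) vφ)
    ... | there (there (there (there (there (here refl))))) = there (there (here refl))
    ... | there (there (there (there (there (there (here refl)))))) = there (there (there (here refl)))

    impossible : Empty
    impossible with filter (v₃ ∈?_) F in eq | two-free
    ... | _ ∷ [] | s≤s ()
    ... | φ ∷ ψ ∷ _ | _ = φ≢ψ equal
      where
      φ∈ : φ ∈ₗ F × v₃ ∈ φ
      φ∈ = ∈-filter⁻ (v₃ ∈?_) {xs = F} (subst (φ ∈ₗ_) (sym eq) (here refl))
      ψ∈ : ψ ∈ₗ F × v₃ ∈ ψ
      ψ∈ = ∈-filter⁻ (v₃ ∈?_) {xs = F} (subst (ψ ∈ₗ_) (sym eq) (there (here refl)))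
      φ≢ψ : φ ≢ ψ
      φ≢ψ with subst Unique eq (Unique.filter⁺ (v₃ ∈?_) (free-unique {ls} {F} uses))
      ... | (≢ ∷ _) ∷ _ = ≢
      not-both : ∀ {φ ψ} → φ ∈ₗ F × v₃ ∈ φ → ψ ∈ₗ F × v₃ ∈ ψ → φ ≢ ψ → v₅ ∈ φ → ¬ q ∈ ψ
      not-both (φ∈ , vφ) (ψ∈ , vψ) ≢ v₅φ qψ = ≢ (no-two-hits L′ i₅′ φ∈ ψ∈ vφ v₅φ vψ qψ)
      A = v₃ ∷ p ∷ v₅ ∷ []
      B = v₃ ∷ p ∷ q ∷ []
      within-A : ∀ {φ} → φ ∈ₗ F × v₃ ∈ φ → ¬ q ∈ φ → ∀ {v} → v ∈ φ → v ∈ₗ A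
      within-A (φ∈ , vφ) q∉ vv with inside-of φ∈ vφ vv
      ... | here refl = here refl
      ... | there (here refl) = there (here refl)
      ... | there (there (here refl)) = there (there (here refl))
      ... | there (there (there (here refl))) = absurd (q∉ vv)
      within-B : ∀ {φ} → φ ∈ₗ F × v₃ ∈ φ → ¬ v₅ ∈ φ → ∀ {v} → v ∈ φ → v ∈ₗ B
      within-B (φ∈ , vφ) v₅∉ vv with inside-of φ∈ vφ vv
      ... | here refl = here refl
      ... | there (here refl) = there (here refl)
      ... | there (there (here refl)) = absurd (v₅∉ vv)
      ... | there (there (there (here refl))) = there (there (here refl))
      3≤ : ∀ {φ} → φ ∈ₗ F × v₃ ∈ φ → 3 ≤ ∣ φ ∣
      3≤ (φ∈ , _) = ≤-reflexive (sym (three (free∈ φ∈)))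
      must : ∀ {φ} → φ ∈ₗ F × v₃ ∈ φ → ¬ q ∈ φ → v₅ ∈ φ
      must {φ} φ∈ q∉ with v₅ ∈? φ
      ... | yes p = p
      ... | no v₅∉ = contradiction (size-≤ φ {v₃ ∷ p ∷ []} λ vv → case within-A φ∈ q∉ vv of λ
              { (here refl) → here refl ; (there (here refl)) → there (here refl)
              ; (there (there (here refl))) → absurd (v₅∉ vv) }) (<⇒≱ (3≤ φ∈))
      must′ : ∀ {φ} → φ ∈ₗ F × v₃ ∈ φ → ¬ v₅ ∈ φ → q ∈ φ
      must′ {φ} φ∈ v₅∉ with q ∈? φ
      ... | yes p = p
      ... | no q∉ = absurd (v₅∉ (must φ∈ q∉))
      -- By `not-both`, different edges cannot contain `v₅` and `q` respectively. So both consist of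
      -- v₃, p and v₅, or both of v₃, p and q.
      equal : φ ≡ ψ
      equal with φ ≟ˢ ψ
      ... | yes eq = eq
      ... | no φ≢ψ with v₅ ∈? φ
      ... | yes v₅φ = subset-of-equal (within-A φ∈ (not-both ψ∈ φ∈ (φ≢ψ ∘ sym) (must ψ∈ (not-both φ∈ ψ∈ φ≢ψ v₅φ))))
                        (within-A ψ∈ (not-both φ∈ ψ∈ φ≢ψ v₅φ)) (3≤ φ∈) (3≤ ψ∈)
      ... | no v₅∉φ = subset-of-equal (within-B φ∈ v₅∉φ)
                        (within-B ψ∈ λ v₅ψ → not-both ψ∈ φ∈ (φ≢ψ ∘ sym) v₅ψ (must′ φ∈ v₅∉φ)) (3≤ φ∈) (3≤ ψ∈)

  -- As `p` and `q` lie in `h`, neither the first nor the last label contains `z`. Hence z is in at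
  -- most n - 4 labels and δ ≤ n - 3, which only the case of `Seven` allows.
  one-hit : ∀ {z p q ls F} → LineBut z p q ls F → ¬ count (z ∈?_) F ≡ 1
  one-hit {z} {p} {q} {ls} {F} L one with count-witness (z ∈?_) F (≤-reflexive (sym one))
  ... | h , h∈ , zh with single-ends L h∈ zh one
  ... | ρ≡2 , ph , qh = go ls refl
    where
    uses = proj₂ (proj₂ (proj₁ L))
    unique : ∀ {f} → f ∈ₗ F → z ∈ f → f ≡ h
    unique = unique-free (free-unique {ls} {F} uses) one h∈ zh
    d : δ ≤ suc (count (on? z) ls)
    d = ≤-trans (deg z) (≤-reflexive (trans (sym (degree-split {ls} {F} uses z)) (trans (cong (count (on? z) ls +_) one) (+-comm _ 1))))
    len : suc (suc (length ls)) ≡ n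
    len = line-length L
    3<n : 3 < n
    3<n = subst (_< n) (cong suc ρ≡2) ρ<n
    l-head : ∀ {a ℓ b ks} → Chain p (a ⟨ ℓ ⟩ b ∷ ks) q → p ≡ a
    l-head (_ ∷ _) = refl
    l-last : ∀ ms {a ℓ b} → Chain p (ms ++ [ a ⟨ ℓ ⟩ b ]) q → q ≡ b
    l-last ms c with split-at ms c
    ... | _ , _ , [] = refl
    off : ∀ {a ℓ b} → a ⟨ ℓ ⟩ b ∈ₗ ls → a ≡ p ⊎ b ≡ q → ¬ z ∈ˡ ℓ
    off l∈ end zℓ with line-label {ls} {F} uses l∈
    off l∈ (inj₁ refl) zℓ | _ , refl , _ = proj₁ (on-avoids L l∈ zℓ h∈ zh) ph
    off l∈ (inj₂ refl) zℓ | _ , refl , _ = proj₂ (on-avoids L l∈ zℓ h∈ zh) qh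
    middle : ∀ l ms k → l ∷ ms ++ [ k ] ≡ ls → count (on? z) ls ≡ count (on? z) ms
    middle l ms k refl = trans (count-no (on? z) {xs = ms ++ [ k ]} (off (here refl) (inj₁ (sym (l-head (proj₁ (proj₁ L)))))))
      (trans (count-++ (on? z) ms [ k ]) (trans (cong (count (on? z) ms +_)
        (count-no (on? z) {xs = []} (off (there (∈-++⁺ʳ ms (here refl))) (inj₂ (sym (l-last (l ∷ ms) (proj₁ (proj₁ L))))))))
        (+-identityʳ _)))
    final : ∀ l ms k → l ∷ ms ++ [ k ] ≡ ls → length ms ≡ 3 → 4 ≤ δ → Empty
    final l₁@(_ ⟨ _ ⟩ _) (l₂@(_ ⟨ _ ⟩ _) ∷ l₃@(_ ⟨ _ ⟩ _) ∷ l₄@(_ ⟨ _ ⟩ _) ∷ []) l₅@(_ ⟨ _ ⟩ _) eq refl 4≤δ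
      with count-all⁻ (on? z) (l₂ ∷ l₃ ∷ l₄ ∷ []) (s≤s⁻¹ (≤-trans 4≤δ (subst (λ c → δ ≤ suc c) (middle l₁ (l₂ ∷ l₃ ∷ l₄ ∷ []) l₅ eq) d)))
    final l₁ (l₂ ∷ l₃ ∷ l₄ ∷ []) l₅ refl refl 4≤δ | o₂ ∷ o₃ ∷ o₄ ∷ []
      with line-label {ls} {F} uses (here refl) | line-label {ls} {F} uses (there (here refl))
         | line-label {ls} {F} uses (there (there (here refl))) | line-label {ls} {F} uses (there (there (there (here refl))))
         | line-label {ls} {F} uses (there (there (there (there (here refl)))))
    ... | _ , refl , _ | _ , refl , _ | _ , refl , _ | _ , refl , _ | _ , refl , _ with proj₁ (proj₁ L)
    ... | _ ∷ _ ∷ _ ∷ _ ∷ _ ∷ [] = Seven.impossible L ρ≡2 h∈ zh ph qh unique o₂ o₃ o₄ 4≤δ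
    go : ∀ ks → ks ≡ ls → Empty
    go [] refl = contradiction 3<n (<⇒≱ (s≤s (≤-trans (≤-reflexive (sym len)) (s≤s (s≤s z≤n)))))
    go (l ∷ ks) eq with toSnoc ks
    go (l ∷ _) refl | empty = contradiction 3<n (<⇒≱ (s≤s (≤-reflexive (sym len))))
    go (l ∷ _) eq | snoc ms k = final l ms k eq (+-cancelˡ-≡ 4 _ _ (trans (sym n≡) (proj₁ n7))) (proj₂ n7)
      where
      n≡ : n ≡ 4 + length ms
      n≡ = trans (sym len) (cong (suc ∘ suc) (trans (cong length (sym eq)) (cong suc (trans (length-++ ms) (+-comm _ 1)))))
      n7 : n ≡ 7 × 4 ≤ δ
      n7 = seven ρ≡2 (≤-trans (+-monoʳ-≤ 3 (≤-trans d (s≤s (≤-trans (≤-reflexive (middle l ms k eq)) (count-≤-length (on? z) ms)))))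
             (≤-reflexive (sym n≡)))

  -- A vertex left out by a cycle, with several free edges

  Hit : Fin n → List (Subset n) → Fin n → Set
  Hit z F v = Any (λ f → z ∈ f × v ∈ f) F

  hit? : ∀ z F v → Dec (Hit z F v)
  hit? z F v = Any.any? (λ f → (z ∈? f) ×-dec (v ∈? f)) F

  -- Here `s` counts the vertices hit, `A` the labels at `z`, `T` and `H` the links with tail or
  -- head hit, and `bp` and `bq` tell whether the ends of the line are hit. The three kinds of links
  -- are disjoint, so A + 2s ≤ n. For s < m the loss in C(s, ρ) exceeds what `A` can make up for,
  -- and s = m leaves only equality.
  tight-count : ∀ {A s T H bp bq R none len d} → suc (suc len) ≡ n → R + none ≡ len → T + bq ≡ s → bp + H ≡ s →
    A + T + H ≤ R → bp ≤ 1 → bq ≤ 1 → δ ≤ A + d → d ≤ s C ρ → ρ < s →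
    s ≡ m × A ≡ 1 × m C ρ ≤ d × none ≡ 0 × bp ≡ 1 × bq ≡ 1
  tight-count {A} {s} {T} {H} {bp} {bq} {R} {none} {len} {d} len≡ R≡ T≡ H≡ le bp≤ bq≤ δ≤ d≤ ρ<s
    = cases (m ∸ s) (m+[n∸m]≡n s≤m)
    where
    open ≤-Reasoning
    total : A + 2 * s + none + 2 ≤ n + (bp + bq)
    total = begin
      A + 2 * s + none + 2                   ≡⟨ cong₂ (λ t h → A + (t + (h + 0)) + none + 2) (sym T≡) (sym H≡) ⟩
      A + (T + bq + (bp + H + 0)) + none + 2 ≡⟨ lem A T bq bp H none ⟩
      (A + T + H) + none + 2 + (bp + bq)     ≤⟨ +-monoˡ-≤ (bp + bq) (+-monoˡ-≤ 2 (+-monoˡ-≤ none le)) ⟩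
      R + none + 2 + (bp + bq)               ≡⟨ cong (_+ (bp + bq)) (trans (cong (_+ 2) R≡) (trans (+-comm len 2) len≡)) ⟩
      n + (bp + bq) ∎
      where
      lem : ∀ A T bq bp H none → A + (T + bq + (bp + H + 0)) + none + 2 ≡ (A + T + H) + none + 2 + (bp + bq)
      lem = solve-∀
    bound : A + 2 * s + none ≤ n
    bound = +-cancelʳ-≤ 2 _ _ (≤-trans total (+-monoʳ-≤ n (+-mono-≤ bp≤ bq≤)))
    s≤m : s ≤ m
    s≤m with s ≤? m
    ... | yes p = p
    ... | no s≰m = contradiction (begin
          2 * suc m          ≤⟨ *-monoʳ-≤ 2 (≰⇒> s≰m) ⟩
          2 * s              ≤⟨ ≤-trans (m≤n+m (2 * s) A) (m≤m+n (A + 2 * s) none) ⟩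
          A + 2 * s + none   ≤⟨ ≤-trans bound n≤ ⟩
          suc (2 * m) ∎) (<⇒≱ (≤-reflexive (sym (*-suc 2 m))))
    cases : ∀ e → s + e ≡ m → s ≡ m × A ≡ 1 × m C ρ ≤ d × none ≡ 0 × bp ≡ 1 × bq ≡ 1
    cases (suc e) eq = contradiction s<3 (<⇒≱ (s≤s (s≤s (≤-trans (s≤s (2≤ρ)) ρ<s)) ))
      where
      grow : s C ρ + s + 2 * e ≤ m C ρ
      grow = begin
        s C ρ + s + 2 * e   ≤⟨ +-monoˡ-≤ (2 * e) (C-step s ρ 2≤ρ (<⇒≤ ρ<s)) ⟩
        suc s C ρ + 2 * e   ≤⟨ C-growth (suc s) e ρ 2≤ρ (m≤n⇒m≤1+n (<⇒≤ ρ<s)) ⟩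
        (suc s + e) C ρ     ≡⟨ cong (_C ρ) (trans (sym (+-suc s e)) eq) ⟩
        m C ρ ∎
      s<3 : suc (suc s) ≤ 4
      s<3 = +-cancelˡ-≤ (s C ρ + 2 * e + 2 * s) _ _ (begin
        s C ρ + 2 * e + 2 * s + suc (suc s)         ≡⟨ l₁ (s C ρ) e s ⟩
        suc (s C ρ + s + 2 * e) + 2 * s + 1         ≤⟨ +-monoˡ-≤ 1 (+-monoˡ-≤ (2 * s) (≤-trans (s≤s grow) (≤-trans C<δ (≤-trans δ≤ (+-monoʳ-≤ A d≤))))) ⟩
        A + s C ρ + 2 * s + 1                       ≡⟨ l₂ A (s C ρ) s ⟩
        s C ρ + 1 + (A + 2 * s)                     ≤⟨ +-monoʳ-≤ (s C ρ + 1) (≤-trans (m≤m+n (A + 2 * s) none) (≤-trans bound n≤)) ⟩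
        s C ρ + 1 + suc (2 * m)                     ≡⟨ cong (λ k → s C ρ + 1 + suc (2 * k)) (sym eq) ⟩
        s C ρ + 1 + suc (2 * (s + suc e))           ≡⟨ l₃ (s C ρ) s e ⟩
        s C ρ + 2 * e + 2 * s + 4 ∎)
        where
        l₁ : ∀ c e s → c + 2 * e + 2 * s + suc (suc s) ≡ suc (c + s + 2 * e) + 2 * s + 1
        l₁ = solve-∀
        l₂ : ∀ A c s → A + c + 2 * s + 1 ≡ c + 1 + (A + 2 * s)
        l₂ = solve-∀
        l₃ : ∀ c s e → c + 1 + suc (2 * (s + suc e)) ≡ c + 2 * e + 2 * s + 4
        l₃ = solve-∀
    cases zero eq = s≡m , A≡1 , s≤s⁻¹ (≤-trans C<δ (≤-trans δ≤ (≤-reflexive (cong (_+ d) A≡1)))) , none≡0 , bp≡1 , bq≡1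
      where
      s≡m : s ≡ m
      s≡m = trans (sym (+-identityʳ s)) eq
      A+none : A + none ≤ 1
      A+none = +-cancelˡ-≤ (2 * s) _ _ (begin
        2 * s + (A + none) ≡⟨ l A s none ⟩
        A + 2 * s + none   ≤⟨ ≤-trans bound n≤ ⟩
        suc (2 * m)        ≡⟨ cong (λ k → suc (2 * k)) (sym s≡m) ⟩
        suc (2 * s)        ≡⟨ +-comm 1 (2 * s) ⟩
        2 * s + 1 ∎)
        where
        l : ∀ A s none → 2 * s + (A + none) ≡ A + 2 * s + none
        l = solve-∀
      1≤A : 1 ≤ A
      1≤A = +-cancelʳ-≤ (m C ρ) 1 A (≤-trans C<δ (≤-trans δ≤ (+-monoʳ-≤ A (subst (λ k → d ≤ k C ρ) s≡m d≤))))
      A≡1 : A ≡ 1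
      A≡1 = ≤-antisym (≤-trans (m≤m+n A none) A+none) 1≤A
      none≡0 : none ≡ 0
      none≡0 = n≤0⇒n≡0 (s≤s⁻¹ (subst (λ k → k + none ≤ 1) A≡1 A+none))
      ends : 2 ≤ bp + bq
      ends = +-cancelˡ-≤ (suc (2 * s)) _ _ (begin
        suc (2 * s) + 2             ≤⟨ +-monoˡ-≤ 2 (≤-trans (+-monoˡ-≤ (2 * s) 1≤A) (m≤m+n _ none)) ⟩
        A + 2 * s + none + 2        ≤⟨ total ⟩
        n + (bp + bq)               ≤⟨ +-monoˡ-≤ (bp + bq) n≤ ⟩
        suc (2 * m) + (bp + bq)     ≡⟨ cong (λ k → suc (2 * k) + (bp + bq)) (sym s≡m) ⟩
        suc (2 * s) + (bp + bq) ∎)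
      bp≡1 : bp ≡ 1
      bp≡1 = ≤-antisym bp≤ (+-cancelʳ-≤ 1 1 bp (≤-trans ends (+-monoʳ-≤ bp bq≤)))
      bq≡1 : bq ≡ 1
      bq≡1 = ≤-antisym bq≤ (+-cancelˡ-≤ 1 1 bq (≤-trans ends (+-monoˡ-≤ bq bp≤)))

  -- The extremal situation left by counting the edges at z.
  record Covered (z : Fin n) (ls : List (Link n)) (F : List (Subset n)) (c : Subset n) : Set where
    field
      cover  : ∀ {a e b} → a ⟨ just e ⟩ b ∈ₗ ls → z ∈ e ⊎ (Hit z F a ⊎ Hit z F b)
      only   : ∀ {a e b} → a ⟨ just e ⟩ b ∈ₗ ls → z ∈ e → e ≡ c
      second : ∀ {v} → Hit z F v → ∀ h → ∃ λ h′ → h′ ∈ₗ F × (z ∈ h′ × v ∈ h′) × h′ ≢ h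

  Covered-flip : ∀ {z ls F c} → Covered z ls F c → Covered z (rev ls) F c
  Covered-flip {ls = ls} Cv = record
    { cover  = λ l∈ → [ inj₁ , inj₂ ∘ swap ]′ (cover (∈-rev⁻ ls l∈))
    ; only   = λ l∈ → only (∈-rev⁻ ls l∈)
    ; second = second
    }
    where open Covered Cv

  -- As `t` is not hit, `v` is. Placing `z` after `v` gives a path with ends `t` and `z`. Labels and
  -- free edges at z then make every edge from `t` to the head of a suitable link a crossing, which
  -- confines the edges at `t` to vertices hit.
  module Forward {z p q ls F c v e t} (L : LineBut z p q ls F) (Cv : Covered z ls F c)
                 (l∈ : v ⟨ just e ⟩ t ∈ₗ ls) (¬hit : ¬ Hit z F t) (t∉c : ¬ t ∈ c) where
    open Covered Cv

    z∉e : ¬ z ∈ e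
    z∉e ze with only l∈ ze
    ... | refl = t∉c (proj₂ (spine-joins L l∈))

    hit-v : Hit z F v
    hit-v = [ absurd ∘ z∉e , [ id , absurd ∘ ¬hit ]′ ]′ (cover l∈)

    module _ {h} (h∈ : h ∈ₗ F) (zh : z ∈ h) (vh : v ∈ h) where
      F′ = proj₁ (pick h∈)
      perm = proj₂ (pick h∈)
      ms = proj₁ (place∈ L l∈ perm zh vh)
      G : Gap t z ms (e ∷ F′)
      G = proj₁ (proj₂ (place∈ L l∈ perm zh vh))
      keep : ∀ {l} → l ∈ₗ ls → head l ≢ t → l ∈ₗ ms
      keep = proj₂ (proj₂ (place∈ L l∈ perm zh vh))

      rest : ∀ {g} → g ∈ₗ F → g ≢ h → g ∈ₗ F′
      rest g∈ g≢h with ∈-resp-↭ perm g∈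
      ... | here eq = absurd (g≢h eq)
      ... | there p = p

      reach : ∀ {g a e₁ s} → g ∈ₗ e ∷ F′ → ¬ z ∈ g → t ∈ g → s ∈ g → s ≢ t → a ⟨ just e₁ ⟩ s ∈ₗ ls → Hit z F s
      reach {g} {a} {e₁} {s} g∈ z∉g tg sg s≢t k∈ with cover k∈
      ... | inj₂ (inj₂ hs) = hs
      ... | inj₁ ze₁ with pick g∈
      ... | F″ , perm′ = absurd (¬ham (cross∈ G (keep k∈ s≢t) (prep e₁ perm′) (proj₁ (spine-joins L k∈)) ze₁ tg sg))
      -- The edge `h` was spent on placing `z`, so a second free edge through `z` and `a` is
      -- required.
      reach {g} {a} {e₁} {s} g∈ z∉g tg sg s≢t k∈ | inj₂ (inj₁ ha) with second ha h
      ... | h′ , h′∈ , (zh′ , ah′) , h′≢h with pick₂ (there {x = e} (rest h′∈ h′≢h)) g∈ (λ { refl → z∉g zh′ })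
      ... | F″ , perm′ = absurd (¬ham (cross∈ G (keep k∈ s≢t)
              (↭-trans (prep e₁ perm′) (↭-trans (Perm.swap _ _ ↭-refl) (prep h′ (Perm.swap _ _ ↭-refl)))) ah′ zh′ tg sg))

      not-labelled : ∀ {a φ b} → a ⟨ just φ ⟩ b ∈ₗ ls → t ∈ φ → b ≢ t → ¬ Hit z F a
      not-labelled {φ = φ} k∈ tφ b≢t ha with second ha h
      ... | h′ , h′∈ , (zh′ , ah′) , h′≢h with pick (there {x = e} (rest h′∈ h′≢h))
      ... | F″ , perm′ = ¬ham (cross∈ G (keep k∈ b≢t)
              (↭-trans (prep φ perm′) (Perm.swap _ _ ↭-refl)) ah′ zh′ tφ (proj₂ (spine-joins L k∈)))

    reach-free : ∀ {g a e₁ s} → g ∈ₗ F → ¬ z ∈ g → t ∈ g → s ∈ g → s ≢ t → a ⟨ just e₁ ⟩ s ∈ₗ ls → Hit z F s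
    reach-free g∈ z∉g with find hit-v
    ... | h , h∈ , zh , vh = reach h∈ zh vh (there (rest h∈ zh vh g∈ λ { refl → z∉g zh })) z∉g

    reach-own : ∀ {a e₁ s} → s ∈ e → s ≢ t → a ⟨ just e₁ ⟩ s ∈ₗ ls → Hit z F s
    reach-own with find hit-v
    ... | h , h∈ , zh , vh = reach h∈ zh vh (here refl) z∉e (proj₂ (spine-joins L l∈))

    not-on : ∀ {a φ b} → a ⟨ just φ ⟩ b ∈ₗ ls → t ∈ φ → b ≢ t → ¬ Hit z F a
    not-on with find hit-v
    ... | h , h∈ , zh , vh = not-labelled h∈ zh vh

  module _ {z p q ls F c} (L : LineBut z p q ls F) (Cv : Covered z ls F c) (hit-p : Hit z F p) (hit-q : Hit z F q)
           (few : length (filter (hit? z F) (p ∷ heads ls)) ≤ m) where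
    private
      uses = proj₂ (proj₂ (proj₁ L))
      N = filter (hit? z F) (p ∷ heads ls)
      Lᶠ = LineBut-flip L
      Cvᶠ = Covered-flip Cv
    open Covered Cv

    head-link : ∀ {z p q ls F} → LineBut z p q ls F → ∀ {v} → v ∈ₗ p ∷ heads ls → v ≢ p →
                ∃₂ λ a e → a ⟨ just e ⟩ v ∈ₗ ls
    head-link L (here eq) v≢p = absurd (v≢p eq)
    head-link {ls = ls} {F = F} L (there v∈) v≢p with ∈-head-link v∈
    ... | a , ℓ , l∈ with line-label {ls} {F} (proj₂ (proj₂ (proj₁ L))) l∈
    ... | e , refl , _ = a , e , l∈

    -- Otherwise every edge at `t` lies in `t` together with the at most m vertices hit, so that the
    -- degree of `t` is at most C(m, ρ) < δ.
    covered-∈ : ∀ {t} → t ∈ₗ p ∷ heads ls → ¬ Hit z F t → t ∈ c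
    covered-∈ {t} t∈ ¬hit with t ∈? c
    ... | yes t∈c = t∈c
    ... | no t∉c = contradiction (≤-trans C<δ (≤-trans (deg t) few-edges)) (<-irrefl refl)
      where
      t≢z : t ≢ z
      t≢z refl = spine∌z L t∈
      back : ∀ {s} → s ≢ z → s ≢ q → ∃₂ λ a e → a ⟨ just e ⟩ s ∈ₗ rev ls
      back s≢z = head-link Lᶠ (spine-complete Lᶠ s≢z)
      own = head-link L t∈ λ { refl → ¬hit hit-p }
      ownᶠ = back t≢z λ { refl → ¬hit hit-q }
      near : ∀ {φ} → φ ∈ₗ E → t ∈ φ → ∀ {s} → s ∈ φ → s ∈ₗ t ∷ N
      near {φ} φ∈ tφ {s} sφ with s F.≟ t
      ... | yes eq = here eq
      ... | no s≢t = there (∈-filter⁺ (hit? z F) s∈ hit-s)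
        where
        z∉φ : ¬ z ∈ φ
        z∉φ zφ with E-cases {ls} {F} uses φ∈
        ... | inj₂ φ∈F = ¬hit (lose φ∈F (zφ , tφ))
        ... | inj₁ (a , b , l∈) with only l∈ zφ
        ... | refl = t∉c tφ
        s≢z : s ≢ z
        s≢z refl = z∉φ sφ
        s∈ : s ∈ₗ p ∷ heads ls
        s∈ = spine-complete L s≢z
        hit-s : Hit z F s
        hit-s with s F.≟ p | s F.≟ q
        ... | yes refl | _ = hit-p
        ... | _ | yes refl = hit-q
        ... | no s≢p | no s≢q with E-cases {ls} {F} uses φ∈ | head-link L s∈ s≢p | back s≢z s≢q
        ... | inj₂ φ∈F | _ , _ , k∈ | _ =
              Forward.reach-free L Cv (proj₂ (proj₂ own)) ¬hit t∉c φ∈F z∉φ tφ sφ s≢t k∈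
        ... | inj₁ (a , b , l∈) | _ , _ , k∈ | _ , _ , k∈ᶠ with b F.≟ t | a F.≟ t | cover l∈
        ... | yes refl | _ | _ = Forward.reach-own L Cv l∈ ¬hit t∉c sφ s≢t k∈
        ... | no _ | yes refl | _ = Forward.reach-own Lᶠ Cvᶠ (∈-rev l∈) ¬hit t∉c sφ s≢t k∈ᶠ
        ... | no _ | no _ | inj₁ zφ = absurd (z∉φ zφ)
        ... | no b≢t | no _ | inj₂ (inj₁ ha) = absurd (Forward.not-on L Cv (proj₂ (proj₂ own)) ¬hit t∉c l∈ tφ b≢t ha)
        ... | no _ | no a≢t | inj₂ (inj₂ hb) = absurd (Forward.not-on Lᶠ Cvᶠ (proj₂ (proj₂ ownᶠ)) ¬hit t∉c (∈-rev l∈) tφ a≢t hb)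
      few-edges : count (t ∈?_) E ≤ m C ρ
      few-edges = ≤-trans (family-bound [ t ] N (Unique.filter⁺ (t ∈?_) uniq) ([] ∷ []) λ {e} e∈ →
          let e∈E , te = ∈-filter⁻ (t ∈?_) {xs = E} e∈ in
          unif e∈E , (λ { (here refl) → te }) , near e∈E te)
        (C-mono-≤ ρ few)

    -- Of at least 2m vertices of the line at most m are hit. The others, at least m, lie in `c`
    -- along with `z`, but `c` has only ρ + 1 ≤ m vertices.
    covered-impossible : z ∈ c → c ∈ₗ E → suc (2 * m) ≤ n → ρ < m → Empty
    covered-impossible zc c∈ n≥ ρ<m = contradiction (≤-trans big (≤-reflexive (unif c∈))) (<⇒≱ (s≤s ρ<m))
      where
      M = filter (¬? ∘ hit? z F) (p ∷ heads ls)
      big : suc m ≤ ∣ c ∣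
      big = ≤-trans (s≤s m≤M) (size-≥ c {z ∷ M} (Unique-∷ (λ z∈ → spine∌z L (proj₁ (∈-filter⁻ (¬? ∘ hit? z F) z∈)))
              (Unique.filter⁺ (¬? ∘ hit? z F) (AllPairs.tail (spine-unique L))))
            λ { (here refl) → zc ; (there t∈) → let t∈′ , ¬h = ∈-filter⁻ (¬? ∘ hit? z F) {xs = p ∷ heads ls} t∈ in covered-∈ t∈′ ¬h })
        where
        m≤M : m ≤ length M
        m≤M = +-cancelˡ-≤ m m (length M) (begin
          m + m                ≡⟨ cong (m +_) (sym (+-identityʳ m)) ⟩
          2 * m                ≤⟨ s≤s⁻¹ (≤-trans n≥ (≤-reflexive (sym (line-length L)))) ⟩
          suc (length ls)      ≡⟨ cong suc (sym (length-map head ls)) ⟩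
          length (p ∷ heads ls) ≡⟨ sym (count-¬ (hit? z F) (p ∷ heads ls)) ⟩
          length N + length M  ≤⟨ +-monoˡ-≤ (length M) few ⟩
          m + length M ∎)
          where open ≤-Reasoning

  -- No link joins two vertices hit, and a link with `z` in its label has no end that is hit. So
  -- these links, those leaving a vertex hit and those entering one are counted separately, and
  -- equality holds throughout.
  module Independent {z p q ls F} (L : LineBut z p q ls F) (two : 2 ≤ count (z ∈?_) F)
    (¬double : ¬ Any (λ l → Hit z F (tail l) × Hit z F (head l)) ls) where
    uses = proj₂ (proj₂ (proj₁ L))
    H? = hit? z F
    N = filter H? (p ∷ heads ls)
    d = count (z ∈?_) F

    near : ∀ {e} → e ∈ₗ F → z ∈ e → ∀ {v} → v ∈ e → v ∈ₗ z ∷ N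
    near e∈ ze {v} ve with v F.≟ z
    ... | yes eq = here eq
    ... | no v≢z = there (∈-filter⁺ H? (spine-complete L v≢z) (lose e∈ (ze , ve)))

    free-bound : d ≤ length N C ρ
    free-bound = family-bound [ z ] N (Unique.filter⁺ (z ∈?_) (free-unique {ls} {F} uses)) ([] ∷ []) λ {e} e∈ →
      let e∈F , ze = ∈-filter⁻ (z ∈?_) {xs = F} e∈ in
      unif (free∈E {ls} {F} uses e∈F) , (λ { (here refl) → ze }) , near e∈F ze

    ρ<N : ρ < length N
    ρ<N with suc ρ ≤? length N
    ... | yes p = p
    ... | no ¬p with m≤n⇒m<n∨m≡n (s≤s⁻¹ (≰⇒> ¬p))
    ... | inj₁ lt = contradiction (≤-trans two (≤-trans free-bound (≤-reflexive (k>n⇒nCk≡0 lt)))) λ ()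
    ... | inj₂ eq = contradiction (≤-trans two (≤-trans free-bound (≤-reflexive (trans (cong (_C ρ) eq) (nCn≡1 ρ))))) λ { (s≤s ()) }

    T? = H? ∘ tail
    B? = H? ∘ head
    on-or-tail? : ∀ l → Dec (z ∈ˡ label l ⊎ Hit z F (tail l))
    on-or-tail? l = on? z l ⊎-dec T? l
    any-of? : ∀ l → Dec ((z ∈ˡ label l ⊎ Hit z F (tail l)) ⊎ Hit z F (head l))
    any-of? l = on-or-tail? l ⊎-dec B? l

    on-clear : ∀ {l} → l ∈ₗ ls → z ∈ˡ label l → ¬ Hit z F (tail l) × ¬ Hit z F (head l)
    on-clear {l} l∈ zl with line-label {ls} {F} uses l∈
    on-clear {_ ⟨ _ ⟩ _} l∈ zl | e , refl , _ =
      (λ h → let f , f∈ , zf , af = find h in proj₁ (on-avoids L l∈ zl f∈ zf) af) ,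
      (λ h → let f , f∈ , zf , bf = find h in proj₂ (on-avoids L l∈ zl f∈ zf) bf)

    parts : count (on? z) ls + count T? ls + count B? ls ≤ count any-of? ls
    parts = ≤-trans
      (+-monoˡ-≤ (count B? ls) (count-⊎-≥ (on? z) T? on-or-tail? ls (λ _ → inj₁) (λ _ → inj₂) λ l∈ zl → proj₁ (on-clear l∈ zl)))
      (count-⊎-≥ on-or-tail? B? any-of? ls (λ _ → inj₁) (λ _ → inj₂) λ
        { l∈ (inj₁ zl) → proj₂ (on-clear l∈ zl) ; l∈ (inj₂ ht) hh → ¬double (lose l∈ (ht , hh)) })

    facts = tight-count (line-length L) (count-¬ any-of? ls) (count-tails L H?) (count-heads L H?) parts
      (count-≤-length H? [ p ]) (count-≤-length H? [ q ])
      (≤-trans (deg z) (≤-reflexive (sym (degree-split {ls} {F} uses z)))) free-bound ρ<N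

    impossible : Empty
    impossible with facts | count-witness (on? z) ls | count-witness H? [ p ] | count-witness H? [ q ]
    ... | s≡m , one-on , full , none , hp , hq | won | wp | wq
      with won (≤-reflexive (sym one-on)) | wp (≤-reflexive (sym hp)) | wq (≤-reflexive (sym hq))
    ... | (a ⟨ ℓ ⟩ b) , l∈ , zl | _ , here refl , hit-p | _ , here refl , hit-q with line-label {ls} {F} uses l∈
    ... | c , refl , c∈ = covered-impossible L covered hit-p hit-q (≤-reflexive s≡m) zl c∈ n-big (subst (ρ <_) s≡m ρ<N)
      where
      n-big : suc (2 * m) ≤ n
      n-big = begin
        suc (2 * m)                              ≡⟨ cong (λ k → suc (2 * k)) (sym s≡m) ⟩
        suc (length N + (length N + 0))          ≡⟨ cong₂ (λ t h → suc (t + (h + 0))) (sym (count-tails L H?)) (sym (count-heads L H?)) ⟩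
        suc (count T? ls + count H? [ q ] + (count H? [ p ] + count B? ls + 0))
          ≡⟨ cong₂ (λ i j → suc (count T? ls + i + (j + count B? ls + 0))) hq hp ⟩
        suc (count T? ls + 1 + (1 + count B? ls + 0)) ≡⟨ lem (count T? ls) (count B? ls) ⟩
        suc (suc (1 + count T? ls + count B? ls)) ≡⟨ cong (λ k → suc (suc (k + count T? ls + count B? ls))) (sym one-on) ⟩
        suc (suc (count (on? z) ls + count T? ls + count B? ls)) ≤⟨ s≤s (s≤s (≤-trans parts (count-≤-length any-of? ls))) ⟩
        suc (suc (length ls))                    ≡⟨ line-length L ⟩
        n ∎
        where
        open ≤-Reasoning
        lem : ∀ t b → suc (t + 1 + (1 + b + 0)) ≡ suc (suc (1 + t + b))
        lem = solve-∀
      covered : Covered z ls F c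
      covered = record { cover = cover ; only = only ; second = second }
        where
        cover : ∀ {a e b} → a ⟨ just e ⟩ b ∈ₗ ls → z ∈ e ⊎ (Hit z F a ⊎ Hit z F b)
        cover {a} {e} {b} k∈ with any-of? (a ⟨ just e ⟩ b)
        ... | yes (inj₁ (inj₁ ze)) = inj₁ ze
        ... | yes (inj₁ (inj₂ ha)) = inj₂ (inj₁ ha)
        ... | yes (inj₂ hb) = inj₂ (inj₂ hb)
        ... | no ¬any = contradiction (count-pos (¬? ∘ any-of?) k∈ ¬any) (<⇒≱ (s≤s (≤-reflexive none)))
        only : ∀ {a e b} → a ⟨ just e ⟩ b ∈ₗ ls → z ∈ e → e ≡ c
        only k∈ ze with length-one one-on (∈-filter⁺ (on? z) k∈ ze) (∈-filter⁺ (on? z) l∈ zl)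
        ... | refl = refl
        -- Equality means that all C(m, ρ) sets through `z` and vertices hit are free edges. Only
        -- C(m - 1, ρ) of them miss `v`, at least two fewer.
        second : ∀ {v} → Hit z F v → ∀ h → ∃ λ h′ → h′ ∈ₗ F × (z ∈ h′ × v ∈ h′) × h′ ≢ h
        second {v} hv h = two-of P? (free-unique {ls} {F} uses) (many (v F.≟ z)) _≟ˢ_ h
          where
          P? : ∀ e → Dec (z ∈ e × v ∈ e)
          P? e = (z ∈? e) ×-dec (v ∈? e)
          Q? : ∀ e → Dec (z ∈ e × ¬ v ∈ e)
          Q? e = (z ∈? e) ×-dec ¬? (v ∈? e)
          many : Dec (v ≡ z) → 2 ≤ count P? F
          many (yes refl) = ≤-trans two (count-mono (z ∈?_) P? F λ _ zf → zf , zf)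
          many (no v≢z) with ∈-∃++ (∈-filter⁺ H? {xs = p ∷ heads ls} (spine-complete L v≢z) hv)
          ... | N₁ , N₂ , N≡ = +-cancelʳ-≤ (ℕ.pred m C ρ) 2 _ (begin
              2 + ℕ.pred m C ρ         ≤⟨ C-drop m ρ 2≤ρ (subst (ρ <_) s≡m ρ<N) ⟩
              m C ρ                    ≤⟨ full ⟩
              d                        ≤⟨ count-⊎-≤ P? Q? (z ∈?_) F split-v ⟩
              count P? F + count Q? F  ≤⟨ +-monoʳ-≤ (count P? F) few ⟩
              count P? F + ℕ.pred m C ρ ∎)
            where
            open ≤-Reasoning
            N↭ : N ↭ v ∷ N₁ ++ N₂
            N↭ = ↭-trans (↭-reflexive N≡) (shift v N₁ N₂)
            split-v : ∀ {e} → e ∈ₗ F → z ∈ e → (z ∈ e × v ∈ e) ⊎ (z ∈ e × ¬ v ∈ e)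
            split-v {e} _ ze with v ∈? e
            ... | yes ve = inj₁ (ze , ve)
            ... | no ¬ve = inj₂ (ze , ¬ve)
            len : length (N₁ ++ N₂) ≡ ℕ.pred m
            len = cong ℕ.pred (trans (sym (↭-length N↭)) s≡m)
            few : count Q? F ≤ ℕ.pred m C ρ
            few = subst (λ k → count Q? F ≤ k C ρ) len
              (family-bound [ z ] (N₁ ++ N₂) (Unique.filter⁺ Q? (free-unique {ls} {F} uses)) ([] ∷ []) λ {e} e∈ →
                let e∈F , ze , ¬ve = ∈-filter⁻ Q? {xs = F} e∈ in
                unif (free∈E {ls} {F} uses e∈F) , (λ { (here refl) → ze }) , λ we → case near e∈F ze we of λ
                  { (here eq) → here eq
                  ; (there w∈) → case ∈-resp-↭ N↭ w∈ of λ { (here refl) → absurd (¬ve we) ; (there w∈′) → there w∈′ } })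

  -- Induction on the number of free edges at `z`. If both ends of a link are hit, then they are hit
  -- by the same edge; making it the label frees one that misses `z`, and the number drops.
  no-insertion′ : ∀ k {z p q ls F} → LineBut z p q ls F → ¬ count (z ∈?_) F ≡ suc k
  no-insertion′ zero L eq = one-hit L eq
  no-insertion′ (suc k) {z} {p} {q} {ls} {F} L eq
    with Any.any? (λ l → hit? z F (tail l) ×-dec hit? z F (head l)) ls
  ... | no ¬double = Independent.impossible L (≤-trans (s≤s (s≤s z≤n)) (≤-reflexive (sym eq))) ¬double
  ... | yes double with find double
  ... | (a ⟨ ℓ ⟩ b) , l∈ , ha , hb with line-label {ls} {F} (proj₂ (proj₂ (proj₁ L))) l∈ | find ha | find hb
  ... | e , refl , _ | f , f∈ , zf , af | g , g∈ , zg , bg with no-two-hits L l∈ f∈ g∈ zf af zg bg | ∈-∃++ l∈ | pick f∈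
  ... | refl | l₁ , l₂ , refl | F′ , perm =
    no-insertion′ k (LineBut-swap l₁ L (↭-trans (prep e perm) (Perm.swap e f ↭-refl)) af bg)
      (trans (count-no (z ∈?_) z∉e) (suc-injective (trans (sym (count-yes (z ∈?_) zf)) (trans (sym (count-↭ (z ∈?_) perm)) eq))))
    where
    z∉e : ¬ z ∈ e
    z∉e ze = proj₁ (on-avoids L l∈ ze f∈ zf) af

  no-insertion : ∀ {z F} → CycleBut z F → ¬ (∃ λ f → f ∈ₗ F × z ∈ f)
  no-insertion {z} {F} cyc (f , f∈ , zf) with CycleBut⇒LineBut cyc | count (z ∈?_) F in eq | count-pos (z ∈?_) f∈ zf
  ... | _ , _ , _ , L | suc k | _ = no-insertion′ k L eq

  -- Paths with a gap and the vertices reached from their ends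

  module _ {ls : List (Link n)} {F : List (Subset n)} (uses : Uses ls F) where
    gap-label : ∀ {a e b} → a ⟨ just e ⟩ b ∈ₗ ls → e ∈ₗ E
    gap-label l∈ with ∈-resp-↭ uses (∈-++⁺ˡ (∈-map⁺ label l∈))
    ... | there p = just⁻ p

    gap-free : ∀ {f} → f ∈ₗ F → f ∈ₗ E
    gap-free f∈ with ∈-resp-↭ uses (∈-++⁺ʳ (labels ls) (∈-map⁺ just f∈))
    ... | there p = just⁻ p

    gap-unique : Unique (labels ls ++ map just F)
    gap-unique = Unique-resp-↭ (↭-sym uses) (Unique-∷ (nothing∉just E) (Unique.map⁺ just-injective uniq))

    gap-labels-unique : Unique (labels ls)
    gap-labels-unique = Unique-++ˡ (labels ls) gap-unique

    gap-free-unique : Unique F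
    gap-free-unique = Unique.map⁻ (Unique-++ʳ (labels ls) gap-unique)

    gap-free-used : ∀ {a e b} → a ⟨ just e ⟩ b ∈ₗ ls → ¬ e ∈ₗ F
    gap-free-used {e = e} l∈ e∈ with ∈-∃++ (∈-map⁺ label l∈)
    ... | xs , ys , eq = ∉-head (Unique-++ʳ xs (subst Unique (trans (cong (_++ map just F) eq) (++-assoc xs _ _)) gap-unique))
            (∈-++⁺ʳ ys (∈-map⁺ just e∈))

    gap-degree : ∀ v → count (on? v) ls + count (v ∈?_) F ≡ count (v ∈?_) E
    gap-degree v = trans (sym (cong₂ _+_ (count-map (v ∈ˡ?_) label ls) (count-map (v ∈ˡ?_) just F)))
      (trans (sym (count-++ (v ∈ˡ?_) (labels ls) (map just F)))
      (trans (count-↭ (v ∈ˡ?_) uses) (count-map (v ∈ˡ?_) just E)))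

    gap-cases : ∀ {e} → e ∈ₗ E → (∃₂ λ a b → a ⟨ just e ⟩ b ∈ₗ ls) ⊎ (e ∈ₗ F)
    gap-cases e∈ with ∈-++⁻ (labels ls) (∈-resp-↭ (↭-sym uses) (there (∈-map⁺ just e∈)))
    ... | inj₂ p = inj₂ (just⁻ p)
    ... | inj₁ p with ∈-map⁻ label p
    ... | (a ⟨ _ ⟩ b) , l∈ , refl = inj₁ (a , b , l∈)

    gap-special : ∃₂ λ a b → a ⟨ nothing ⟩ b ∈ₗ ls
    gap-special with ∈-++⁻ (labels ls) (∈-resp-↭ (↭-sym uses) (here refl))
    ... | inj₂ p = absurd (nothing∉just F p)
    ... | inj₁ p with ∈-map⁻ label p
    ... | (a ⟨ _ ⟩ b) , l∈ , refl = a , b , l∈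

  module _ {w u ls F} (G : Gap w u ls F) where
    path-unique : Unique (w ∷ heads ls)
    path-unique = Unique-resp-↭ (↭-sym (proj₁ (proj₂ G))) Unique-allFin

    path-complete : ∀ v → v ∈ₗ w ∷ heads ls
    path-complete v = ∈-resp-↭ (↭-sym (proj₁ (proj₂ G))) (∈-allFin v)

    path-length : suc (length ls) ≡ n
    path-length = trans (cong suc (sym (length-map head ls))) (trans (↭-length (proj₁ (proj₂ G))) length-allFin)

    tails-u-unique : Unique (tails ls ++ [ u ])
    tails-u-unique = subst Unique (sym (tails-chain (proj₁ G))) path-unique

    tails-unique : Unique (tails ls)
    tails-unique = Unique-++ˡ (tails ls) tails-u-unique

    u∉tails : u ∉ₗ tails ls
    u∉tails = ∉-head (Unique-resp-↭ (↭-++-comm (tails ls) [ u ]) tails-u-unique)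

    ∈-tails : ∀ {v} → v ≢ u → v ∈ₗ tails ls
    ∈-tails {v} v≢u with ∈-++⁻ (tails ls) (subst (v ∈ₗ_) (sym (tails-chain (proj₁ G))) (path-complete v))
    ... | inj₁ p = p
    ... | inj₂ (here eq) = absurd (v≢u eq)

    gap-joins : ∀ {a e b} → a ⟨ just e ⟩ b ∈ₗ ls → a ∈ e × b ∈ e
    gap-joins l∈ = link-joins (proj₁ G) l∈

    link≢ : ∀ {a ℓ b} → a ⟨ ℓ ⟩ b ∈ₗ ls → a ≢ b
    link≢ {a} {ℓ} l∈ refl with ∈-∃++ l∈
    ... | l₁ , l₂ , refl with split l₁ (proj₁ G)
    ... | _ , c₁ , (_ ∷ _) = ∉-head (Unique-resp-↭ (shift a (w ∷ heads l₁) (heads l₂))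
            (subst (λ h → Unique (w ∷ h)) (heads-++ l₁ _) path-unique))
            (∈-++⁺ˡ (subst (a ∈ₗ_) (tails-chain c₁) (∈-++⁺ʳ (tails l₁) (here refl))))

    unique-tail : ∀ {k l} → k ∈ₗ ls → l ∈ₗ ls → tail k ≡ tail l → k ≡ l
    unique-tail {k} {l} = go tails-unique
      where
      go : ∀ {ks} → Unique (tails ks) → k ∈ₗ ks → l ∈ₗ ks → tail k ≡ tail l → k ≡ l
      go u (here refl) (here refl) eq = refl
      go (x∉ ∷ u) (here refl) (there q) eq = absurd (All.lookup x∉ (∈-map⁺ tail q) eq)
      go (x∉ ∷ u) (there p) (here refl) eq = absurd (All.lookup x∉ (∈-map⁺ tail p) (sym eq))
      go (x∉ ∷ u) (there p) (there q) eq = go u p q eq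

    not-closing : ∀ {f} → f ∈ₗ F → u ∈ f → ¬ w ∈ f
    not-closing f∈ uf wf = ¬ham (Cycle⇒Ham (close G (proj₂ (pick f∈)) uf wf))

    -- A crossing that reuses the opened label: `f` joins `u` to `a`, and `e` joins `w` to `b`.
    cross-label : ∀ {a e b f} → a ⟨ just e ⟩ b ∈ₗ ls → f ∈ₗ F → u ∈ f → a ∈ f → ¬ w ∈ e
    cross-label l∈ f∈ uf af we with pick f∈
    ... | _ , perm = ¬ham (cross∈ G l∈ (↭-trans (prep _ perm) (Perm.swap _ _ ↭-refl)) af uf we (proj₂ (gap-joins l∈)))

    cross-labelʷ : ∀ {a e b g} → a ⟨ just e ⟩ b ∈ₗ ls → g ∈ₗ F → w ∈ g → b ∈ g → ¬ u ∈ e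
    cross-labelʷ l∈ g∈ wg bg ue with pick g∈
    ... | _ , perm = ¬ham (cross∈ G l∈ (prep _ perm) (proj₁ (gap-joins l∈)) ue wg bg)

    swap∈ : ∀ {a e b f} → a ⟨ just e ⟩ b ∈ₗ ls → f ∈ₗ F → a ∈ f → b ∈ f → ∃₂ λ ls′ F′ → Gap w u ls′ F′ ×
            Similar ls ls′ × e ∈ₗ F′ × (∀ {g} → g ∈ₗ F → g ≢ f → g ∈ₗ F′) × (∀ {l} → l ∈ₗ ls → label l ≢ just e → l ∈ₗ ls′)
    swap∈ {a} {e} {b} {f} l∈ f∈ af bf with ∈-∃++ l∈ | pick f∈
    ... | l₁ , l₂ , refl | F′ , perm = l₁ ++ a ⟨ just f ⟩ b ∷ l₂ , e ∷ F′ ,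
      Gap-swap l₁ G (↭-trans (prep e perm) (Perm.swap e f ↭-refl)) af bf , Similar-at l₁ , here refl , keep , stay
      where
      keep : ∀ {g} → g ∈ₗ F → g ≢ f → g ∈ₗ e ∷ F′
      keep g∈ g≢f with ∈-resp-↭ perm g∈
      ... | here eq = absurd (g≢f eq)
      ... | there p = there p
      stay : ∀ {l} → l ∈ₗ l₁ ++ a ⟨ just e ⟩ b ∷ l₂ → label l ≢ just e → l ∈ₗ l₁ ++ a ⟨ just f ⟩ b ∷ l₂
      stay p ne with ∈-++⁻ l₁ p
      ... | inj₁ q = ∈-++⁺ˡ q
      ... | inj₂ (here refl) = absurd (ne refl)
      ... | inj₂ (there q) = ∈-++⁺ʳ l₁ (there q)

  -- t and s are the two ends u and w, in either order.
  Crossable : Fin n → Fin n → Fin n → Fin n → Set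
  Crossable w u t s = ∀ {ls F} → Gap w u ls F →
    (∀ {f} → f ∈ₗ F → t ∈ f → ¬ s ∈ f) ×
    (∀ {a e b f} → a ⟨ just e ⟩ b ∈ₗ ls → f ∈ₗ F → t ∈ f → a ∈ f → b ∈ f → ¬ s ∈ e)

  crossableᵘ : ∀ {w u} → Crossable w u u w
  crossableᵘ G = not-closing G , λ l∈ f∈ uf af _ → cross-label G l∈ f∈ uf af

  crossableʷ : ∀ {w u} → Crossable w u w u
  crossableʷ G = (λ g∈ wg ug → not-closing G g∈ ug wg) , λ l∈ g∈ wg _ bg → cross-labelʷ G l∈ g∈ wg bg

  -- Every edge whose role changes contains `t`, hence misses `s`, since otherwise the path would
  -- close up or cross. So the free edges and labels at `s` survive, and the other end can be
  -- treated afterwards.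
  release : ∀ {w u t s ls F e} → Crossable w u t s → Gap w u ls F → Freeable t ls F e → ∃₂ λ ls′ F′ → Gap w u ls′ F′ ×
            Similar ls ls′ × e ∈ₗ F′ × ¬ s ∈ e × (∀ {g} → g ∈ₗ F → s ∈ g → g ∈ₗ F′) × (∀ {l} → l ∈ₗ ls → s ∈ˡ label l → l ∈ₗ ls′)
  release X G (now e∈ te) = _ , _ , G , Similar-refl _ , e∈ , proj₁ (X G) e∈ te , (λ g∈ _ → g∈) , λ l∈ _ → l∈
  release X G (once l∈ te f∈ tf af bf) with swap∈ G l∈ f∈ af bf
  ... | ls′ , F′ , G′ , sim , e∈ , keep , stay = ls′ , F′ , G′ , sim , e∈ , proj₁ (X G′) e∈ te ,
    (λ g∈ sg → keep g∈ λ { refl → proj₁ (X G) g∈ tf sg }) ,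
    λ {l} k∈ sl → stay k∈ λ eq → proj₂ (X G) l∈ f∈ tf af bf (subst (_ ∈ˡ_) eq sl)
  release X G (twice {e = e} {e′ = e′} l∈ te l′∈ te′ e≢e′ f∈ tf af bf ae be) with swap∈ G l′∈ f∈ af bf
  ... | ls₁ , F₁ , G₁ , sim₁ , e′∈ , keep₁ , stay₁ with stay₁ l∈ (λ { refl → e≢e′ refl })
  ... | l∈₁ with swap∈ G₁ l∈₁ e′∈ ae be
  ... | ls₂ , F₂ , G₂ , sim₂ , e∈ , keep₂ , stay₂ = ls₂ , F₂ , G₂ , Similar-trans sim₁ sim₂ , e∈ , proj₁ (X G₂) e∈ te ,
    (λ g∈ sg → keep₂ (keep₁ g∈ λ { refl → proj₁ (X G) g∈ tf sg }) λ { refl → proj₂ (X G) l′∈ f∈ tf af bf sg }) ,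
    λ {l} k∈ sl → stay₂ (stay₁ k∈ λ eq → proj₂ (X G) l′∈ f∈ tf af bf (subst (_ ∈ˡ_) eq sl))
                       λ eq → proj₂ (X G₁) l∈₁ e′∈ te′ ae be (subst (_ ∈ˡ_) eq sl)

  release₂ : ∀ {w u ls F e g} → Gap w u ls F → Freeable u ls F e → Freeable w ls F g → ∃₂ λ ls′ F′ → Gap w u ls′ F′ ×
             Similar ls ls′ × e ∈ₗ F′ × g ∈ₗ F′ × e ≢ g
  release₂ G φ ψ with release crossableᵘ G φ
  ... | ls₁ , F₁ , G₁ , sim₁ , e∈ , w∉e , keep₁ , stay₁
    with release crossableʷ G₁ (Freeable-map keep₁ (λ l∈ we → inj₁ (stay₁ l∈ we)) ψ)
  ... | ls₂ , F₂ , G₂ , sim₂ , g∈ , u∉g , keep₂ , stay₂ =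
    ls₂ , F₂ , G₂ , Similar-trans sim₁ sim₂ , keep₂ e∈ (Freeable-∋ φ) , g∈ , λ { refl → u∉g (Freeable-∋ φ) }

  Reach : Fin n → List (Link n) → List (Subset n) → Fin n → Set
  Reach t ls F v = v ≢ t × ∃ λ e → Freeable t ls F e × v ∈ e

  module _ {w u ls F} (G : Gap w u ls F) where
    no-cross : ∀ {a e b} → a ⟨ just e ⟩ b ∈ₗ ls → Reach u ls F a → ¬ Reach w ls F b
    no-cross l∈ (_ , f , φ , af) (_ , g , ψ , bg) with release₂ G φ ψ
    ... | ls′ , F′ , G′ , sim , f∈ , g∈ , f≢g with Similar-∈ sim l∈ | pick₂ f∈ g∈ f≢g
    ... | e′ , l∈′ | F″ , perm = ¬ham (cross∈ G′ l∈′ (↭-trans (prep e′ perm) (↭-trans (Perm.swap _ _ ↭-refl) (prep f (Perm.swap _ _ ↭-refl))))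
            af (Freeable-∋ φ) (Freeable-∋ ψ) bg)

    no-cross-label : ∀ {a e b} → a ⟨ just e ⟩ b ∈ₗ ls → Reach u ls F a → ¬ w ∈ e
    no-cross-label l∈ (_ , f , φ , af) we with release crossableᵘ G φ
    ... | ls′ , F′ , G′ , _ , f∈ , _ , _ , stay = cross-label G′ (stay l∈ we) f∈ (Freeable-∋ φ) af we

    no-cross-labelʷ : ∀ {a e b} → a ⟨ just e ⟩ b ∈ₗ ls → Reach w ls F b → ¬ u ∈ e
    no-cross-labelʷ l∈ (_ , g , ψ , bg) ue with release crossableʷ G ψ
    ... | ls′ , F′ , G′ , _ , g∈ , _ , _ , stay = cross-labelʷ G′ (stay l∈ ue) g∈ (Freeable-∋ ψ) bg ue

    bypass-last′ : ∀ l₁ {a e f} → ls ≡ l₁ ++ [ a ⟨ just e ⟩ u ] → f ∈ₗ F → u ∈ f → ¬ w ∈ e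
    bypass-last′ l₁ refl f∈ uf we = no-insertion (bypass-last l₁ G we) (_ , f∈ , uf)

  module _ {w u a e b e′ c F} l₁ {l₂} (G : Gap w u (l₁ ++ a ⟨ just e ⟩ b ∷ b ⟨ just e′ ⟩ c ∷ l₂) F) where
    private
      ls = l₁ ++ a ⟨ just e ⟩ b ∷ b ⟨ just e′ ⟩ c ∷ l₂
      k∈ : a ⟨ just e ⟩ b ∈ₗ ls
      k∈ = ∈-++⁺ʳ l₁ (here refl)
      k′∈ : b ⟨ just e′ ⟩ c ∈ₗ ls
      k′∈ = ∈-++⁺ʳ l₁ (there (here refl))

    -- The bypass leaves out `b`, while the label of the link into `b` becomes free and contains
    -- `b`. This is what `no-insertion` excludes.
    no-bypass : Reach u ls F a → ¬ Reach w ls F c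
    no-bypass (_ , f , φ , af) (_ , g , ψ , cg) with release₂ G φ ψ
    ... | ls′ , F′ , G′ , sim , f∈ , g∈ , f≢g with Similar-split l₁ sim | pick₂ f∈ g∈ f≢g
    ... | m₁ , _ , refl , _ , ordinary {e′ = d} (ordinary {e′ = d′} _) | F″ , perm = no-insertion
          (bypass m₁ G′ rearrange af (Freeable-∋ φ) (Freeable-∋ ψ) cg)
          (d , here refl , proj₂ (gap-joins G′ (∈-++⁺ʳ m₁ (here refl))))
      where
      open ↭Solver
      rearrange : d ∷ d′ ∷ F′ ↭ f ∷ g ∷ d ∷ d′ ∷ F″
      rearrange = ↭-trans (prep d (prep d′ perm))
        (solve 5 (λ d d′ f g F → d ⊕ (d′ ⊕ (f ⊕ (g ⊕ F))) ⊜ f ⊕ (g ⊕ (d ⊕ (d′ ⊕ F)))) ↭-refl [ d ] [ d′ ] [ f ] [ g ] F″)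

    -- The same bypass with the label of the second link, kept during the release because it
    -- contains `w`, joining `c` to `w`.
    no-bypass-label : Reach u ls F a → ¬ w ∈ e′
    no-bypass-label (_ , f , φ , af) we′ with release crossableᵘ G φ
    ... | ls′ , F′ , G′ , sim , f∈ , _ , _ , stay with Similar-split l₁ sim | pick f∈ | stay k′∈ we′
    ... | m₁ , _ , refl , _ , ordinary {e′ = d} (ordinary {e′ = d′} _) | F″ , perm | k″∈
      with unique-tail G′ k″∈ (∈-++⁺ʳ m₁ (there (here refl))) refl
    ... | refl = no-insertion (bypass m₁ G′ rearrange af (Freeable-∋ φ) we′ (proj₂ (gap-joins G k′∈)))
          (d , here refl , proj₂ (gap-joins G′ (∈-++⁺ʳ m₁ (here refl))))
      where
      open ↭Solver
      rearrange : d ∷ e′ ∷ F′ ↭ f ∷ e′ ∷ d ∷ F″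
      rearrange = ↭-trans (prep d (prep e′ perm))
        (solve 4 (λ d d′ f F → d ⊕ (d′ ⊕ (f ⊕ F)) ⊜ f ⊕ (d′ ⊕ (d ⊕ F))) ↭-refl [ d ] [ e′ ] [ f ] F″)

  no-loop : ∀ {w u ls F k l} → Gap w u ls F → k ∈ₗ ls → l ∈ₗ ls → tail k ≡ head l → head k ≢ tail l
  no-loop {w} {ls = ls} {k = k} {l} G k∈ l∈ eq eq′ with ∈-∃++ k∈
  ... | l₁ , l₂ , refl with split l₁ (proj₁ G)
  ... | _ , c₁ , (_ ∷ _) = go (∈-++⁻ l₁ l∈)
    where
    u₁ : Unique ((w ∷ heads l₁) ++ head k ∷ heads l₂)
    u₁ = subst (λ h → Unique (w ∷ h)) (heads-++ l₁ _) (path-unique G)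
    apart : ∀ {v} → v ∈ₗ w ∷ heads l₁ → ¬ v ∈ₗ head k ∷ heads l₂
    apart {v} p q with ∈-∃++ p
    ... | xs , ys , e = ∉-head (Unique-++ʳ xs (subst Unique (trans (cong (_++ head k ∷ heads l₂) e) (++-assoc xs _ _)) u₁)) (∈-++⁺ʳ ys q)
    before : ∀ {v} → v ∈ₗ tails l₁ → v ∈ₗ w ∷ heads l₁
    before {v} p = subst (v ∈ₗ_) (tails-chain c₁) (∈-++⁺ˡ p)
    go : l ∈ₗ l₁ ⊎ l ∈ₗ k ∷ l₂ → Empty
    go (inj₁ p) = apart (before (∈-map⁺ tail p)) (here (sym eq′))
    go (inj₂ (here refl)) = link≢ G l∈ eq
    go (inj₂ (there p)) = apart (subst (tail k ∈ₗ_) (tails-chain c₁) (∈-++⁺ʳ (tails l₁) (here refl))) (there (subst (_∈ₗ heads l₂) (sym eq) (∈-map⁺ head p)))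

  Reach-map : ∀ {t ls F ls′ F′ v} → (∀ {f} → f ∈ₗ F → t ∈ f → f ∈ₗ F′) →
    (∀ {a e b} → a ⟨ just e ⟩ b ∈ₗ ls → t ∈ e → a ⟨ just e ⟩ b ∈ₗ ls′ ⊎ b ⟨ just e ⟩ a ∈ₗ ls′) →
    Reach t ls F v → Reach t ls′ F′ v
  Reach-map φ ψ (v≢t , e , fr , ve) = v≢t , e , Freeable-map φ ψ fr , ve

  ordinary? : ∀ (l : Link n) → Dec (label l ≢ nothing)
  ordinary? (_ ⟨ just _ ⟩ _) = yes λ ()
  ordinary? (_ ⟨ nothing ⟩ _) = no λ h → h refl

  -- Both ends have free edges: the degree count

  module Predicates (u w : Fin n) (U W : Subset n) where
    -- Without a cycle these classes are disjoint and exhaust the ordinary links. Outside `A` and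
    -- `B`, a label contributes to the degree of one end (`Onᵘ`, `Onʷ`), of both (`D`) or of neither
    -- (`O`).
    A B Onᵘ Onʷ D O : Link n → Set
    A l = label l ≢ nothing × tail l ∈ U
    B l = label l ≢ nothing × head l ∈ W
    Onᵘ l = (u ∈ˡ label l × ¬ w ∈ˡ label l) × ¬ tail l ∈ U
    Onʷ l = (w ∈ˡ label l × ¬ u ∈ˡ label l) × ¬ head l ∈ W
    D l = u ∈ˡ label l × w ∈ˡ label l
    O l = (label l ≢ nothing × (¬ tail l ∈ U × ¬ head l ∈ W)) × (¬ u ∈ˡ label l × ¬ w ∈ˡ label l)

    A? : Decidable A
    A? l = ordinary? l ×-dec tail l ∈? U
    B? : Decidable B
    B? l = ordinary? l ×-dec head l ∈? W
    Onᵘ? : Decidable Onᵘ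
    Onᵘ? l = (on? u l ×-dec ¬? (on? w l)) ×-dec ¬? (tail l ∈? U)
    Onʷ? : Decidable Onʷ
    Onʷ? l = (on? w l ×-dec ¬? (on? u l)) ×-dec ¬? (head l ∈? W)
    D? : Decidable D
    D? l = on? u l ×-dec on? w l
    O? : Decidable O
    O? l = (ordinary? l ×-dec (¬? (tail l ∈? U) ×-dec ¬? (head l ∈? W))) ×-dec (¬? (on? u l) ×-dec ¬? (on? w l))

  record BothFree (w u : Fin n) (ls : List (Link n)) (F : List (Subset n)) (U W : Subset n) : Set where
    field
      gap   : Gap w u ls F
      freeᵘ : ∃ λ f → f ∈ₗ F × u ∈ f
      freeʷ : ∃ λ g → g ∈ₗ F × w ∈ g
      reachᵘ : ∀ v → (v ∈ U → Reach u ls F v) × (Reach u ls F v → v ∈ U)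
      reachʷ : ∀ v → (v ∈ W → Reach w ls F v) × (Reach w ls F v → v ∈ W)

  flipped : ∀ {w u ls F U W} → BothFree w u ls F U W → BothFree u w (rev ls) F W U
  flipped {w} {u} {ls} {F} S = record
    { gap = Gap-flip gap ; freeᵘ = freeʷ ; freeʷ = freeᵘ
    ; reachᵘ = λ v → there′ ∘ proj₁ (reachʷ v) , proj₂ (reachʷ v) ∘ back
    ; reachʷ = λ v → there′ ∘ proj₁ (reachᵘ v) , proj₂ (reachᵘ v) ∘ back }
    where
    open BothFree S
    there′ : ∀ {t v} → Reach t ls F v → Reach t (rev ls) F v
    there′ = Reach-map (λ f∈ _ → f∈) λ l∈ _ → inj₂ (∈-rev l∈)
    back : ∀ {t v} → Reach t (rev ls) F v → Reach t ls F v
    back = Reach-map (λ f∈ _ → f∈) λ l∈ _ → inj₂ (∈-rev⁻ ls l∈)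

  module OneEnd {w u ls F U W} (S : BothFree w u ls F U W) where
    open BothFree S public
    open Predicates u w U W public
    uses : Uses ls F
    uses = proj₂ (proj₂ gap)

    not-special : ∀ {v : Fin n} ℓ → v ∈ˡ ℓ → ℓ ≢ nothing
    not-special (just _) _ ()

    crossing : ∀ {l} → l ∈ₗ ls → label l ≢ nothing → tail l ∈ U → ¬ head l ∈ W
    crossing {_ ⟨ nothing ⟩ _} l∈ ord = absurd (ord refl)
    crossing {a ⟨ just e ⟩ b} l∈ _ aU bW = no-cross gap l∈ (proj₁ (reachᵘ a) aU) (proj₁ (reachʷ b) bW)

    crossing-label : ∀ {l} → l ∈ₗ ls → tail l ∈ U → ¬ w ∈ˡ label l
    crossing-label {a ⟨ just e ⟩ b} l∈ aU we = no-cross-label gap l∈ (proj₁ (reachᵘ a) aU) we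

    crossing-labelʷ : ∀ {l} → l ∈ₗ ls → head l ∈ W → ¬ u ∈ˡ label l
    crossing-labelʷ {a ⟨ just e ⟩ b} l∈ bW ue = no-cross-labelʷ gap l∈ (proj₁ (reachʷ b) bW) ue

    p q : Fin n
    p = proj₁ (gap-special {ls} {F} uses)
    q = proj₁ (proj₂ (gap-special {ls} {F} uses))
    s∈ : p ⟨ nothing ⟩ q ∈ₗ ls
    s∈ = proj₂ (proj₂ (gap-special {ls} {F} uses))

    unique-special : ∀ {a b} → a ⟨ nothing ⟩ b ∈ₗ ls → a ⟨ nothing ⟩ b ≡ p ⟨ nothing ⟩ q
    unique-special {a} {b} k∈ = go (gap-labels-unique {ls} {F} uses) k∈ s∈
      where
      go : ∀ {ks} → Unique (labels ks) → a ⟨ nothing ⟩ b ∈ₗ ks → p ⟨ nothing ⟩ q ∈ₗ ks → a ⟨ nothing ⟩ b ≡ p ⟨ nothing ⟩ q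
      go _ (here refl) (here refl) = refl
      go un (here refl) (there k) = absurd (∉-head un (∈-map⁺ label k))
      go un (there k) (here refl) = absurd (∉-head un (∈-map⁺ label k))
      go (_ ∷ un) (there k) (there l) = go un k l

    -- Every vertex but `u` is the tail of a link, so a vertex reached from `u` is the tail of a
    -- link in `A` or of the special link. The vertex `p` is listed in any case, which gives |L| =
    -- |A| + 1 exactly.
    As L : List _
    As = filter A? ls
    L = p ∷ tails As

    As⊆ : ∀ {v} → v ∈ₗ tails As → v ∈ₗ tails ls
    As⊆ v∈ with ∈-map⁻ tail v∈
    ... | l , l∈ , refl = ∈-map⁺ tail (proj₁ (∈-filter⁻ A? {xs = ls} l∈))

    p∉As : p ∉ₗ tails As
    p∉As p∈ with ∈-map⁻ tail p∈
    ... | l , l∈ , eq with ∈-filter⁻ A? {xs = ls} l∈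
    ... | l∈ls , ord , _ = ord (cong label (sym (unique-tail gap s∈ l∈ls eq)))

    L-unique : Unique (u ∷ L)
    L-unique = Unique-∷ (λ { (here eq) → u∉tails gap (subst (_∈ₗ tails ls) (sym eq) (∈-map⁺ tail s∈)) ; (there r) → u∉tails gap (As⊆ r) })
      (Unique-∷ p∉As (AllPairs.map⁺ (AllPairs.filter⁺ A? (AllPairs.map⁻ (tails-unique gap)))))

    U⊆L : ∀ {v} → v ∈ U → v ∈ₗ L
    U⊆L {v} vU with ∈-tail-link (∈-tails gap (proj₁ (proj₁ (reachᵘ v) vU)))
    ... | nothing , b , l∈ = here (cong tail (unique-special l∈))
    ... | just e , b , l∈ = there (∈-map⁺ tail (∈-filter⁺ A? l∈ ((λ ()) , vU)))

    freeable⊆ : ∀ {e} → Freeable u ls F e → ∀ {v} → v ∈ e → v ∈ₗ u ∷ L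
    freeable⊆ {e} φ {v} ve with v F.≟ u
    ... | yes eq = here eq
    ... | no v≢u = there (U⊆L (proj₂ (reachᵘ v) (v≢u , e , φ , ve)))

    InL? : ∀ v → Dec (v ∈ₗ u ∷ L)
    InL? v = Any.any? (v F.≟_) (u ∷ L)

    -- Labels at `u` on links of `A` are counted together with the free edges as long as the link
    -- stays inside u ∪ L. The others are the exits, bounded separately through the links that
    -- follow them.
    Inner? : ∀ l → Dec (A l × (u ∈ˡ label l × head l ∈ₗ u ∷ L))
    Inner? l = A? l ×-dec (on? u l ×-dec InL? (head l))
    Exit? : ∀ l → Dec (A l × (u ∈ˡ label l × ¬ head l ∈ₗ u ∷ L))
    Exit? l = A? l ×-dec (on? u l ×-dec ¬? (InL? (head l)))

    𝓕 = filter (u ∈?_) F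
    Ks = filter Inner? ls
    exits : ℕ
    exits = count Exit? ls

    Ks⊆ : ∀ {k} → k ∈ₗ Ks → k ∈ₗ ls × (A k × (u ∈ˡ label k × head k ∈ₗ u ∷ L))
    Ks⊆ = ∈-filter⁻ Inner? {xs = ls}

    length-L : length L ≡ suc (count A? ls)
    length-L = cong suc (length-map tail As)

    -- The assumptions `S₁` and `S₂` of `Relabelling` say that freeable edges lead to reached
    -- vertices only; they are the origin of `once` and `twice`.
    inner-bound : length 𝓕 + length Ks ≤ length L C ρ
    inner-bound = subst (λ k → length 𝓕 + length Ks ≤ length L C k) ρ≡ (Relabelling.bound {ρ = ρ ∸ 2}
      L-unique (Unique.filter⁺ (u ∈?_) (gap-free-unique {ls} {F} uses))
      (AllPairs.map⁺ (AllPairs.filter⁺ Inner? (AllPairs.map⁻ (gap-labels-unique {ls} {F} uses))))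
      (λ f∈ → let f∈F , uf = ∈-filter⁻ (u ∈?_) {xs = F} f∈ in
         size (gap-free {ls} {F} uses f∈F) , uf , freeable⊆ (now f∈F uf))
      (λ { {_ ⟨ nothing ⟩ _} k∈ → absurd (proj₁ (proj₁ (proj₂ (Ks⊆ k∈))) refl)
         ; {a ⟨ just e ⟩ b} k∈ → let k∈ls , (ord , aU) , ue , b∈ = Ks⊆ k∈ in
           (e , refl , size (gap-label {ls} {F} uses k∈ls) , ue ,
             (λ e∈ → gap-free-used {ls} {F} uses k∈ls (proj₁ (∈-filter⁻ (u ∈?_) {xs = F} e∈))) , gap-joins gap k∈ls) ,
           U⊆L aU , b∈ , link≢ gap k∈ls })
      (λ k∈ l∈ → unique-tail gap (proj₁ (Ks⊆ k∈)) (proj₁ (Ks⊆ l∈)))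
      (λ k∈ l∈ → no-loop gap (proj₁ (Ks⊆ k∈)) (proj₁ (Ks⊆ l∈)))
      (subst (length Ks <_) (sym length-L) (s≤s (count-mono Inner? A? ls λ _ → proj₁)))
      (λ k∈ f∈ af bf → let f∈F , uf = ∈-filter⁻ (u ∈?_) {xs = F} f∈ ; k∈ls , _ , ue , _ = Ks⊆ k∈ in
         freeable⊆ (once k∈ls ue f∈F uf af bf))
      S₂
      (let f , f∈ , uf = freeᵘ in f , ∈-filter⁺ (u ∈?_) f∈ uf))
      where
      ρ≡ : 2 + (ρ ∸ 2) ≡ ρ
      ρ≡ = m+[n∸m]≡n 2≤ρ
      size : ∀ {e} → e ∈ₗ E → ∣ e ∣ ≡ 3 + (ρ ∸ 2)
      size e∈ = trans (unif e∈) (cong suc (sym ρ≡))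
      S₂ : ∀ {a e b a′ e′ b′ f} → a ⟨ just e ⟩ b ∈ₗ Ks → a′ ⟨ just e′ ⟩ b′ ∈ₗ Ks → f ∈ₗ 𝓕 → a′ ∈ f → b′ ∈ f →
           a ∈ e′ → b ∈ e′ → ∀ {v} → v ∈ e → v ∈ₗ u ∷ L
      -- The constructor `twice` asks for two different labels; for equal ones a single replacement
      -- does the same.
      S₂ {e = e} {e′ = e′} k∈ k′∈ f∈ af bf ae be with e ≟ˢ e′ | Ks⊆ k∈ | Ks⊆ k′∈ | ∈-filter⁻ (u ∈?_) {xs = F} f∈
      ... | yes refl | _ | k′∈ls , _ , ue′ , _ | f∈F , uf = freeable⊆ (once k′∈ls ue′ f∈F uf af bf)
      ... | no ne | k∈ls , _ , ue , _ | k′∈ls , _ , ue′ , _ | f∈F , uf = freeable⊆ (twice k∈ls ue k′∈ls ue′ ne f∈F uf af bf ae be)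

    degree-bound : δ ≤ length L C ρ + (exits + (count Onᵘ? ls + count D? ls))
    degree-bound = begin
      δ                                ≤⟨ deg u ⟩
      count (u ∈?_) E                  ≡⟨ sym (gap-degree {ls} {F} uses u) ⟩
      count (on? u) ls + length 𝓕      ≤⟨ +-monoˡ-≤ (length 𝓕) on-split ⟩
      (length Ks + (exits + (count Onᵘ? ls + count D? ls))) + length 𝓕 ≡⟨ lem (length Ks) _ (length 𝓕) ⟩
      (length 𝓕 + length Ks) + (exits + (count Onᵘ? ls + count D? ls)) ≤⟨ +-monoˡ-≤ _ inner-bound ⟩
      length L C ρ + (exits + (count Onᵘ? ls + count D? ls)) ∎
      where
      open ≤-Reasoning
      lem : ∀ k r f → (k + r) + f ≡ (f + k) + r
      lem = solve-∀
      R₁? : ∀ l → Dec (Onᵘ l ⊎ D l)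
      R₁? l = Onᵘ? l ⊎-dec D? l
      R₂? : ∀ l → Dec ((A l × (u ∈ˡ label l × ¬ head l ∈ₗ u ∷ L)) ⊎ (Onᵘ l ⊎ D l))
      R₂? l = Exit? l ⊎-dec R₁? l
      where-on : ∀ {l} → l ∈ₗ ls → u ∈ˡ label l → (A l × (u ∈ˡ label l × head l ∈ₗ u ∷ L)) ⊎ ((A l × (u ∈ˡ label l × ¬ head l ∈ₗ u ∷ L)) ⊎ (Onᵘ l ⊎ D l))
      where-on {l} l∈ ul with on? w l | tail l ∈? U | InL? (head l)
      ... | yes wl | _ | _ = inj₂ (inj₂ (inj₂ (ul , wl)))
      ... | no ¬wl | no ¬U | _ = inj₂ (inj₂ (inj₁ ((ul , ¬wl) , ¬U)))
      ... | no ¬wl | yes tU | yes h∈ = inj₁ ((not-special (label l) ul , tU) , ul , h∈)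
      ... | no ¬wl | yes tU | no h∉ = inj₂ (inj₁ ((not-special (label l) ul , tU) , ul , h∉))
      on-split : count (on? u) ls ≤ length Ks + (exits + (count Onᵘ? ls + count D? ls))
      on-split = ≤-trans (count-⊎-≤ Inner? R₂? (on? u) ls where-on) (+-monoʳ-≤ (length Ks)
        (≤-trans (count-⊎-≤ Exit? R₁? R₂? ls λ _ r → r) (+-monoʳ-≤ exits (count-⊎-≤ Onᵘ? D? R₁? ls λ _ r → r))))

    exits<L : exits < length L
    exits<L = subst (exits <_) (sym length-L) (s≤s (count-mono Exit? A? ls λ _ → proj₁))

    ρ≤L : ρ ≤ length L
    ρ≤L = let f , f∈ , uf = freeᵘ in s≤s⁻¹ (subst (_≤ suc (length L)) (unif (gap-free {ls} {F} uses f∈)) (size-≤ f {u ∷ L} (freeable⊆ (now f∈ uf))))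

    -- The head of an exit is neither `u` nor `p`, so an ordinary link follows. Its tail is not
    -- reached from `u`, and bypassing that tail keeps `w` out of its label and its head out of `W`.
    after-exit : ∀ l₁ {k l₂} → ls ≡ l₁ ++ k ∷ l₂ → A k × (u ∈ˡ label k × ¬ head k ∈ₗ u ∷ L) → ∃₂ λ k′ l₃ → l₂ ≡ k′ ∷ l₃ × (Onᵘ k′ ⊎ O k′)
    after-exit l₁ {_ ⟨ nothing ⟩ _} eq ((ord , _) , _) = absurd (ord refl)
    after-exit l₁ {a ⟨ just e ⟩ b} {l₂} eq ((_ , aU) , ue , b∉) with split-at l₁ (subst (λ ks → Chain w ks u) eq (proj₁ gap))
    after-exit l₁ {a ⟨ just e ⟩ b} {[]} eq ((_ , aU) , ue , b∉) | _ , _ , [] = absurd (b∉ (here refl))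
    after-exit l₁ {a ⟨ just e ⟩ b} {_ ⟨ nothing ⟩ c ∷ l₃} eq ((_ , aU) , ue , b∉) | _ , _ , _ ∷ _ =
      absurd (b∉ (there (here (cong tail (unique-special (subst (b ⟨ nothing ⟩ c ∈ₗ_) (sym eq) (∈-++⁺ʳ l₁ (there (here refl)))))))))
    after-exit l₁ {a ⟨ just e ⟩ b} {_ ⟨ just e′ ⟩ c ∷ l₃} eq ((_ , aU) , ue , b∉) | _ , _ , _ ∷ _ =
      _ , l₃ , refl , decide (u ∈? e′)
      where
      k′∈ : b ⟨ just e′ ⟩ c ∈ₗ ls
      k′∈ = subst (b ⟨ just e′ ⟩ c ∈ₗ_) (sym eq) (∈-++⁺ʳ l₁ (there (here refl)))
      G′ : Gap w u (l₁ ++ a ⟨ just e ⟩ b ∷ b ⟨ just e′ ⟩ c ∷ l₃) F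
      G′ = subst (λ ks → Gap w u ks F) eq gap
      reach-a : Reach u (l₁ ++ a ⟨ just e ⟩ b ∷ b ⟨ just e′ ⟩ c ∷ l₃) F a
      reach-a = subst (λ ks → Reach u ks F a) eq (proj₁ (reachᵘ a) aU)
      b∉U : ¬ b ∈ U
      b∉U = b∉ ∘ there ∘ U⊆L
      w∉e′ : ¬ w ∈ e′
      w∉e′ = no-bypass-label l₁ G′ reach-a
      c∉W : ¬ c ∈ W
      c∉W cW = no-bypass l₁ G′ reach-a (subst (λ ks → Reach w ks F c) eq (proj₁ (reachʷ c) cW))
      decide : Dec (u ∈ e′) → Onᵘ (b ⟨ just e′ ⟩ c) ⊎ O (b ⟨ just e′ ⟩ c)
      decide (yes ue′) = inj₁ ((ue′ , w∉e′) , b∉U)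
      decide (no ¬ue′) = inj₂ (((λ ()) , b∉U , c∉W) , ¬ue′ , w∉e′)

    exits≤ : exits ≤ count Onᵘ? ls + count O? ls
    exits≤ = ≤-trans (count-next Exit? Q? ls after-exit) (count-⊎-≤ Onᵘ? O? Q? ls λ _ r → r)
      where
      Q? : ∀ l → Dec (Onᵘ l ⊎ O l)
      Q? l = Onᵘ? l ⊎-dec O? l

  -- One end, with a = |L|, α = |Onᵘ| and `s` exits; `b` is the total for the other end. If a = m -
  -- e, at most 2e + 1 labels can make up for the sets lost, which is too few for e ≥ 2. For e = 1
  -- only a = ρ = 2 survives, where D = 0 forces α ≥ 2 although a + α ≤ m.
  side-arith : ∀ {a α b s D o} → a + α ≤ b → (a + α) + b + (D + o) ≤ n → δ ≤ a C ρ + (s + (α + D)) → s ≤ α + o → s < a →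
    ρ ≤ a → (ρ ≡ 2 → D ≡ 0) → a ≡ m × α ≡ 0 × b ≡ m × D + o ≡ 1
  side-arith {a} {α} {b} {s} {D} {o} a≤b sum≤ δ≤ s≤ s<a ρ≤a D0 =
    cases (proj₁ rest) (proj₂ rest)
    where
    open ≤-Reasoning
    a+α≤m : a + α ≤ m
    a+α≤m with a + α ≤? m
    ... | yes h = h
    ... | no h = contradiction (begin
          2 * suc m                       ≤⟨ *-monoʳ-≤ 2 (≰⇒> h) ⟩
          2 * (a + α)                     ≡⟨ cong (a + α +_) (+-identityʳ _) ⟩
          (a + α) + (a + α)               ≤⟨ +-monoʳ-≤ (a + α) a≤b ⟩
          (a + α) + b                     ≤⟨ ≤-trans (m≤m+n _ (D + o)) (≤-trans sum≤ n≤) ⟩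
          suc (2 * m) ∎) (<⇒≱ (≤-reflexive (sym (*-suc 2 m))))
    rest : ∃ λ e → a + e ≡ m
    rest = m≤n⇒∃[o]m+o≡n (≤-trans (m≤m+n a α) a+α≤m)
    low : ∀ {x} → a C ρ + x ≤ m C ρ → x < s + (α + D)
    low {x} h = +-cancelˡ-≤ (a C ρ) _ _ (begin
      a C ρ + suc x       ≡⟨ +-suc (a C ρ) x ⟩
      suc (a C ρ + x)     ≤⟨ s≤s h ⟩
      suc (m C ρ)         ≤⟨ C<δ ⟩
      δ                   ≤⟨ δ≤ ⟩
      a C ρ + (s + (α + D)) ∎)
    high : ∀ {e} → a + e ≡ m → s + (α + D) ≤ suc (2 * e)
    high {e} eq = +-cancelʳ-≤ (2 * a) _ _ (begin
      (s + (α + D)) + 2 * a            ≤⟨ +-monoˡ-≤ (2 * a) (+-monoˡ-≤ (α + D) s≤) ⟩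
      ((α + o) + (α + D)) + 2 * a      ≡⟨ l₁ α o D a ⟩
      (a + α) + (a + α) + (D + o)      ≤⟨ +-monoˡ-≤ (D + o) (+-monoʳ-≤ (a + α) a≤b) ⟩
      (a + α) + b + (D + o)            ≤⟨ ≤-trans sum≤ n≤ ⟩
      suc (2 * m)                      ≡⟨ cong (suc ∘ (2 *_)) (sym eq) ⟩
      suc (2 * (a + e))                ≡⟨ l₂ a e ⟩
      suc (2 * e) + 2 * a ∎)
      where
      l₁ : ∀ α o D a → ((α + o) + (α + D)) + 2 * a ≡ (a + α) + (a + α) + (D + o)
      l₁ = solve-∀
      l₂ : ∀ a e → suc (2 * (a + e)) ≡ suc (2 * e) + 2 * a
      l₂ = solve-∀
    2≤a : 2 ≤ a
    2≤a = ≤-trans 2≤ρ ρ≤a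
    step : a C ρ + a ≤ suc a C ρ
    step = C-step a ρ 2≤ρ ρ≤a
    cases : ∀ e → a + e ≡ m → a ≡ m × α ≡ 0 × b ≡ m × D + o ≡ 1
    cases zero eq = a≡m , α≡0 , b≡m , T≡1
      where
      a≡m : a ≡ m
      a≡m = trans (sym (+-identityʳ a)) eq
      α≡0 : α ≡ 0
      α≡0 = n≤0⇒n≡0 (+-cancelˡ-≤ a _ _ (≤-trans a+α≤m (≤-reflexive (sym eq))))
      m≤b : m ≤ b
      m≤b = ≤-trans (≤-reflexive (sym a≡m)) (≤-trans (m≤m+n a α) a≤b)
      1≤T : 1 ≤ D + o
      1≤T = begin
        1             ≤⟨ low {0} (≤-reflexive (trans (+-identityʳ _) (cong (_C ρ) a≡m))) ⟩
        s + (α + D)   ≤⟨ +-monoˡ-≤ (α + D) s≤ ⟩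
        (α + o) + (α + D) ≡⟨ cong (λ k → (k + o) + (k + D)) α≡0 ⟩
        o + D         ≡⟨ +-comm o D ⟩
        D + o ∎
      b+T≤ : b + (D + o) ≤ m + 1
      b+T≤ = +-cancelˡ-≤ m _ _ (begin
        m + (b + (D + o))       ≡⟨ cong (_+ (b + (D + o))) (sym a≡m) ⟩
        a + (b + (D + o))       ≤⟨ +-monoˡ-≤ (b + (D + o)) (m≤m+n a α) ⟩
        (a + α) + (b + (D + o)) ≡⟨ sym (+-assoc (a + α) b (D + o)) ⟩
        (a + α) + b + (D + o)   ≤⟨ ≤-trans sum≤ n≤ ⟩
        suc (2 * m)             ≡⟨ l m ⟩
        m + (m + 1) ∎)
        where
        l : ∀ m → suc (2 * m) ≡ m + (m + 1)
        l = solve-∀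
      b≡m : b ≡ m
      b≡m = ≤-antisym (+-cancelʳ-≤ 1 _ _ (≤-trans (+-monoʳ-≤ b 1≤T) b+T≤)) m≤b
      T≡1 : D + o ≡ 1
      T≡1 = ≤-antisym (+-cancelˡ-≤ m _ _ (≤-trans (+-monoˡ-≤ (D + o) m≤b) b+T≤)) 1≤T
    cases (suc zero) eq = contradiction (≤-trans a<3 (≤-reflexive refl)) λ _ → <⇒≱ 2≤α (s≤s⁻¹ (+-cancelˡ-≤ a _ _ (begin
        a + suc α     ≡⟨ +-suc a α ⟩
        suc (a + α)   ≤⟨ s≤s a+α≤m ⟩
        suc m         ≡⟨ trans (cong suc (sym eq)) (sym (+-suc a 1)) ⟩
        a + 2 ∎)))
      where
      grow : a C ρ + a ≤ m C ρ
      grow = ≤-trans step (≤-reflexive (cong (_C ρ) (trans (+-comm 1 a) eq)))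
      a<3 : a < 3
      a<3 = ≤-trans (low grow) (high eq)
      ρ≡2 : ρ ≡ 2
      ρ≡2 = ≤-antisym (≤-trans ρ≤a (s≤s⁻¹ a<3)) 2≤ρ
      2≤α : 1 < α
      2≤α = +-cancelˡ-≤ 1 _ _ (begin
        3                  ≤⟨ s≤s 2≤a ⟩
        suc a              ≤⟨ low grow ⟩
        s + (α + D)        ≡⟨ cong (s +_) (trans (cong (α +_) (D0 ρ≡2)) (+-identityʳ α)) ⟩
        s + α              ≤⟨ +-monoˡ-≤ α (s≤s⁻¹ (≤-trans s<a (s≤s⁻¹ a<3))) ⟩
        1 + α ∎)
    cases (suc (suc e)) eq = contradiction 2≤a (<⇒≱ a<2)
      where
      grow : a C ρ + (a + (suc a + 2 * e)) ≤ m C ρ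
      grow = begin
        a C ρ + (a + (suc a + 2 * e))  ≡⟨ l (a C ρ) a e ⟩
        a C ρ + a + suc a + 2 * e      ≤⟨ +-monoˡ-≤ (2 * e) (+-monoˡ-≤ (suc a) step) ⟩
        suc a C ρ + suc a + 2 * e      ≤⟨ +-monoˡ-≤ (2 * e) (C-step (suc a) ρ 2≤ρ (m≤n⇒m≤1+n ρ≤a)) ⟩
        suc (suc a) C ρ + 2 * e        ≤⟨ C-growth (suc (suc a)) e ρ 2≤ρ (m≤n⇒m≤1+n (m≤n⇒m≤1+n ρ≤a)) ⟩
        (suc (suc a) + e) C ρ          ≡⟨ cong (_C ρ) (trans (l′ a e) eq) ⟩
        m C ρ ∎
        where
        l : ∀ c a e → c + (a + (suc a + 2 * e)) ≡ c + a + suc a + 2 * e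
        l = solve-∀
        l′ : ∀ a e → suc (suc a) + e ≡ a + suc (suc e)
        l′ = solve-∀
      a+a<4 : a + a < 4
      a+a<4 = +-cancelʳ-≤ (suc (2 * e)) _ _ (begin
        suc (a + a) + suc (2 * e)          ≡⟨ l a e ⟩
        suc (a + (suc a + 2 * e))          ≤⟨ low grow ⟩
        s + (α + D)                        ≤⟨ high eq ⟩
        suc (2 * suc (suc e))              ≡⟨ l′ e ⟩
        4 + suc (2 * e) ∎)
        where
        l : ∀ a e → suc (a + a) + suc (2 * e) ≡ suc (a + (suc a + 2 * e))
        l = solve-∀
        l′ : ∀ e → suc (2 * suc (suc e)) ≡ 4 + suc (2 * e)
        l′ = solve-∀
      a<2 : a < 2
      a<2 with a <? 2
      ... | yes h = h
      ... | no h = contradiction (+-mono-≤ (≮⇒≥ h) (≮⇒≥ h)) (<⇒≱ a+a<4)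

  -- The end with the smaller total comes first. For it `side-arith` gives m on both sides, so the
  -- other end has no larger total and can be treated in the same way.
  balance-arith : ∀ {a b α β d o s s′} → (a + α) + (b + β) + (d + o) ≤ n → (ρ ≡ 2 → d ≡ 0) →
    δ ≤ a C ρ + (s + (α + d)) → s ≤ α + o → s < a → ρ ≤ a →
    δ ≤ b C ρ + (s′ + (β + d)) → s′ ≤ β + o → s′ < b → ρ ≤ b →
    (a ≡ m × α ≡ 0) × (b ≡ m × β ≡ 0) × d + o ≡ 1 × 1 ≤ s + d × ρ < m
  balance-arith {a} {b} {α} {β} {d} {o} {s} {s′} sum≤ d0 δ≤ s≤ s<a ρ≤a δ≤′ s≤′ s<b ρ≤b = finish (≤-total (a + α) (b + β))
    where
    open ≤-Reasoning
    sum≤′ : (b + β) + (a + α) + (d + o) ≤ n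
    sum≤′ = ≤-trans (≤-reflexive (cong (_+ (d + o)) (+-comm (b + β) (a + α)))) sum≤
    rest : a ≡ m → α ≡ 0 → d + o ≡ 1 → 1 ≤ s + d × ρ < m
    -- In the tight case the degree bound is C(m, ρ) + 1, so `slack` leaves only ρ < m.
    rest refl refl t = some , [ id , (λ h → contradiction (≤-trans h upper) (<⇒≱ ≤-refl)) ]′ slack
      where
      some : 1 ≤ s + d
      some = +-cancelˡ-≤ (m C ρ) _ _ (≤-trans (≤-reflexive (+-comm (m C ρ) 1)) (≤-trans C<δ δ≤))
      upper : δ ≤ suc (m C ρ)
      upper = begin
        δ                  ≤⟨ δ≤ ⟩
        m C ρ + (s + d)    ≤⟨ +-monoʳ-≤ (m C ρ) (+-monoˡ-≤ d s≤) ⟩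
        m C ρ + (o + d)    ≡⟨ cong (m C ρ +_) (trans (+-comm o d) t) ⟩
        m C ρ + 1          ≡⟨ +-comm (m C ρ) 1 ⟩
        suc (m C ρ) ∎
    both : a ≡ m × α ≡ 0 × b + β ≡ m × d + o ≡ 1 → b ≡ m × β ≡ 0 × a + α ≡ m × d + o ≡ 1 →
           (a ≡ m × α ≡ 0) × (b ≡ m × β ≡ 0) × d + o ≡ 1 × 1 ≤ s + d × ρ < m
    both (a≡ , α≡ , _ , t) (b≡ , β≡ , _) = (a≡ , α≡) , (b≡ , β≡) , t , rest a≡ α≡ t
    firstˢ : a + α ≤ b + β → a ≡ m × α ≡ 0 × b + β ≡ m × d + o ≡ 1
    firstˢ h = side-arith h sum≤ δ≤ s≤ s<a ρ≤a d0
    secondˢ : b + β ≤ a + α → b ≡ m × β ≡ 0 × a + α ≡ m × d + o ≡ 1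
    secondˢ h = side-arith h sum≤′ δ≤′ s≤′ s<b ρ≤b d0
    finish : a + α ≤ b + β ⊎ b + β ≤ a + α → (a ≡ m × α ≡ 0) × (b ≡ m × β ≡ 0) × d + o ≡ 1 × 1 ≤ s + d × ρ < m
    finish (inj₁ h) = let one@(a≡ , α≡ , b≡ , _) = firstˢ h in
      both one (secondˢ (≤-reflexive (trans b≡ (sym (trans (cong₂ _+_ a≡ α≡) (+-identityʳ m))))))
    finish (inj₂ h) = let two@(b≡ , β≡ , a≡ , _) = secondˢ h in
      both (firstˢ (≤-reflexive (trans a≡ (sym (trans (cong₂ _+_ b≡ β≡) (+-identityʳ m)))))) two

  module Split {w u ls F U W} (S : BothFree w u ls F U W) where
    open OneEnd S public
    module Opposite = OneEnd (flipped S)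

    count-flip : ∀ {P Q : Link n → Set} (P? : Decidable P) (Q? : Decidable Q) → (∀ {l} → P (flip l) → Q l) → (∀ {l} → Q l → P (flip l)) →
                 count P? (rev ls) ≡ count Q? ls
    count-flip P? Q? f g = trans (count-rev P? ls)
      (≤-antisym (count-mono (P? ∘ flip) Q? ls λ _ → f) (count-mono Q? (P? ∘ flip) ls λ _ → g))

    opp-A : count Opposite.A? (rev ls) ≡ count B? ls
    opp-A = count-flip Opposite.A? B? id id
    opp-Onᵘ : count Opposite.Onᵘ? (rev ls) ≡ count Onʷ? ls
    opp-Onᵘ = count-flip Opposite.Onᵘ? Onʷ? id id
    opp-D : count Opposite.D? (rev ls) ≡ count D? ls
    opp-D = count-flip Opposite.D? D? (λ (a , b) → b , a) (λ (a , b) → b , a)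
    opp-O : count Opposite.O? (rev ls) ≡ count O? ls
    opp-O = count-flip Opposite.O? O? (λ ((a , b , c) , d , e) → (a , c , b) , e , d) (λ ((a , b , c) , d , e) → (a , c , b) , e , d)

    private
      c₁? : ∀ l → Dec (A l ⊎ B l)
      c₁? l = A? l ⊎-dec B? l
      c₂? : ∀ l → Dec ((A l ⊎ B l) ⊎ Onᵘ l)
      c₂? l = c₁? l ⊎-dec Onᵘ? l
      c₃? : ∀ l → Dec (((A l ⊎ B l) ⊎ Onᵘ l) ⊎ Onʷ l)
      c₃? l = c₂? l ⊎-dec Onʷ? l
      c₄? : ∀ l → Dec ((((A l ⊎ B l) ⊎ Onᵘ l) ⊎ Onʷ l) ⊎ D l)
      c₄? l = c₃? l ⊎-dec D? l
      c₅? : ∀ l → Dec (((((A l ⊎ B l) ⊎ Onᵘ l) ⊎ Onʷ l) ⊎ D l) ⊎ O l)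
      c₅? l = c₄? l ⊎-dec O? l

    -- The final `1` stands for the special link.
    count-classes : count A? ls + count B? ls + count Onᵘ? ls + count Onʷ? ls + count D? ls + count O? ls + 1 ≤ length ls
    count-classes = begin
      count A? ls + count B? ls + count Onᵘ? ls + count Onʷ? ls + count D? ls + count O? ls + 1
        ≤⟨ +-mono-≤ (+-monoˡ-≤ (count O? ls) (+-monoˡ-≤ (count D? ls) (+-monoˡ-≤ (count Onʷ? ls) (+-monoˡ-≤ (count Onᵘ? ls) s₁)))) sp ⟩
      count c₁? ls + count Onᵘ? ls + count Onʷ? ls + count D? ls + count O? ls + count (¬? ∘ ordinary?) ls
        ≤⟨ +-monoˡ-≤ _ (+-monoˡ-≤ (count O? ls) (+-monoˡ-≤ (count D? ls) (+-monoˡ-≤ (count Onʷ? ls) s₂))) ⟩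
      count c₂? ls + count Onʷ? ls + count D? ls + count O? ls + count (¬? ∘ ordinary?) ls
        ≤⟨ +-monoˡ-≤ _ (+-monoˡ-≤ (count O? ls) (+-monoˡ-≤ (count D? ls) s₃)) ⟩
      count c₃? ls + count D? ls + count O? ls + count (¬? ∘ ordinary?) ls ≤⟨ +-monoˡ-≤ _ (+-monoˡ-≤ (count O? ls) s₄) ⟩
      count c₄? ls + count O? ls + count (¬? ∘ ordinary?) ls ≤⟨ +-monoˡ-≤ _ s₅ ⟩
      count c₅? ls + count (¬? ∘ ordinary?) ls ≤⟨ count-disjoint c₅? (¬? ∘ ordinary?) ls ord ⟩
      length ls ∎
      where
      open ≤-Reasoning
      sp : 1 ≤ count (¬? ∘ ordinary?) ls
      sp = count-pos (¬? ∘ ordinary?) s∈ λ h → h refl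
      s₁ : count A? ls + count B? ls ≤ count c₁? ls
      s₁ = count-⊎-≥ A? B? c₁? ls (λ _ → inj₁) (λ _ → inj₂) λ l∈ (o , tU) (_ , hW) → crossing l∈ o tU hW
      s₂ : count c₁? ls + count Onᵘ? ls ≤ count c₂? ls
      s₂ = count-⊎-≥ c₁? Onᵘ? c₂? ls (λ _ → inj₁) (λ _ → inj₂) λ
        { l∈ (inj₁ (_ , tU)) (_ , ¬tU) → ¬tU tU ; l∈ (inj₂ (_ , hW)) ((ul , _) , _) → crossing-labelʷ l∈ hW ul }
      s₃ : count c₂? ls + count Onʷ? ls ≤ count c₃? ls
      s₃ = count-⊎-≥ c₂? Onʷ? c₃? ls (λ _ → inj₁) (λ _ → inj₂) λ
        { l∈ (inj₁ (inj₁ (_ , tU))) ((wl , _) , _) → crossing-label l∈ tU wl ; l∈ (inj₁ (inj₂ (_ , hW))) (_ , ¬hW) → ¬hW hW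
        ; l∈ (inj₂ ((_ , ¬wl) , _)) ((wl , _) , _) → ¬wl wl }
      s₄ : count c₃? ls + count D? ls ≤ count c₄? ls
      s₄ = count-⊎-≥ c₃? D? c₄? ls (λ _ → inj₁) (λ _ → inj₂) λ
        { l∈ (inj₁ (inj₁ (inj₁ (_ , tU)))) (_ , wl) → crossing-label l∈ tU wl
        ; l∈ (inj₁ (inj₁ (inj₂ (_ , hW)))) (ul , _) → crossing-labelʷ l∈ hW ul
        ; l∈ (inj₁ (inj₂ ((_ , ¬wl) , _))) (_ , wl) → ¬wl wl ; l∈ (inj₂ ((_ , ¬ul) , _)) (ul , _) → ¬ul ul }
      s₅ : count c₄? ls + count O? ls ≤ count c₅? ls
      s₅ = count-⊎-≥ c₄? O? c₅? ls (λ _ → inj₁) (λ _ → inj₂) λ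
        { l∈ (inj₁ (inj₁ (inj₁ (inj₁ (_ , tU))))) ((_ , ¬tU , _) , _) → ¬tU tU
        ; l∈ (inj₁ (inj₁ (inj₁ (inj₂ (_ , hW))))) ((_ , _ , ¬hW) , _) → ¬hW hW
        ; l∈ (inj₁ (inj₁ (inj₂ ((ul , _) , _)))) (_ , ¬ul , _) → ¬ul ul
        ; l∈ (inj₁ (inj₂ ((wl , _) , _))) (_ , _ , ¬wl) → ¬wl wl ; l∈ (inj₂ (ul , _)) (_ , ¬ul , _) → ¬ul ul }
      ord : ∀ {l} → l ∈ₗ ls → ((((A l ⊎ B l) ⊎ Onᵘ l) ⊎ Onʷ l) ⊎ D l) ⊎ O l → ¬ ¬ label l ≢ nothing
      ord {l} _ (inj₁ (inj₁ (inj₁ (inj₁ (inj₁ (o , _)))))) h = h o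
      ord {l} _ (inj₁ (inj₁ (inj₁ (inj₁ (inj₂ (o , _)))))) h = h o
      ord {l} _ (inj₁ (inj₁ (inj₁ (inj₂ ((ul , _) , _))))) h = h (not-special (label l) ul)
      ord {l} _ (inj₁ (inj₁ (inj₂ ((wl , _) , _)))) h = h (not-special (label l) wl)
      ord {l} _ (inj₁ (inj₂ (ul , _))) h = h (not-special (label l) ul)
      ord {l} _ (inj₂ ((o , _) , _)) h = h o

    -- Otherwise the last label could be turned to `w`, leaving out `u`, which has a free edge.
    D-ends : ∀ {l} → l ∈ₗ ls → D l → head l ≢ u
    D-ends {a ⟨ just e ⟩ _} l∈ (ul , wl) refl with ∈-∃++ l∈
    ... | l₁ , l₂ , refl with split-at l₁ (proj₁ gap)
    ... | _ , _ , [] = let f , f∈ , uf = freeᵘ in bypass-last′ gap l₁ refl f∈ uf wl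
    ... | _ , _ , (_∷_ {ls = l₃} j c) = u∉tails gap (subst (u ∈ₗ_) (sym (map-++ tail l₁ _)) (∈-++⁺ʳ (tails l₁) (there (here refl))))

  module Balanced {w u ls F U W} (S : BothFree w u ls F U W) where
    open Split S public

    u≢w : u ≢ w
    u≢w refl = u∉tails gap (go (proj₁ gap) s∈)
      where
      go : ∀ {ks v} → Chain w ks v → ∀ {l} → l ∈ₗ ks → w ∈ₗ tails ks
      go (_ ∷ _) _ = here refl

    D-ends′ : ∀ {l} → l ∈ₗ ls → D l → tail l ≢ w
    D-ends′ l∈ (ul , wl) = Split.D-ends (flipped S) (∈-rev l∈) (wl , ul)

    -- Such a label has four different vertices: both ends of the path and both ends of its link.
    D-zero : ρ ≡ 2 → count D? ls ≡ 0
    D-zero ρ≡2 = count-none D? none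
      where
      none : ∀ {l} → l ∈ₗ ls → ¬ D l
      none {_ ⟨ nothing ⟩ _} _ ()
      none {a ⟨ just e ⟩ b} l∈ d@(ue , we) = contradiction
        (size-≥ e {u ∷ w ∷ a ∷ b ∷ []}
          ((u≢w ∷ (λ { refl → u∉tails gap (∈-map⁺ tail l∈) }) ∷ (D-ends l∈ d ∘ sym) ∷ []) ∷
           ((D-ends′ l∈ d ∘ sym) ∷ (λ { refl → ∉-head (path-unique gap) (∈-map⁺ head l∈) }) ∷ []) ∷ (link≢ gap l∈ ∷ []) ∷ [] ∷ [])
          λ { (here refl) → ue ; (there (here refl)) → we ; (there (there (here refl))) → proj₁ (gap-joins gap l∈)
            ; (there (there (there (here refl)))) → proj₂ (gap-joins gap l∈) })
        (<⇒≱ (s≤s (≤-reflexive (trans (unif (gap-label {ls} {F} uses l∈)) (cong suc ρ≡2)))))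

    classes≤n : (suc (count A? ls) + count Onᵘ? ls) + (suc (count B? ls) + count Onʷ? ls) + (count D? ls + count O? ls) ≤ n
    classes≤n = subst ((suc (count A? ls) + count Onᵘ? ls) + (suc (count B? ls) + count Onʷ? ls) + (count D? ls + count O? ls) ≤_) (path-length gap)
      (≤-trans (≤-reflexive (l (count A? ls) (count B? ls) (count Onᵘ? ls) (count Onʷ? ls) (count D? ls) (count O? ls))) (s≤s count-classes))
      where
      l : ∀ a b α β d o → (suc a + α) + (suc b + β) + (d + o) ≡ suc (a + b + α + β + d + o + 1)
      l = solve-∀

    -- As m C ρ < δ, the bounds on the degrees of both ends are attained.
    balance : (suc (count A? ls) ≡ m × count Onᵘ? ls ≡ 0) × (suc (count B? ls) ≡ m × count Onʷ? ls ≡ 0) ×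
              count D? ls + count O? ls ≡ 1 × 1 ≤ exits + count D? ls × ρ < m
    balance = balance-arith {suc (count A? ls)} {suc (count B? ls)} {count Onᵘ? ls} {count Onʷ? ls} {count D? ls} {count O? ls}
      {exits} {Opposite.exits} classes≤n D-zero
      (subst (λ k → δ ≤ k C ρ + (exits + (count Onᵘ? ls + count D? ls))) length-L degree-bound) exits≤
      (subst (exits <_) length-L exits<L) (subst (ρ ≤_) length-L ρ≤L)
      (≤-trans Opposite.degree-bound (≤-reflexive (cong₂ (λ k r → k C ρ + (Opposite.exits + r)) L≡ (cong₂ _+_ opp-Onᵘ opp-D))))
      (≤-trans Opposite.exits≤ (≤-reflexive (cong₂ _+_ opp-Onᵘ opp-O)))
      (subst (Opposite.exits <_) L≡ Opposite.exits<L) (subst (ρ ≤_) L≡ Opposite.ρ≤L)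
      where
      L≡ : length Opposite.L ≡ suc (count B? ls)
      L≡ = trans Opposite.length-L (cong suc opp-A)

  -- Both ends have free edges: rotations in the tight case

  module _ {w u l₁ a e b l₂ F U W} (S : BothFree w u (l₁ ++ a ⟨ just e ⟩ b ∷ l₂) F U W) where
    open OneEnd S
    private
      ls = l₁ ++ a ⟨ just e ⟩ b ∷ l₂

    Rotated : Set
    Rotated = ∃ λ ls₁ → ∃₂ λ F₁ W₁ → BothFree a u ls₁ F₁ U W₁ ×
      (∀ {j} → j ∈ₗ l₁ → u ∈ˡ label j → flip j ∈ₗ ls₁) × (∀ {j} → j ∈ₗ l₂ → u ∈ˡ label j → j ∈ₗ ls₁)

    -- The free edges and labels at `u` stay as they are, up to the direction of links, so `U` is
    -- unchanged. The label set free contains the new end `a`, and only the set reached from there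
    -- has to be formed anew.
    rotate : b ∈ W → ¬ ¬ Rotated
    rotate bW ¬rotated with proj₁ (reachʷ b) bW
    ... | _ , g , ψ , bg with release crossableʷ gap ψ
    ... | ls′ , F′ , G′ , sim , g∈ , u∉g , keep , stay with Similar-split l₁ sim | pick g∈
    ... | m₁ , _ , refl , tails≡ , ordinary {e′ = ê} {ms = m₂} sim₂ | F″ , perm =
      ¬¬-comprehension (Reach a ls₁ F₁) λ (W₁ , reach₁) → ¬rotated (ls₁ , F₁ , W₁ , record
        { gap = G₁
        ; freeᵘ = let f , f∈ , uf = freeᵘ in f , to-free f∈ uf , uf
        ; freeʷ = ê , here refl , proj₁ (gap-joins G′ k̂∈)
        ; reachᵘ = λ v → Reach-map to-free to-link ∘ proj₁ (reachᵘ v) , proj₂ (reachᵘ v) ∘ Reach-map from-free from-link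
        ; reachʷ = reach₁ } ,
        (λ j∈ uj → ∈-++⁺ˡ (∈-rev (before j∈ uj))) ,
        (λ j∈ uj → ∈-++⁺ʳ (rev m₁) (there (after j∈ uj))))
      where
      wg : w ∈ g
      wg = Freeable-∋ ψ
      ls₁ = rev m₁ ++ w ⟨ just g ⟩ b ∷ m₂
      F₁ = ê ∷ F″
      k̂∈ : a ⟨ just ê ⟩ b ∈ₗ m₁ ++ a ⟨ just ê ⟩ b ∷ m₂
      k̂∈ = ∈-++⁺ʳ m₁ (here refl)
      G₁ : Gap a u ls₁ F₁
      G₁ = rotateʷ m₁ G′ (↭-trans (prep ê perm) (Perm.swap ê g ↭-refl)) wg bg
      u∉ê : ¬ u ∈ ê
      u∉ê = cross-labelʷ G′ k̂∈ g∈ wg bg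
      uses′ : Uses (m₁ ++ a ⟨ just ê ⟩ b ∷ m₂) F′
      uses′ = proj₂ (proj₂ G′)
      to-free : ∀ {f} → f ∈ₗ F → u ∈ f → f ∈ₗ F₁
      to-free f∈ uf with ∈-resp-↭ perm (keep f∈ uf)
      ... | here refl = absurd (u∉g uf)
      ... | there p = there p
      from-free : ∀ {f} → f ∈ₗ F₁ → u ∈ f → f ∈ₗ F
      from-free (here refl) uf = absurd (u∉ê uf)
      from-free (there p) uf with gap-cases {ls} {F} uses (gap-free {m₁ ++ _ ∷ m₂} {F′} uses′ (∈-resp-↭ (↭-sym perm) (there p)))
      ... | inj₂ f∈ = f∈
      ... | inj₁ (_ , _ , l∈) = absurd (gap-free-used {m₁ ++ _ ∷ m₂} {F′} uses′ (stay l∈ uf) (∈-resp-↭ (↭-sym perm) (there p)))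
      position : ∀ {j} → j ∈ₗ ls → u ∈ˡ label j → j ∈ₗ m₁ ⊎ j ∈ₗ m₂
      position {j} j∈ uj with ∈-++⁻ m₁ (stay j∈ uj)
      ... | inj₁ p = inj₁ p
      ... | inj₂ (here refl) = absurd (u∉ê uj)
      ... | inj₂ (there p) = inj₂ p
      t₁ : Unique (tails l₁ ++ a ∷ tails l₂)
      t₁ = subst Unique (map-++ tail l₁ (a ⟨ just e ⟩ b ∷ l₂)) (tails-unique gap)
      t₂ : Unique (tails m₁ ++ a ∷ tails m₂)
      t₂ = subst Unique (map-++ tail m₁ (a ⟨ just ê ⟩ b ∷ m₂)) (tails-unique G′)
      separate : ∀ xs {ys} {v : Fin n} → Unique (xs ++ ys) → v ∈ₗ xs → ¬ v ∈ₗ ys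
      separate xs {ys} un v∈ v∈′ with ∈-∃++ v∈
      ... | as , bs , refl = ∉-head (Unique-++ʳ as (subst Unique (++-assoc as (_ ∷ bs) ys) un)) (∈-++⁺ʳ bs v∈′)
      before : ∀ {j} → j ∈ₗ l₁ → u ∈ˡ label j → j ∈ₗ m₁
      before {j} j∈ uj with position (∈-++⁺ˡ j∈) uj
      ... | inj₁ p = p
      ... | inj₂ p = absurd (separate (tails m₁) t₂ (subst (tail j ∈ₗ_) (sym tails≡) (∈-map⁺ tail j∈)) (there (∈-map⁺ tail p)))
      after : ∀ {j} → j ∈ₗ l₂ → u ∈ˡ label j → j ∈ₗ m₂
      after {j} j∈ uj with position (∈-++⁺ʳ l₁ (there j∈)) uj
      ... | inj₂ p = p
      ... | inj₁ p = absurd (separate (tails l₁) t₁ (subst (tail j ∈ₗ_) tails≡ (∈-map⁺ tail p)) (there (∈-map⁺ tail j∈)))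
      to-link : ∀ {c d f} → c ⟨ just d ⟩ f ∈ₗ ls → u ∈ d → c ⟨ just d ⟩ f ∈ₗ ls₁ ⊎ f ⟨ just d ⟩ c ∈ₗ ls₁
      to-link j∈ ud with position j∈ ud
      ... | inj₁ p = inj₂ (∈-++⁺ˡ (∈-rev p))
      ... | inj₂ p = inj₁ (∈-++⁺ʳ (rev m₁) (there p))
      original : ∀ {c d f} → c ⟨ just d ⟩ f ∈ₗ m₁ ++ a ⟨ just ê ⟩ b ∷ m₂ → u ∈ d → c ⟨ just d ⟩ f ∈ₗ ls
      original {c} {d} {f} j∈ ud with gap-cases {ls} {F} uses (gap-label {m₁ ++ _ ∷ m₂} {F′} uses′ j∈)
      ... | inj₂ d∈ = absurd (gap-free-used {m₁ ++ _ ∷ m₂} {F′} uses′ j∈ (keep d∈ ud))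
      ... | inj₁ (c′ , f′ , i∈) = subst (_∈ₗ ls) (same (gap-labels-unique {m₁ ++ _ ∷ m₂} {F′} uses′) (stay i∈ ud) j∈) i∈
        where
        same : ∀ {ks} → Unique (labels ks) → c′ ⟨ just d ⟩ f′ ∈ₗ ks → c ⟨ just d ⟩ f ∈ₗ ks → c′ ⟨ just d ⟩ f′ ≡ c ⟨ just d ⟩ f
        same _ (here refl) (here refl) = refl
        same un (here refl) (there q) = absurd (∉-head un (∈-map⁺ label q))
        same un (there q) (here refl) = absurd (∉-head un (∈-map⁺ label q))
        same (_ ∷ un) (there q) (there q′) = same un q q′
      from-link : ∀ {c d f} → c ⟨ just d ⟩ f ∈ₗ ls₁ → u ∈ d → c ⟨ just d ⟩ f ∈ₗ ls ⊎ f ⟨ just d ⟩ c ∈ₗ ls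
      from-link j∈ ud with ∈-++⁻ (rev m₁) j∈
      ... | inj₁ p = inj₂ (original (∈-++⁺ˡ (∈-rev⁻ m₁ p)) ud)
      ... | inj₂ (here refl) = absurd (u∉g ud)
      ... | inj₂ (there p) = inj₁ (original (∈-++⁺ʳ m₁ (there p)) ud)

  rev-mid : ∀ l₁ {j : Link n} {l₂} → rev (l₁ ++ j ∷ l₂) ≡ rev l₂ ++ flip j ∷ rev l₁
  rev-mid l₁ {j} {l₂} = trans (rev-++ l₁ (j ∷ l₂)) (++-assoc (rev l₂) [ flip j ] (rev l₁))

  flipped-at : ∀ l₁ {w u j l₂ F U W} → BothFree w u (l₁ ++ j ∷ l₂) F U W → BothFree u w (rev l₂ ++ flip j ∷ rev l₁) F W U
  flipped-at l₁ {F = F} {U} {W} S = subst (λ ks → BothFree _ _ ks F W U) (rev-mid l₁) (flipped S)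

  -- Rotating w to a would otherwise put the link j into a class that is empty.
  tail-in-label : ∀ l₁ {w u a e b l₂ F U W j} (S : BothFree w u (l₁ ++ a ⟨ just e ⟩ b ∷ l₂) F U W) → b ∈ W → j ∈ₗ l₂ →
                  u ∈ˡ label j → w ∈ˡ label j → a ∈ˡ label j
  tail-in-label l₁ {a = a} {j = j} S bW j∈ uj wj with a ∈ˡ? label j
  ... | yes p = p
  ... | no a∉ = absurd (rotate {l₁ = l₁} S bW λ (ls₁ , F₁ , W₁ , S₁ , _ , keep) →
      contradiction (count-pos (OneEnd.Onᵘ? S₁) (keep j∈ uj) ((uj , a∉) , λ aU → OneEnd.crossing-label S (∈-++⁺ʳ l₁ (there j∈)) aU wj))
        (<⇒≱ (s≤s (≤-reflexive (proj₂ (proj₁ (Balanced.balance S₁)))))))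

  separate : ∀ xs {ys} {v : Fin n} → Unique (xs ++ ys) → v ∈ₗ xs → ¬ v ∈ₗ ys
  separate xs {ys} un v∈ v∈′ with ∈-∃++ v∈
  ... | as , bs , refl = ∉-head (Unique-++ʳ as (subst Unique (++-assoc as (_ ∷ bs) ys) un)) (∈-++⁺ʳ bs v∈′)

  module At {w u l₁ j l₂ F U W} (S : BothFree w u (l₁ ++ j ∷ l₂) F U W) (uj : u ∈ˡ label j) (wj : w ∈ˡ label j) where
    open Balanced S

    j∈ : j ∈ₗ l₁ ++ j ∷ l₂
    j∈ = ∈-++⁺ʳ l₁ (here refl)

    B⇒∈ : ∀ {k} → k ∈ₗ l₁ → B k → tail k ∈ˡ label j
    B⇒∈ {_ ⟨ nothing ⟩ _} _ (ord , _) = absurd (ord refl)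
    B⇒∈ {a ⟨ just e ⟩ b} k∈ (_ , bW) with ∈-∃++ k∈
    ... | x , y , refl = tail-in-label x (subst (λ ks → BothFree w u ks F U W) (++-assoc x _ _) S) bW (∈-++⁺ʳ y (here refl)) uj wj

    -- Besides `u` and the two ends of its link, the label of `j` contains the tails of all links of
    -- `B` in front of it, by `B⇒∈`.
    few : 3 + count B? l₁ ≤ suc ρ
    few = go j refl
      where
      go : ∀ k → k ≡ j → 3 + count B? l₁ ≤ suc ρ
      go (a ⟨ nothing ⟩ b) refl = absurd uj
      go (a ⟨ just d ⟩ b) refl = subst₂ _≤_ (cong (3 +_) (length-map tail (filter B? l₁))) (unif (gap-label {l₁ ++ j ∷ l₂} {F} uses j∈))
          (size-≥ d {u ∷ b ∷ a ∷ tails (filter B? l₁)} distinct λ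
            { (here refl) → uj ; (there (here refl)) → proj₂ (gap-joins gap j∈) ; (there (there (here refl))) → proj₁ (gap-joins gap j∈)
            ; (there (there (there p))) → in-d p })
        where
        in-d : ∀ {v} → v ∈ₗ tails (filter B? l₁) → v ∈ d
        in-d p with ∈-map⁻ tail p
        ... | k , k∈ , refl = let k∈l₁ , Bk = ∈-filter⁻ B? {xs = l₁} k∈ in B⇒∈ k∈l₁ Bk
        ⊆l₁ : ∀ {v} → v ∈ₗ tails (filter B? l₁) → v ∈ₗ tails l₁
        ⊆l₁ p with ∈-map⁻ tail p
        ... | k , k∈ , refl = ∈-map⁺ tail (proj₁ (∈-filter⁻ B? {xs = l₁} k∈))
        t₁ : Unique (tails l₁ ++ a ∷ tails l₂)
        t₁ = subst Unique (map-++ tail l₁ (j ∷ l₂)) (tails-unique gap)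
        spine : Unique ((tails l₁ ++ [ a ]) ++ b ∷ heads l₂)
        spine = subst (λ t → Unique (t ++ b ∷ heads l₂)) (sym (tails-chain (proj₁ (split-at l₁ (proj₁ gap)))))
          (subst (λ h → Unique (w ∷ h)) (heads-++ l₁ (j ∷ l₂)) (path-unique gap))
        ⊆tails : ∀ {v} → v ∈ₗ a ∷ tails (filter B? l₁) → v ∈ₗ tails l₁ ++ [ a ]
        ⊆tails (here refl) = ∈-++⁺ʳ (tails l₁) (here refl)
        ⊆tails (there p) = ∈-++⁺ˡ (⊆l₁ p)
        ⊆all : ∀ {v} → v ∈ₗ tails l₁ ++ [ a ] → v ∈ₗ tails (l₁ ++ j ∷ l₂)
        ⊆all {v} p with ∈-++⁻ (tails l₁) p
        ... | inj₁ q = subst (v ∈ₗ_) (sym (map-++ tail l₁ (j ∷ l₂))) (∈-++⁺ˡ q)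
        ... | inj₂ (here refl) = ∈-map⁺ tail j∈
        distinct : Unique (u ∷ b ∷ a ∷ tails (filter B? l₁))
        distinct = Unique-∷ (λ { (here eq) → D-ends j∈ (uj , wj) (sym eq) ; (there p) → u∉tails gap (⊆all (⊆tails p)) })
          (Unique-∷ (λ p → separate (tails l₁ ++ [ a ]) spine (⊆tails p) (here refl))
          (Unique-∷ (λ p → separate (tails l₁) t₁ (⊆l₁ p) (here refl))
            (AllPairs.map⁺ (AllPairs.filter⁺ B? (AllPairs.map⁻ (Unique-++ˡ (tails l₁) t₁))))))

    ¬A-j : ¬ A j
    ¬A-j (_ , tU) = crossing-label j∈ tU wj

    D≡1 : count D? (l₁ ++ j ∷ l₂) ≡ 1 × count O? (l₁ ++ j ∷ l₂) ≡ 0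
    D≡1 = go (proj₁ (proj₂ (proj₂ balance))) (count-pos D? j∈ (uj , wj))
      where
      go : ∀ {d o} → d + o ≡ 1 → 1 ≤ d → d ≡ 1 × o ≡ 0
      go {suc zero} {zero} _ _ = refl , refl

    -- In the tight case a single ordinary link is in neither class, and `j` is this link.
    A-or-B : ∀ {k} → k ∈ₗ l₁ → label k ≢ nothing → A k ⊎ B k
    A-or-B {k} k∈l₁ ord with tail k ∈? U | head k ∈? W | on? u k | on? w k
    ... | yes tU | _ | _ | _ = inj₁ (ord , tU)
    ... | no _ | yes hW | _ | _ = inj₂ (ord , hW)
    ... | no ¬tU | no ¬hW | yes uk | yes wk = contradiction (begin
        2                                       ≤⟨ +-mono-≤ (count-pos D? k∈l₁ (uk , wk)) (count-pos D? {xs = j ∷ l₂} (here refl) (uj , wj)) ⟩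
        count D? l₁ + count D? (j ∷ l₂)         ≡⟨ sym (count-++ D? l₁ (j ∷ l₂)) ⟩
        count D? (l₁ ++ j ∷ l₂)                 ≡⟨ proj₁ D≡1 ⟩
        1 ∎) (<⇒≱ ≤-refl)
      where open ≤-Reasoning
    ... | no ¬tU | no ¬hW | yes uk | no ¬wk = contradiction (count-pos Onᵘ? (∈-++⁺ˡ k∈l₁) ((uk , ¬wk) , ¬tU))
        (<⇒≱ (s≤s (≤-reflexive (proj₂ (proj₁ balance)))))
    ... | no ¬tU | no ¬hW | no ¬uk | yes wk = contradiction (count-pos Onʷ? (∈-++⁺ˡ k∈l₁) ((wk , ¬uk) , ¬hW))
        (<⇒≱ (s≤s (≤-reflexive (proj₂ (proj₁ (proj₂ balance))))))
    ... | no ¬tU | no ¬hW | no ¬uk | no ¬wk = contradiction (count-pos O? (∈-++⁺ˡ k∈l₁) ((ord , ¬tU , ¬hW) , ¬uk , ¬wk))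
        (<⇒≱ (s≤s (≤-reflexive (proj₂ D≡1))))

    -- A link of `A` is not followed by one of `B`, by `no-bypass`. So links of `A` continue up to
    -- `j`, whose label contains `w`, contrary to `no-bypass-label`.
    chase : ∀ xs k rest → xs ++ k ∷ rest ≡ l₁ → A k → (∀ {r} → r ∈ₗ rest → A r ⊎ B r) → Empty
    chase xs (_ ⟨ nothing ⟩ _) rest eq (ord , _) _ = ord refl
    chase xs k@(a ⟨ just e ⟩ b) rest eq (ord , aU) h = step rest eq h
      where
      whole : ∀ rest → xs ++ k ∷ rest ≡ l₁ → l₁ ++ j ∷ l₂ ≡ xs ++ k ∷ (rest ++ j ∷ l₂)
      whole rest eq = trans (cong (_++ j ∷ l₂) (sym eq)) (++-assoc xs (k ∷ rest) (j ∷ l₂))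
      reach-a : ∀ {ks} → l₁ ++ j ∷ l₂ ≡ ks → Reach u ks F a
      reach-a refl = proj₁ (reachᵘ a) aU
      gap′ : ∀ {ks} → l₁ ++ j ∷ l₂ ≡ ks → Gap w u ks F
      gap′ refl = gap
      next : ∀ {c ℓ d r} → l₁ ++ j ∷ l₂ ≡ xs ++ k ∷ c ⟨ ℓ ⟩ d ∷ r → b ≡ c
      next eq with split-at xs (proj₁ (gap′ eq))
      ... | _ , _ , _ ∷ _ = refl
      step : ∀ rest → xs ++ k ∷ rest ≡ l₁ → (∀ {r} → r ∈ₗ rest → A r ⊎ B r) → Empty
      step [] eq _ = last j refl
        where
        last : ∀ i → i ≡ j → Empty
        last (_ ⟨ nothing ⟩ _) refl = uj
        last (c ⟨ just d ⟩ f) refl with next (whole [] eq)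
        ... | refl = no-bypass-label xs (gap′ (whole [] eq)) (reach-a (whole [] eq)) wj
      step (r ∷ rest) eq h with h (here refl)
      ... | inj₁ Ar = chase (xs ++ [ k ]) r rest (trans (++-assoc xs [ k ] (r ∷ rest)) eq) Ar (h ∘ there)
      step ((_ ⟨ nothing ⟩ _) ∷ rest) eq h | inj₂ (ord′ , _) = ord′ refl
      step ((c ⟨ just d ⟩ f) ∷ rest) eq h | inj₂ (_ , fW) with next (whole (_ ∷ rest) eq)
      ... | refl = no-bypass xs (gap′ (whole (_ ∷ rest) eq)) (reach-a (whole (_ ∷ rest) eq))
            (subst (λ ks → Reach w ks F f) (whole (_ ∷ rest) eq) (proj₁ (reachʷ f) fW))

    -- There are m - 1 ≥ ρ links in `A`, more than can lie behind `j`, so one lies in front of it.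
    -- With the special link behind `j`, all links from there to `j` are ordinary and `chase`
    -- applies.
    special-after : 3 + count A? l₂ ≤ suc ρ → ∀ {p q} → p ⟨ nothing ⟩ q ∈ₗ l₂ → Empty
    special-after few′ {p} {q} sp∈ = go (count-witness A? l₁ A₁)
      where
      open ≤-Reasoning
      A₁ : 1 ≤ count A? l₁
      A₁ = +-cancelʳ-≤ (suc (count A? l₂)) _ _ (begin
        1 + suc (count A? l₂)                 ≤⟨ s≤s⁻¹ few′ ⟩
        ρ                                     ≤⟨ s≤s⁻¹ (≤-trans (proj₂ (proj₂ (proj₂ (proj₂ balance)))) (≤-reflexive (sym (proj₁ (proj₁ balance))))) ⟩
        count A? (l₁ ++ j ∷ l₂)               ≡⟨ trans (count-++ A? l₁ (j ∷ l₂)) (cong (count A? l₁ +_) (count-no A? ¬A-j)) ⟩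
        count A? l₁ + count A? l₂             ≤⟨ +-monoʳ-≤ (count A? l₁) (n≤1+n _) ⟩
        count A? l₁ + suc (count A? l₂) ∎)
      ordinary₁ : ∀ {k} → k ∈ₗ l₁ → label k ≢ nothing
      ordinary₁ {a ⟨ nothing ⟩ b} k∈ _ = separate (tails l₁) (subst Unique (map-++ tail l₁ (j ∷ l₂)) (tails-unique gap)) (∈-map⁺ tail k∈)
        (there (subst (_∈ₗ tails l₂) (cong tail (trans (unique-special (∈-++⁺ʳ l₁ (there sp∈))) (sym (unique-special (∈-++⁺ˡ k∈))))) (∈-map⁺ tail sp∈)))
      go : ∃ (λ k → k ∈ₗ l₁ × A k) → Empty
      go (k , k∈ , Ak) with ∈-∃++ k∈
      ... | xs , rest , refl = chase xs k rest refl Ak λ r∈ → A-or-B (∈-++⁺ʳ xs (there r∈)) (ordinary₁ (∈-++⁺ʳ xs (there r∈)))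

  A-flip : ∀ {w u} {U W : Subset n} ks → count (Predicates.A? w u W U) (rev ks) ≡ count (Predicates.B? u w U W) ks
  A-flip {w} {u} {U} {W} ks = trans (count-rev (Predicates.A? w u W U) ks)
    (≤-antisym (count-mono (Predicates.A? w u W U ∘ flip) (Predicates.B? u w U W) ks λ _ p → p)
               (count-mono (Predicates.B? u w U W) (Predicates.A? w u W U ∘ flip) ks λ _ p → p))

  B-flip : ∀ {w u} {U W : Subset n} ks → count (Predicates.B? w u W U) (rev ks) ≡ count (Predicates.A? u w U W) ks
  B-flip {w} {u} {U} {W} ks = trans (count-rev (Predicates.B? w u W U) ks)
    (≤-antisym (count-mono (Predicates.B? w u W U ∘ flip) (Predicates.A? u w U W) ks λ _ p → p)
               (count-mono (Predicates.A? u w U W) (Predicates.B? w u W U ∘ flip) ks λ _ p → p))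

  -- Reversing the path exchanges the two sides of `j`, so the special link may be assumed to lie
  -- behind it.
  no-D-at : ∀ l₁ {w u j l₂ F U W} → BothFree w u (l₁ ++ j ∷ l₂) F U W → u ∈ˡ label j → ¬ w ∈ˡ label j
  no-D-at l₁ {w} {u} {j} {l₂} {F} {U} {W} S uj wj = go (∈-++⁻ l₁ (OneEnd.s∈ S))
    where
    S′ : BothFree u w (rev l₂ ++ flip j ∷ rev l₁) F W U
    S′ = flipped-at l₁ S
    go : ∀ {p q} → (p ⟨ nothing ⟩ q ∈ₗ l₁) ⊎ (p ⟨ nothing ⟩ q ∈ₗ j ∷ l₂) → Empty
    go (inj₁ s∈) = At.special-after {l₁ = rev l₂} {j = flip j} S′ wj uj
      (subst (λ c → 3 + c ≤ suc ρ) (sym (A-flip {w} {u} {U} {W} l₁)) (At.few {l₁ = l₁} {j = j} S uj wj)) (∈-rev s∈)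
    go (inj₂ (here eq)) = subst (λ k → u ∈ˡ label k) (sym eq) uj
    go (inj₂ (there s∈)) = At.special-after {l₁ = l₁} {j = j} S uj wj
      (subst (λ c → 3 + c ≤ suc ρ) (B-flip {w} {u} {U} {W} l₂) (At.few {l₁ = rev l₂} {j = flip j} S′ wj uj)) s∈

  no-D : ∀ {w u ls F U W j} → BothFree w u ls F U W → j ∈ₗ ls → u ∈ˡ label j → ¬ w ∈ˡ label j
  no-D S j∈ with ∈-∃++ j∈
  ... | l₁ , l₂ , refl = no-D-at l₁ S

  module Exits {w u ls F U W} (S : BothFree w u ls F U W) where
    open Balanced S

    D≡0 : count D? ls ≡ 0
    D≡0 = count-none D? λ k∈ (uk , wk) → no-D S k∈ uk wk

    O≡1 : count O? ls ≡ 1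
    O≡1 = trans (cong (_+ count O? ls) (sym D≡0)) (proj₁ (proj₂ (proj₂ balance)))

    ExitsAt : Link n → Set
    ExitsAt k = A k × (u ∈ˡ label k × ¬ head k ∈ₗ u ∷ L)

    Exit : Set
    Exit = ∃₂ λ l₁ k → ∃₂ λ o l₃ → ls ≡ l₁ ++ k ∷ o ∷ l₃ × ExitsAt k × O o

    exit : Exit
    exit = start (count-witness Exit? ls some)
      where
      some : 1 ≤ exits
      some = ≤-trans (proj₁ (proj₂ (proj₂ (proj₂ balance)))) (≤-reflexive (trans (cong (exits +_) D≡0) (+-identityʳ exits)))
      settle : ∀ l₁ {k l₂} → ls ≡ l₁ ++ k ∷ l₂ → ExitsAt k → (∃₂ λ o l₃ → l₂ ≡ o ∷ l₃ × (Onᵘ o ⊎ O o)) → Exit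
      settle l₁ eq ek (o , l₃ , l₂≡ , inj₂ Oo) = l₁ , _ , o , l₃ , trans eq (cong (λ t → l₁ ++ _ ∷ t) l₂≡) , ek , Oo
      settle l₁ {k} eq ek (o , l₃ , l₂≡ , inj₁ Ono) = contradiction
        (count-pos Onᵘ? (subst (o ∈ₗ_) (sym (trans eq (cong (λ t → l₁ ++ k ∷ t) l₂≡))) (∈-++⁺ʳ l₁ (there (here refl)))) Ono)
        (<⇒≱ (s≤s (≤-reflexive (proj₂ (proj₁ balance)))))
      start : ∃ (λ k → k ∈ₗ ls × ExitsAt k) → Exit
      start (k , k∈ , ek) = let l₁ , l₂ , eq = ∈-∃++ k∈ in settle l₁ eq ek (after-exit l₁ eq ek)

  -- The only link `o` of `O` follows an exit `k` of `u` and, in the reversed path, an exit of `w`.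
  -- So `k`, `o` and a link from `a` to `b` with `b` in `W` are consecutive. Rotating `w` to `a`
  -- reverses `k`: its label contains `u`, its new tail is not in `U`, and so it falls into `Onᵘ`,
  -- which is empty.
  no-state : ∀ {w u ls F U W} → ¬ BothFree w u ls F U W
  no-state {w} {u} {ls} {F} {U} {W} S = go (Exits.exit S) (Exits.exit (flipped S))
    where
    module P = Exits S
    module P′ = Exits (flipped S)
    open Predicates u w U W
    rotated : ∀ {a k ls₁ F₁ W₁} → BothFree a u ls₁ F₁ U W₁ → flip k ∈ₗ ls₁ → u ∈ˡ label k → ¬ head k ∈ U → Empty
    rotated S₁ k∈ uk h∉ = contradiction (count-pos (OneEnd.Onᵘ? S₁) k∈ ((uk , no-D S₁ k∈ uk) , h∉))
      (<⇒≱ (s≤s (≤-reflexive (proj₂ (proj₁ (Balanced.balance S₁))))))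
    go : P.Exit → P′.Exit → Empty
    go _ (_ , (_ ⟨ nothing ⟩ _) , _ , _ , _ , ((ord , _) , _) , _) = ord refl
    go (l₁ , k , o , l₃ , eq , (_ , uk , hk∉) , Oo) (m₁ , (b ⟨ just e ⟩ a) , o′ , m₃ , eq′ , ((_ , bW) , _) , ((oo , p₁ , p₂) , p₃ , p₄)) =
      rotate {l₁ = l₁ ++ k ∷ o ∷ []} S′ bW λ (ls₁ , F₁ , W₁ , S₁ , back , _) →
        rotated {k = k} S₁ (back (∈-++⁺ʳ l₁ (here refl)) uk) uk (hk∉ ∘ there ∘ OneEnd.U⊆L S)
      where
      reversed : ls ≡ rev m₃ ++ flip o′ ∷ a ⟨ just e ⟩ b ∷ rev m₁
      reversed = trans (sym (rev-rev ls)) (trans (cong rev eq′) (trans (rev-mid m₁) (++-assoc (rev m₃) [ flip o′ ] _)))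
      forward : ls ≡ (l₁ ++ [ k ]) ++ o ∷ l₃
      forward = trans eq (sym (++-assoc l₁ [ k ] (o ∷ l₃)))
      l₃≡ : l₃ ≡ a ⟨ just e ⟩ b ∷ rev m₁
      l₃≡ = proj₂ (proj₂ (split-unique O? (l₁ ++ [ k ]) (rev m₃) (subst (λ ks → count O? ks ≡ 1) forward P.O≡1)
        (trans (sym forward) reversed) Oo ((oo , p₂ , p₁) , p₄ , p₃)))
      S′ : BothFree w u ((l₁ ++ k ∷ o ∷ []) ++ a ⟨ just e ⟩ b ∷ rev m₁) F U W
      S′ = subst (λ ks → BothFree w u ks F U W) (trans eq (trans (cong (λ t → l₁ ++ k ∷ o ∷ t) l₃≡) (sym (++-assoc l₁ (k ∷ o ∷ []) _)))) S

  no-both-free : ∀ {w u ls F} → Gap w u ls F → (∃ λ f → f ∈ₗ F × u ∈ f) → ¬ (∃ λ g → g ∈ₗ F × w ∈ g)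
  no-both-free {w} {u} {ls} {F} G fu gw = ¬¬-comprehension (Reach u ls F) λ (U , hU) → ¬¬-comprehension (Reach w ls F) λ (W , hW) →
    no-state record { gap = G ; freeᵘ = fu ; freeʷ = gw ; reachᵘ = hU ; reachʷ = hW }

  -- At most one end has free edges: rooted edges

  x≢y-ends : ∀ {w u ls F} → Gap w u ls F → ∀ {p q} → p ⟨ nothing ⟩ q ∈ₗ ls → u ≡ x ⊎ u ≡ y → q ≡ u
  x≢y-ends G s∈ ux with link-joins (proj₁ G) s∈ | ux
  ... | inj₁ (refl , refl) | inj₁ refl = absurd (u∉tails G (∈-map⁺ tail s∈))
  ... | inj₁ (refl , refl) | inj₂ refl = refl
  ... | inj₂ (refl , refl) | inj₁ refl = refl
  ... | inj₂ (refl , refl) | inj₂ refl = absurd (u∉tails G (∈-map⁺ tail s∈))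

  -- Links with `u` in the label are weighed against ordinary links entering `f`, with one more link
  -- for the special one. This serves both for a free edge at one end, where equality results, and
  -- for the case without any free edge at an end.
  module Count {w u ls F f} (G : Gap w u ls F) (f∈ : f ∈ₗ E) where
    uses : Uses ls F
    uses = proj₂ (proj₂ G)
    p q : Fin n
    p = proj₁ (gap-special {ls} {F} uses)
    q = proj₁ (proj₂ (gap-special {ls} {F} uses))
    s∈ : p ⟨ nothing ⟩ q ∈ₗ ls
    s∈ = proj₂ (proj₂ (gap-special {ls} {F} uses))

    Hit? : ∀ (l : Link n) → Dec (head l ∈ f)
    Hit? l = head l ∈? f
    Special? : ∀ (l : Link n) → Dec (¬ label l ≢ nothing)
    Special? = ¬? ∘ ordinary?
    OrdHit? : ∀ (l : Link n) → Dec (label l ≢ nothing × head l ∈ f)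
    OrdHit? l = ordinary? l ×-dec Hit? l
    SpecialHit? : ∀ (l : Link n) → Dec (¬ label l ≢ nothing × head l ∈ f)
    SpecialHit? l = Special? l ×-dec Hit? l

    heads-hit : count (_∈? f) [ w ] + count Hit? ls ≡ suc ρ
    heads-hit = trans (cong (count (_∈? f) [ w ] +_) (sym (count-map (_∈? f) head ls)))
      (trans (sym (count-++ (_∈? f) [ w ] (heads ls))) (trans (count-∈ f (path-unique G) (λ {v} _ → path-complete G v)) (unif f∈)))

    special-hits : count SpecialHit? ls ≤ 1
    special-hits = ≤-trans (count-mono SpecialHit? Special? ls λ _ → proj₁) (one (gap-labels-unique {ls} {F} uses))
      where
      one : ∀ {ks} → Unique (labels ks) → count Special? ks ≤ 1
      one {[]} _ = z≤n
      one {(_ ⟨ just _ ⟩ _) ∷ ks} (_ ∷ un) = one un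
      one {(_ ⟨ nothing ⟩ _) ∷ ks} un = s≤s (≤-reflexive (count-none Special? {ks} λ
        { {_ ⟨ nothing ⟩ _} k∈ _ → ∉-head un (∈-map⁺ label k∈) ; {_ ⟨ just _ ⟩ _} _ h → h λ () }))

    hits-split : count Hit? ls ≤ count OrdHit? ls + count SpecialHit? ls
    hits-split = count-⊎-≤ OrdHit? SpecialHit? Hit? ls λ {l} _ h → case ordinary? l of λ { (yes o) → inj₁ (o , h) ; (no s) → inj₂ (s , h) }

    Any? : ∀ (l : Link n) → Dec (u ∈ˡ label l ⊎ (label l ≢ nothing × head l ∈ f))
    Any? l = on? u l ⊎-dec OrdHit? l

    module _ (clear : ∀ {a e b} → a ⟨ just e ⟩ b ∈ₗ ls → u ∈ e → ¬ b ∈ f) (none : ∀ {g} → g ∈ₗ F → ¬ u ∈ g) where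
      on-u : count (on? u) ls ≡ count (u ∈?_) E
      on-u = trans (trans (sym (+-identityʳ _)) (cong (count (on? u) ls +_) (sym (count-none (u ∈?_) none)))) (gap-degree {ls} {F} uses u)

      both : count (on? u) ls + count OrdHit? ls ≤ count Any? ls
      both = count-⊎-≥ (on? u) OrdHit? Any? ls (λ _ → inj₁) (λ _ → inj₂) λ
        { {_ ⟨ just e ⟩ _} k∈ ue (_ , h) → clear k∈ ue h ; {_ ⟨ nothing ⟩ _} _ () }

      within : count Any? ls + count Special? ls ≤ length ls
      within = count-disjoint Any? Special? ls λ
        { {_ ⟨ just _ ⟩ _} _ _ s → s λ () ; {_ ⟨ nothing ⟩ _} _ (inj₁ ()) ; {_ ⟨ nothing ⟩ _} _ (inj₂ (o , _)) → absurd (o refl) }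

      1≤special : 1 ≤ count Special? ls
      1≤special = count-pos Special? s∈ λ h → h refl

      total : count (u ∈?_) E + count OrdHit? ls + 2 ≤ n
      total = begin
        count (u ∈?_) E + count OrdHit? ls + 2  ≡⟨ cong (λ k → k + count OrdHit? ls + 2) (sym on-u) ⟩
        count (on? u) ls + count OrdHit? ls + 2 ≤⟨ +-monoˡ-≤ 2 both ⟩
        count Any? ls + 2                       ≡⟨ l (count Any? ls) ⟩
        suc (count Any? ls + 1)                 ≤⟨ s≤s (≤-trans (+-monoʳ-≤ _ 1≤special) within) ⟩
        suc (length ls)                         ≡⟨ path-length G ⟩
        n ∎
        where
        open ≤-Reasoning
        l : ∀ k → k + 2 ≡ suc (k + 1)
        l = solve-∀

  -- A rotation at `w` along `g` keeps `u` and replaces `g`; a rotation at `u` along a label keeps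
  -- `g`. So the pair of `u` and `g` is what matters, and `w` is left open.
  Rooted : List (Subset n) → Fin n → Subset n → Set
  Rooted F₀ u g = ∃₂ λ w ls → Gap w u ls (g ∷ F₀) × w ∈ g

  module RootedAt {F₀ w u ls g} (G : Gap w u ls (g ∷ F₀)) (wg : w ∈ g) where
    private
      uses : Uses ls (g ∷ F₀)
      uses = proj₂ (proj₂ G)
      g∈ : g ∈ₗ E
      g∈ = gap-free {ls} {g ∷ F₀} uses (here refl)
      none : ∀ {f} → f ∈ₗ g ∷ F₀ → ¬ u ∈ f
      none f∈ uf = no-both-free G (_ , f∈ , uf) (g , here refl , wg)
      module N = Count G g∈
      clear : ∀ {a e b} → a ⟨ just e ⟩ b ∈ₗ ls → u ∈ e → ¬ b ∈ g
      clear l∈ ue bg = cross-labelʷ G l∈ (here refl) wg bg ue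

    private
      d = count (u ∈?_) E
      hits = count N.OrdHit? ls
      sp = count N.SpecialHit? ls

      ρ≤ : ρ ≤ hits + sp
      ρ≤ = ≤-trans (≤-reflexive (suc-injective (trans (sym N.heads-hit) (cong (_+ count N.Hit? ls) (count-yes (_∈? g) {xs = []} wg))))) N.hits-split

      chain : d + ρ + 2 ≤ n + sp
      chain = begin
        d + ρ + 2             ≤⟨ +-monoˡ-≤ 2 (+-monoʳ-≤ d ρ≤) ⟩
        d + (hits + sp) + 2   ≡⟨ l d hits sp ⟩
        d + hits + 2 + sp     ≤⟨ +-monoˡ-≤ sp (N.total clear none) ⟩
        n + sp ∎
        where
        open ≤-Reasoning
        l : ∀ d h s → d + (h + s) + 2 ≡ d + h + 2 + s
        l = solve-∀

      n+1≤ : n + 1 ≤ d + ρ + 2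
      n+1≤ = ≤-trans (+-monoˡ-≤ 1 (≤-trans n≤δ+r (+-monoˡ-≤ (suc ρ) (deg u)))) (≤-reflexive (l d ρ))
        where
        l : ∀ d ρ → d + suc ρ + 1 ≡ d + ρ + 2
        l = solve-∀

      -- The upper and lower bounds for the degree of `u` differ by `sp`, the number of special
      -- links entering `g`, minus one. Hence all inequalities of the count are equalities.
      sp≡1 : sp ≡ 1
      sp≡1 = ≤-antisym N.special-hits (+-cancelˡ-≤ n _ _ (≤-trans n+1≤ chain))

    rooted-degree : d + suc ρ ≡ n
    rooted-degree = ≤-antisym
      (+-cancelʳ-≤ 1 _ _ (≤-trans (≤-reflexive (l d ρ)) (subst (λ k → d + ρ + 2 ≤ n + k) sp≡1 chain)))
      (≤-trans n≤δ+r (+-monoˡ-≤ (suc ρ) (deg u)))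
      where
      l : ∀ d ρ → d + suc ρ + 1 ≡ d + ρ + 2
      l = solve-∀

    rooted-δ : δ + suc ρ ≡ n
    rooted-δ = ≤-antisym (≤-trans (+-monoˡ-≤ (suc ρ) (deg u)) (≤-reflexive rooted-degree)) n≤δ+r

    private
      special-head : ∀ {a b} → a ⟨ nothing ⟩ b ∈ₗ ls → b ∈ g
      special-head {a} {b} k∈ = go (count-witness N.SpecialHit? ls (≤-reflexive (sym sp≡1)))
        where
        same : ∀ {ks a′ b′} → Unique (labels ks) → a′ ⟨ nothing ⟩ b′ ∈ₗ ks → a ⟨ nothing ⟩ b ∈ₗ ks → b′ ≡ b
        same _ (here refl) (here refl) = refl
        same un (here refl) (there r) = absurd (∉-head un (∈-map⁺ label r))
        same un (there r) (here refl) = absurd (∉-head un (∈-map⁺ label r))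
        same (_ ∷ un) (there r) (there r′) = same un r r′
        go : ∃ (λ k → k ∈ₗ ls × (¬ label k ≢ nothing × head k ∈ g)) → b ∈ g
        go ((_ ⟨ just _ ⟩ _) , _ , s , _) = absurd (s λ ())
        go ((a′ ⟨ nothing ⟩ b′) , k′∈ , _ , bg) = subst (_∈ g) (same (gap-labels-unique {ls} {g ∷ F₀} uses) k′∈ k∈) bg

      -- Equality in the count leaves no other link.
      on-or-hit : ∀ {a e b} → a ⟨ just e ⟩ b ∈ₗ ls → u ∈ e ⊎ b ∈ g
      on-or-hit {a} {e} {b} k∈ with N.Any? (a ⟨ just e ⟩ b)
      ... | yes (inj₁ ue) = inj₁ ue
      ... | yes (inj₂ (_ , bg)) = inj₂ bg
      ... | no ¬any = contradiction (begin
          suc (d + ρ + 2)                                ≤⟨ s≤s (+-monoˡ-≤ 2 (+-monoʳ-≤ d ρ≤)) ⟩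
          suc (d + (hits + sp) + 2)                      ≡⟨ cong₂ (λ i j → suc (i + (hits + j) + 2)) (sym (N.on-u clear none)) sp≡1 ⟩
          suc (count (on? u) ls + (hits + 1) + 2)        ≡⟨ l (count (on? u) ls) hits ⟩
          (count (on? u) ls + hits) + 1 + 1 + 2          ≤⟨ +-monoˡ-≤ 2 (+-monoˡ-≤ 1 (+-monoˡ-≤ 1 (N.both clear none))) ⟩
          count N.Any? ls + 1 + 1 + 2                    ≤⟨ +-monoˡ-≤ 2 (+-mono-≤ (+-monoʳ-≤ (count N.Any? ls) (N.1≤special clear none)) (count-pos Left? k∈ (¬any , λ ()))) ⟩
          count N.Any? ls + count N.Special? ls + count Left? ls + 2 ≤⟨ +-monoˡ-≤ 2 three ⟩
          length ls + 2                                  ≡⟨ +-comm (length ls) 2 ⟩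
          suc (suc (length ls))                          ≡⟨ cong suc (path-length G) ⟩
          suc n ∎) (<⇒≱ (s≤s (≤-trans (≤-reflexive (+-comm 1 n)) n+1≤)))
        where
        open ≤-Reasoning
        l : ∀ c h → suc (c + (h + 1) + 2) ≡ (c + h) + 1 + 1 + 2
        l = solve-∀
        Left? : ∀ k → Dec (¬ (u ∈ˡ label k ⊎ (label k ≢ nothing × head k ∈ g)) × label k ≢ nothing)
        Left? k = ¬? (N.Any? k) ×-dec ordinary? k
        Two? : ∀ k → Dec ((u ∈ˡ label k ⊎ (label k ≢ nothing × head k ∈ g)) ⊎ ¬ label k ≢ nothing)
        Two? k = N.Any? k ⊎-dec N.Special? k
        three : count N.Any? ls + count N.Special? ls + count Left? ls ≤ length ls
        three = ≤-trans (+-monoˡ-≤ (count Left? ls) (count-⊎-≥ N.Any? N.Special? Two? ls (λ _ → inj₁) (λ _ → inj₂) disj))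
          (count-disjoint Two? Left? ls λ { _ (inj₁ a) (¬a , _) → ¬a a ; _ (inj₂ s) (_ , o) → s o })
          where
          disj : ∀ {k} → k ∈ₗ ls → u ∈ˡ label k ⊎ (label k ≢ nothing × head k ∈ g) → ¬ ¬ label k ≢ nothing
          disj {_ ⟨ just _ ⟩ _} _ _ s = s λ ()
          disj {_ ⟨ nothing ⟩ _} _ (inj₂ (o , _)) _ = o refl

    -- If `u` were `x` or `y`, the special link would end in `u`. By equality it ends in `g`, but no
    -- free edge contains `u`.
    rooted-not-end : ¬ (u ≡ x ⊎ u ≡ y)
    rooted-not-end ux = none (here refl) (subst (_∈ g) (x≢y-ends G N.s∈ ux) (special-head N.s∈))

    -- If the label `e` misses `u`, its link enters `g`. Rotating `w` along `g` then frees `e`,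
    -- which contains the new end.
    rooted-edge : ∀ {e} → e ∈ₗ E → ¬ e ∈ₗ F₀ → ¬ u ∈ e → Rooted F₀ u e
    rooted-edge {e} e∈ e∉ u∉e with gap-cases {ls} {g ∷ F₀} uses e∈
    ... | inj₂ (here refl) = w , ls , G , wg
    ... | inj₂ (there p) = absurd (e∉ p)
    ... | inj₁ (a , b , k∈) with on-or-hit k∈
    ... | inj₁ ue = absurd (u∉e ue)
    ... | inj₂ bg = go (∈-∃++ k∈)
      where
      go : (∃₂ λ l₁ l₂ → ls ≡ l₁ ++ a ⟨ just e ⟩ b ∷ l₂) → Rooted F₀ u e
      go (l₁ , l₂ , eq) = a , _ , rotateʷ l₁ (subst (λ ks → Gap w u ks (g ∷ F₀)) eq G) (Perm.swap e g ↭-refl) wg bg , proj₁ (gap-joins G k∈)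

    -- The link into `v` does not enter `g`, so its label contains `u`. Rotating `u` along this very
    -- label makes `v` the end.
    rooted-vertex : ∀ {v} → ¬ v ∈ g → Rooted F₀ v g
    rooted-vertex {v} v∉g with path-complete G v
    ... | here refl = absurd (v∉g wg)
    ... | there v∈ = go (∈-head-link v∈)
      where
      go : (∃₂ λ a ℓ → a ⟨ ℓ ⟩ v ∈ₗ ls) → Rooted F₀ v g
      go (a , nothing , k∈) = absurd (v∉g (special-head k∈))
      go (a , just e , k∈) with on-or-hit k∈ | ∈-∃++ k∈
      ... | inj₂ vg | _ = absurd (v∉g vg)
      ... | inj₁ ue | l₁ , l₂ , eq = w , _ , rotateᵘ l₁ (subst (λ ks → Gap w u ks (g ∷ F₀)) eq G) ↭-refl (proj₁ (gap-joins G k∈)) ue , wg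

    -- A vertex of a second free edge outside `g` could be made an end, and then both ends would
    -- have free edges. So a second free edge is contained in `g` and equals it.
    rooted-rest : F₀ ≡ []
    rooted-rest = go F₀ refl
      where
      go : ∀ F → F ≡ F₀ → F₀ ≡ []
      go [] refl = refl
      go (f ∷ F) refl = absurd (gap-free-used-twice f≡g)
        where
        ⊆g : f ⊆ g
        ⊆g {v} vf with v ∈? g
        ... | yes vg = vg
        ... | no v∉g = absurd (no-both-free′ (rooted-vertex v∉g))
          where
          no-both-free′ : Rooted F₀ v g → Empty
          no-both-free′ (w′ , _ , G′ , wg′) = no-both-free G′ (f , there (here refl) , vf) (g , here refl , wg′)
        f≡g : f ≡ g
        f≡g = subset-of-equal {L = elements g} (∈-elements⁺ g ∘ ⊆g) (∈-elements⁺ g)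
          (≤-reflexive (trans (trans (length-elements g) (unif g∈)) (sym (unif (gap-free {ls} {g ∷ F₀} uses (there (here refl)))))))
          (≤-reflexive (length-elements g))
        gap-free-used-twice : f ≢ g
        gap-free-used-twice refl = ∉-head (gap-free-unique {ls} {g ∷ F₀} uses) (here refl)

    rooted-size : length E + 1 ≡ n
    rooted-size = trans (cong (_+ 1) size) (trans (+-comm (length ls) 1) (path-length G))
      where
      size : length E ≡ length ls
      size = suc-injective (begin
        suc (length E)                        ≡⟨ cong suc (sym (length-map just E)) ⟩
        length (nothing ∷ map just E)         ≡⟨ sym (↭-length uses) ⟩
        length (labels ls ++ map just (g ∷ F₀)) ≡⟨ length-++ (labels ls) ⟩
        length (labels ls) + length (map just (g ∷ F₀)) ≡⟨ cong₂ (λ i j → i + suc (length (map {B = Label n} just j))) (length-map label ls) rooted-rest ⟩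
        length ls + 1                         ≡⟨ +-comm (length ls) 1 ⟩
        suc (length ls) ∎)
        where open ≡-Reasoning

  Root : Fin n → Subset n → Set
  Root = Rooted []

  root-vertex : ∀ {u g v} → Root u g → ¬ v ∈ g → Root v g
  root-vertex (_ , _ , G , wg) = RootedAt.rooted-vertex G wg

  root-edge : ∀ {u g e} → Root u g → e ∈ₗ E → ¬ u ∈ e → Root u e
  root-edge (_ , _ , G , wg) e∈ = RootedAt.rooted-edge G wg e∈ λ ()

  root-not-end : ∀ {u g} → Root u g → ¬ (u ≡ x ⊎ u ≡ y)
  root-not-end (_ , _ , G , wg) = RootedAt.rooted-not-end G wg

  module _ {u₀ g₀} (R : Root u₀ g₀) where
    size-E : length E + 1 ≡ n
    size-E = let _ , _ , G , wg = R in RootedAt.rooted-size G wg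

    δ+r : δ + suc ρ ≡ n
    δ+r = let _ , _ , G , wg = R in RootedAt.rooted-δ G wg

    δ+ρ : length E ≡ δ + ρ
    δ+ρ = suc-injective (trans (+-comm 1 (length E)) (trans size-E (trans (sym δ+r) (+-suc δ ρ))))

    degree-u₀ : count (u₀ ∈?_) E ≡ δ
    degree-u₀ = let _ , _ , G , wg = R in +-cancelʳ-≡ (suc ρ) _ _ (trans (RootedAt.rooted-degree G wg) (sym δ+r))

    x≢y : x ≢ y
    x≢y = let _ , ls , G , wg = R ; _ , _ , s∈ = gap-special {ls} {g₀ ∷ []} (proj₂ (proj₂ G)) in
      λ eq → [ (λ (p , q) → link≢ G s∈ (trans p (trans eq (sym q)))) , (λ (p , q) → link≢ G s∈ (trans p (trans (sym eq) (sym q)))) ]′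
        (link-joins (proj₁ G) s∈)

    -- If every edge occurs as a root, x and y lie in all of them.
    all-rooted : ¬ (∀ {e} → e ∈ₗ E → ¬ ¬ ∃ λ u → Root u e)
    all-rooted rooted = contradiction big (<⇒≱ few-links)
      where
      in-all : ∀ {v} → v ≡ x ⊎ v ≡ y → ∀ {e} → e ∈ₗ E → v ∈ e
      in-all {v} end {e} e∈ with v ∈? e
      ... | yes p = p
      ... | no v∉ = absurd (rooted e∈ λ (u , r) → root-not-end (root-vertex r v∉) end)
      full : ∀ {v} → v ≡ x ⊎ v ≡ y → count (v ∈?_) E ≡ length E
      full end = count-all (_ ∈?_) (in-all end)
      others : ∃ λ vs → allFin n ↭ x ∷ y ∷ vs
      others = let vs , perm = pick₂ (∈-allFin x) (∈-allFin y) x≢y in vs , perm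
      vs = proj₁ others
      N = length E
      incidences : sum (map (λ v → count (v ∈?_) E) (allFin n)) ≤ N * suc ρ
      incidences = ≤-trans (≤-reflexive (double-count _∈?_ (allFin n) E))
        (sum-≤ E λ {e} e∈ → ≤-reflexive (trans (count-∈ e Unique-allFin (λ {v} _ → ∈-allFin v)) (unif e∈)))
      length-vs : length vs + 1 ≡ N
      length-vs = suc-injective (trans (cong suc (+-comm (length vs) 1)) (trans (sym (↭-length (proj₂ others)))
        (trans length-allFin (trans (sym size-E) (+-comm N 1)))))
      big : N + (N + length vs * δ) ≤ N * suc ρ
      big = ≤-trans (+-mono-≤ (≤-reflexive (sym (full (inj₁ refl)))) (+-mono-≤ (≤-reflexive (sym (full (inj₂ refl)))) (sum-≥ vs λ {v} _ → deg v)))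
        (≤-trans (≤-reflexive (sym (sum-↭ (↭-map⁺ (λ v → count (v ∈?_) E) (proj₂ others))))) incidences)
      few-links : N * suc ρ < N + (N + length vs * δ)
      few-links = begin-strict
        N * suc ρ                      ≡⟨ *-suc N ρ ⟩
        N + N * ρ                      ≡⟨ cong (λ k → N + k * ρ) (sym length-vs) ⟩
        N + (length vs + 1) * ρ        ≡⟨ cong (N +_) (trans (*-distribʳ-+ ρ (length vs) 1) (cong (length vs * ρ +_) (+-identityʳ ρ))) ⟩
        N + (length vs * ρ + ρ)        <⟨ +-monoʳ-< N (+-mono-≤-< (*-monoʳ-≤ (length vs) ρ≤δ) ρ<N) ⟩
        N + (length vs * δ + N)        ≡⟨ cong (N +_) (+-comm (length vs * δ) N) ⟩
        N + (N + length vs * δ) ∎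
        where
        open ≤-Reasoning
        ρ<N : ρ < N
        ρ<N = subst (suc ρ ≤_) (sym δ+ρ) (+-monoˡ-≤ ρ (≤-trans (s≤s z≤n) (≤-trans 2≤ρ ρ≤δ)))

    -- Otherwise an unrooted edge e₀ contains the complement of every rooted edge.
    module Unrooted {e₀} (e₀∈ : e₀ ∈ₗ E) (¬rooted : ¬ ∃ λ u → Root u e₀) where
      Co : List (Fin n)
      Co = elements (∁ e₀)

      ∈-Co : ∀ {v} → v ∈ₗ Co → ¬ v ∈ e₀
      ∈-Co v∈ ve = x∈p⇒x∉∁p ve (∈-elements⁻ (∁ e₀) v∈)

      length-Co : length Co ≡ δ
      length-Co = trans (length-elements (∁ e₀)) (trans (∣∁p∣≡n∸∣p∣ e₀)
        (trans (cong₂ _∸_ (sym δ+r) (unif e₀∈)) (m+n∸n≡m δ (suc ρ))))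

      root∈e₀ : ∀ {u g} → Root u g → u ∈ e₀
      root∈e₀ {u} r with u ∈? e₀
      ... | yes p = p
      ... | no u∉ = absurd (¬rooted (u , root-edge r e₀∈ u∉))

      -- A vertex that `g` misses is a root of `g`, and roots lie in `e₀`.
      rooted⊇ : ∀ {u g} → Root u g → ∀ {v} → v ∈ₗ Co → v ∈ g
      rooted⊇ {g = g} r {v} v∈ with v ∈? g
      ... | yes p = p
      ... | no v∉ = absurd (∈-Co v∈ (root∈e₀ (root-vertex r v∉)))

      -- Of the δ + ρ edges exactly δ contain `u₀`, and ρ ≥ 2.
      two-missing : ∃₂ λ g₁ g₂ → (g₁ ∈ₗ E × ¬ u₀ ∈ g₁) × (g₂ ∈ₗ E × ¬ u₀ ∈ g₂) × g₁ ≢ g₂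
      two-missing = go (filter missing? E) refl many
        where
        missing? : ∀ e → Dec (¬ u₀ ∈ e)
        missing? e = ¬? (u₀ ∈? e)
        many : 2 ≤ count missing? E
        many = +-cancelˡ-≤ δ _ _ (≤-trans (+-monoʳ-≤ δ 2≤ρ) (≤-reflexive
          (trans (sym δ+ρ) (trans (sym (count-¬ (u₀ ∈?_) E)) (cong (_+ count missing? E) degree-u₀)))))
        go : ∀ gs → gs ≡ filter missing? E → 2 ≤ length gs → ∃₂ λ g₁ g₂ → (g₁ ∈ₗ E × ¬ u₀ ∈ g₁) × (g₂ ∈ₗ E × ¬ u₀ ∈ g₂) × g₁ ≢ g₂
        go (_ ∷ []) _ (s≤s ())
        go (g₁ ∷ g₂ ∷ gs) eq _ = g₁ , g₂ , from (here refl) , from (there (here refl)) , differ (subst Unique (sym eq) (Unique.filter⁺ missing? uniq))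
          where
          from : ∀ {g} → g ∈ₗ g₁ ∷ g₂ ∷ gs → g ∈ₗ E × ¬ u₀ ∈ g
          from g∈ = ∈-filter⁻ missing? {xs = E} (subst (_ ∈ₗ_) eq g∈)
          differ : Unique (g₁ ∷ g₂ ∷ gs) → g₁ ≢ g₂
          differ ((ne ∷ _) ∷ _) = ne

      -- Two rooted edges at u₀ with complements in e₀ leave out every vertex of e₀.
      all-roots : ∀ {v} → v ∈ e₀ → ∃ λ g → Root v g
      all-roots {v} ve = let g₁ , g₂ , (g₁∈ , u∉₁) , (g₂∈ , u∉₂) , ne = two-missing in go g₁∈ g₂∈ (root-edge R g₁∈ u∉₁) (root-edge R g₂∈ u∉₂) ne
        where
        go : ∀ {g₁ g₂} → g₁ ∈ₗ E → g₂ ∈ₗ E → Root u₀ g₁ → Root u₀ g₂ → g₁ ≢ g₂ → ∃ λ g → Root v g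
        go {g₁} {g₂} g₁∈ g₂∈ r₁ r₂ ne with v ∈? g₁ | v ∈? g₂
        ... | no v∉ | _ = g₁ , root-vertex r₁ v∉
        ... | yes _ | no v∉ = g₂ , root-vertex r₂ v∉
        ... | yes v₁ | yes v₂ = absurd (ne (⊆-antisym (sub r₂ v₂ g₁∈ v₁ r₁) (sub r₁ v₁ g₂∈ v₂ r₂)))
          where
          v∉Co : v ∉ₗ Co
          v∉Co p = ∈-Co p ve
          sub : ∀ {g h} → Root u₀ h → v ∈ h → g ∈ₗ E → v ∈ g → Root u₀ g → g ⊆ h
          sub {g} {h} rh vh g∈ vg rg {s} sg with s ∈? h
          ... | yes p = p
          ... | no s∉h = contradiction (size-≥ g {s ∷ v ∷ Co}
              (Unique-∷ (λ { (here refl) → s∉h vh ; (there p) → s∉h (rooted⊇ rh p) }) (Unique-∷ v∉Co (Unique-elements (∁ e₀))))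
              λ { (here refl) → sg ; (there (here refl)) → vg ; (there (there p)) → rooted⊇ rg p })
              (<⇒≱ (s≤s (≤-trans (≤-reflexive (unif g∈)) (s≤s (≤-trans ρ≤δ (≤-reflexive (sym length-Co)))))))

      -- An edge without a root contains every vertex that is a root of some edge, thus all of `e₀`,
      -- and equals it. Every other edge has a root and contains `Co`.
      edge-cases : ∀ {e} → e ∈ₗ E → e ≢ e₀ → ∀ {v} → v ∈ₗ Co → v ∈ e
      edge-cases {e} e∈ ne {v} v∈ with v ∈? e
      ... | yes p = p
      ... | no v∉ = absurd (em (∃ λ u → Root u e) λ
        { (yes (_ , r)) → v∉ (rooted⊇ r v∈)
        ; (no ¬r) → ne (sym (⊆-antisym (sub ¬r) (sup ¬r))) })
        where
        sub : ¬ (∃ λ u → Root u e) → e₀ ⊆ e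
        sub ¬r {s} s∈ with s ∈? e
        ... | yes p = p
        ... | no s∉ = absurd (¬r (s , root-edge (proj₂ (all-roots s∈)) e∈ s∉))
        sup : ¬ (∃ λ u → Root u e) → e ⊆ e₀
        sup ¬r {s} s∈ with s ∈? e₀
        ... | yes p = p
        ... | no s∉ = contradiction (size-≥ e {s ∷ elements e₀} (Unique-∷ (s∉ ∘ ∈-elements⁻ e₀) (Unique-elements e₀))
              λ { (here refl) → s∈ ; (there p) → sub ¬r (∈-elements⁻ e₀ p) })
              (<⇒≱ (s≤s (≤-trans (≤-reflexive (unif e∈)) (≤-reflexive (sym (trans (length-elements e₀) (unif e₀∈)))))))

      other? : ∀ e → Dec (e ≢ e₀)
      other? e = ¬? (e ≟ˢ e₀)

      others : count other? E ≤ suc ρ C (suc ρ ∸ δ)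
      others = subst₂ (λ i j → count other? E ≤ i C (suc ρ ∸ j)) (trans (length-elements e₀) (unif e₀∈)) length-Co
        (family-bound Co (elements e₀) (Unique.filter⁺ other? uniq) (Unique-elements (∁ e₀)) λ e∈ →
          let e∈E , ne = ∈-filter⁻ other? {xs = E} e∈ in unif e∈E , edge-cases e∈E ne , λ {v} _ → covers v)
        where
        covers : ∀ v → v ∈ₗ Co ++ elements e₀
        covers v with v ∈? e₀
        ... | yes p = ∈-++⁺ʳ Co (∈-elements⁺ e₀ p)
        ... | no v∉ = ∈-++⁺ˡ (∈-elements⁺ (∁ e₀) (x∉p⇒x∈∁p v∉))

      at-most-one : count (_≟ˢ e₀) E ≤ 1
      at-most-one = length-⊆ {ys = [ e₀ ]} (Unique.filter⁺ (_≟ˢ e₀) uniq) λ e∈ → here (proj₂ (∈-filter⁻ (_≟ˢ e₀) {xs = E} e∈))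

      few-edges : δ + ρ ≤ 1 + suc ρ C (suc ρ ∸ δ)
      few-edges = ≤-trans (≤-reflexive (trans (sym δ+ρ) (sym (count-¬ (_≟ˢ e₀) E)))) (+-mono-≤ at-most-one others)

      impossible : Empty
      impossible = too-few 2≤ρ ρ≤δ δ+r n≤ C<δ slack few-edges

    no-root : Empty
    no-root = em (∃ λ e → e ∈ₗ E × ¬ ∃ λ u → Root u e) λ
      { (yes (e , e∈ , ¬r)) → Unrooted.impossible e∈ ¬r
      ; (no ¬e) → all-rooted λ {e} e∈ ¬r → ¬e (e , e∈ , ¬r) }

  one-free : ∀ {w u ls F} → Gap w u ls F → ¬ (∃ λ g → g ∈ₗ F × w ∈ g)
  one-free {w} {u} {ls} {F} G (g , g∈ , wg) with ∈-∃++ g∈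
  ... | F₁ , F₂ , refl = root G′ (RootedAt.rooted-rest G′ wg)
    where
    G′ : Gap w u ls (g ∷ F₁ ++ F₂)
    G′ = proj₁ G , proj₁ (proj₂ G) , ↭-trans (↭-++⁺ˡ (labels ls) (↭-map⁺ just (↭-sym (shift g F₁ F₂)))) (proj₂ (proj₂ G))
    root : ∀ {F₀} → Gap w u ls (g ∷ F₀) → F₀ ≡ [] → Empty
    root G₀ refl = no-root (w , ls , G₀ , wg)

  -- No free edge contains an end. The path uses n - 2 of at least n - 1 edges, so some `f` is free.
  -- A link into `f` with `u` in its label would, by rotating `u` along that label, make a vertex of
  -- `f` an end. The count then gives δ + ρ + 2 ≤ n, one more than n ≤ δ + ρ + 1 allows.
  no-gap : ∀ {w u ls F} → ¬ Gap w u ls F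
  no-gap {w} {u} {ls} {[]} G = contradiction enough (<⇒≱ (begin
      suc (suc (length E))                ≡⟨ cong (suc ∘ suc) (sym (length-map just E)) ⟩
      suc (length (nothing ∷ map just E)) ≡⟨ cong suc (sym (↭-length (proj₂ (proj₂ G)))) ⟩
      suc (length (labels ls ++ []))      ≡⟨ cong (suc ∘ length) (++-identityʳ (labels ls)) ⟩
      suc (length (labels ls))            ≡⟨ cong suc (length-map label ls) ⟩
      suc (length ls)                     ≡⟨ path-length G ⟩
      n ∎))
    where open ≤-Reasoning
  no-gap {w} {u} {ls} {f ∷ F} G = contradiction
      (≤-trans (+-monoˡ-≤ 2 (+-mono-≤ (deg u) ρ≤hits)) (C.total clear none))
      (<⇒≱ (≤-trans (s≤s n≤δ+r) (≤-reflexive (l δ ρ))))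
    where
    module C = Count G (gap-free {ls} {f ∷ F} (proj₂ (proj₂ G)) (here refl))
    l : ∀ d r → suc (d + suc r) ≡ d + r + 2
    l = solve-∀
    none : ∀ {g} → g ∈ₗ f ∷ F → ¬ u ∈ g
    none g∈ ug = one-free (Gap-flip G) (_ , g∈ , ug)
    w∉f : ¬ w ∈ f
    w∉f wf = one-free G (f , here refl , wf)
    clear : ∀ {a e b} → a ⟨ just e ⟩ b ∈ₗ ls → u ∈ e → ¬ b ∈ f
    clear {a} {e} {b} l∈ ue bf with ∈-∃++ l∈
    ... | l₁ , l₂ , refl = one-free (Gap-flip (rotateᵘ l₁ G ↭-refl (proj₁ (gap-joins G l∈)) ue)) (f , here refl , bf)
    ρ≤hits : ρ ≤ count C.OrdHit? ls
    ρ≤hits = +-cancelʳ-≤ 1 _ _ (begin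
      ρ + 1                                         ≡⟨ +-comm ρ 1 ⟩
      suc ρ                                         ≡⟨ trans (sym C.heads-hit) (cong (_+ count C.Hit? ls) (count-no (_∈? f) {xs = []} w∉f)) ⟩
      count C.Hit? ls                               ≤⟨ C.hits-split ⟩
      count C.OrdHit? ls + count C.SpecialHit? ls   ≤⟨ +-monoʳ-≤ _ C.special-hits ⟩
      count C.OrdHit? ls + 1 ∎)
      where open ≤-Reasoning

-- Adding edges to obtain a hamiltonian path, and removing them

module Complete {n : ℕ} (x y : Fin n) where
  open Chains x y

  -- In a set of r + 1 vertices, the link a b is labelled by the set without the vertex after b,
  -- or without the first vertex if b is the last one.
  module Cyclic (V : List (Fin n)) (uV : Unique V) where
    omit? : ∀ t (v : Fin n) → Dec (v ≢ t)
    omit? t v = ¬? (v F.≟ t)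

    omit : Fin n → Subset n
    omit t = fromList (filter (omit? t) V)

    ∈-omit : ∀ {t v} → v ∈ₗ V → v ≢ t → v ∈ omit t
    ∈-omit {t} v∈ v≢t = ∈-fromList⁺ _ (∈-filter⁺ (omit? t) v∈ v≢t)

    omit-⊆ : ∀ {t v} → v ∈ omit t → v ∈ₗ V × v ≢ t
    omit-⊆ {t} v∈ = ∈-filter⁻ (omit? t) {xs = V} (∈-fromList⁻ _ v∈)

    size-omit : ∀ {t} → t ∈ₗ V → suc ∣ omit t ∣ ≡ length V
    size-omit {t} t∈ = trans (cong suc (size-fromList (Unique.filter⁺ (omit? t) uV)))
      (trans (cong (_+ count (omit? t) V) (sym one)) (trans (cong (_+ count (omit? t) V) (sym flipped)) (trans (+-comm (count (¬? ∘ omit? t) V) _) (count-¬ (omit? t) V))))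
      where
      is? : ∀ v → Dec (v ≡ t)
      is? v = v F.≟ t
      one : count is? V ≡ 1
      one = ≤-antisym (length-⊆ {ys = [ t ]} (Unique.filter⁺ is? uV) λ v∈ → here (proj₂ (∈-filter⁻ is? {xs = V} v∈))) (count-pos is? t∈ refl)
      flipped : count (¬? ∘ omit? t) V ≡ count is? V
      flipped = ≤-antisym (count-mono (¬? ∘ omit? t) is? V λ {v} _ h → decidable-stable (v F.≟ t) h)
        (count-mono is? (¬? ∘ omit? t) V λ { _ refl h → h refl })

    omit-injective : ∀ {s t} → s ∈ₗ V → omit s ≡ omit t → s ≡ t
    omit-injective {s} {t} s∈ eq with s F.≟ t
    ... | yes e = e
    ... | no s≢t = absurd (proj₂ (omit-⊆ (subst (s ∈_) (sym eq) (∈-omit s∈ s≢t))) refl)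

    module _ (w₀ : Fin n) where
      around : Fin n → Fin n → List (Fin n) → List (Link n)
      around a b []      = [ a ⟨ just (omit w₀) ⟩ b ]
      around a b (c ∷ r) = a ⟨ just (omit c) ⟩ b ∷ around b c r

      labels-around : ∀ a b r → labels (around a b r) ≡ map (just ∘ omit) (r ++ [ w₀ ])
      labels-around a b [] = refl
      labels-around a b (c ∷ r) = cong (_ ∷_) (labels-around b c r)

      heads-around : ∀ a b r → heads (around a b r) ≡ b ∷ r
      heads-around a b [] = refl
      heads-around a b (c ∷ r) = cong (b ∷_) (heads-around b c r)

      last : Fin n → List (Fin n) → Fin n
      last b [] = b
      last b (c ∷ r) = last c r

      chain-around : ∀ a b r → Unique (w₀ ∷ a ∷ b ∷ r) → (∀ {v} → v ∈ₗ a ∷ b ∷ r → v ∈ₗ V) → Chain a (around a b r) (last b r)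
      chain-around a b [] ((w≢a ∷ w≢b ∷ []) ∷ _) sub = (∈-omit (sub (here refl)) (w≢a ∘ sym) , ∈-omit (sub (there (here refl))) (w≢b ∘ sym)) ∷ []
      chain-around a b (c ∷ r) ((_ ∷ w∉) ∷ (_ ∷ a≢c ∷ _) ∷ u@((b≢c ∷ _) ∷ _)) sub =
        (∈-omit (sub (here refl)) a≢c , ∈-omit (sub (there (here refl))) b≢c) ∷ chain-around b c r (w∉ ∷ u) (sub ∘ there)

  record Labelled (r : ℕ) (v : Fin n) (vs : List (Fin n)) (z : Fin n) : Set where
    field
      links  : List (Link n)
      chain  : Chain v links z
      heads≡ : heads links ≡ vs
      Ks     : List (Subset n)
      labels≡ : labels links ≡ map just Ks
      unique : Unique Ks
      sized  : ∀ {e} → e ∈ₗ Ks → ∣ e ∣ ≡ r × (∀ {u} → u ∈ e → u ∈ₗ v ∷ vs)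

  labelled-base : ∀ {r} a b c vs z → Unique (a ∷ b ∷ c ∷ vs ++ [ z ]) → length (a ∷ b ∷ c ∷ vs ++ [ z ]) ≡ suc r →
                  Labelled r a (b ∷ c ∷ vs ++ [ z ]) z
  labelled-base {r} a b c vs z u@((_ ∷ a≢c ∷ _) ∷ u′@((b≢c ∷ _) ∷ _)) len = record
    -- There are r links but r + 1 vertices to omit: `b` is the one never omitted, and `a` is
    -- omitted in the last label.
    { links   = around a a b (c ∷ vs ++ [ z ])
    ; chain   = (∈-omit (here refl) a≢c , ∈-omit (there (here refl)) b≢c) ∷
                subst (Chain b (around a b c (vs ++ [ z ]))) (last-z vs) (chain-around a b c (vs ++ [ z ]) u there)
    ; heads≡  = heads-around a a b (c ∷ vs ++ [ z ])
    ; Ks      = map omit ((c ∷ vs ++ [ z ]) ++ [ a ])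
    ; labels≡ = trans (labels-around a a b (c ∷ vs ++ [ z ])) (map-∘ ((c ∷ vs ++ [ z ]) ++ [ a ]))
    ; unique  = unique-map ((c ∷ vs ++ [ z ]) ++ [ a ]) (Unique-resp-↭ (↭-++-comm [ a ] _) (a∉ u)) ts∈
    ; sized   = λ e∈ → let t , t∈ , eq = ∈-map⁻ omit e∈ in
        subst (λ e → ∣ e ∣ ≡ r × (∀ {u} → u ∈ e → u ∈ₗ V)) (sym eq)
          (suc-injective (trans (size-omit (ts∈ t∈)) len) , proj₁ ∘ omit-⊆) }
    where
    V = a ∷ b ∷ c ∷ vs ++ [ z ]
    open Cyclic V u
    last-z : ∀ {c} vs → last a c (vs ++ [ z ]) ≡ z
    last-z [] = refl
    last-z (_ ∷ vs) = last-z vs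
    a∉ : Unique V → Unique (a ∷ c ∷ vs ++ [ z ])
    a∉ ((_ ∷ a∉) ∷ _ ∷ un) = a∉ ∷ un
    ts∈ : ∀ {t} → t ∈ₗ (c ∷ vs ++ [ z ]) ++ [ a ] → t ∈ₗ V
    ts∈ t∈ with ∈-++⁻ (c ∷ vs ++ [ z ]) t∈
    ... | inj₁ p = there (there p)
    ... | inj₂ (here refl) = here refl
    unique-map : ∀ ts → Unique ts → (∀ {t} → t ∈ₗ ts → t ∈ₗ V) → Unique (map omit ts)
    unique-map [] _ _ = []
    unique-map (t ∷ ts) (t∉ ∷ un) sub = Unique-∷ (λ p → let s , s∈ , eq = ∈-map⁻ omit p in
      All.lookup t∉ s∈ (omit-injective (sub (here refl)) eq)) (unique-map ts un (sub ∘ there))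

  -- Each vertex in front of the last r + 1 is only in the label of its own link.
  labelled : ∀ {r} k a b c vs z → 2 ≤ r → Unique (a ∷ b ∷ c ∷ vs ++ [ z ]) → length (a ∷ b ∷ c ∷ vs ++ [ z ]) ≡ k + suc r →
             3 ≤ r → Labelled r a (b ∷ c ∷ vs ++ [ z ]) z
  labelled zero a b c vs z _ u len _ = labelled-base a b c vs z u len
  labelled {r} (suc k) a b c [] z 2≤r u len 3≤r = contradiction (≤-trans (s≤s (s≤s 3≤r)) (≤-trans (s≤s (m≤n+m (suc r) k)) (≤-reflexive (sym len)))) (<⇒≱ ≤-refl)
  labelled {r} (suc k) a b c (d ∷ vs) z 2≤r u@(a∉ ∷ u′) len 3≤r = record
    { links = a ⟨ just e ⟩ b ∷ links ; chain = (proj₁ (proj₂ (proj₂ new)) (here refl) , proj₁ (proj₂ (proj₂ new)) (there (here refl))) ∷ chain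
    ; heads≡ = cong (b ∷_) heads≡ ; Ks = e ∷ Ks ; labels≡ = cong (just e ∷_) labels≡
    ; unique = Unique-∷ (λ e∈ → ∉-head u (proj₂ (sized e∈) (proj₁ (proj₂ (proj₂ new)) (here refl)))) unique
    ; sized = λ { (here refl) → proj₁ (proj₂ new) , proj₂ (proj₂ (proj₂ new)) ; (there e∈) → proj₁ (sized e∈) , there ∘ proj₂ (sized e∈) } }
    where
    open Labelled (labelled k b c d vs z 2≤r u′ (suc-injective len) 3≤r)
    new = subset-between (a ∷ b ∷ []) (c ∷ d ∷ vs ++ [ z ]) u 2≤r (≤-trans (≤-trans (n≤1+n r) (m≤n+m (suc r) (suc k))) (≤-reflexive (sym len)))
    e = proj₁ new

module Closing {n ρ m δ : ℕ} (x y : Fin n) (2≤ρ : 2 ≤ ρ) (ρ<n : suc ρ < n) (n≤ : n ≤ suc (2 * m))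
               (C<δ : m C ρ < δ) (n≤δ+r : n ≤ δ + suc ρ) (ρ≤δ : ρ ≤ δ) (slack : ρ < m ⊎ suc (m C ρ) < δ) where
  open Chains x y

  record Dense (E : List (Subset n)) : Set where
    field
      uniq   : Unique E
      unif   : ∀ {e} → e ∈ₗ E → ∣ e ∣ ≡ suc ρ
      deg    : ∀ v → δ ≤ count (v ∈?_) E
      enough : n ≤ suc (length E)

  Hamᴱ : List (Subset n) → Set
  Hamᴱ E = States.Ham E

  add-dense : ∀ {E k} → Dense E → ∣ k ∣ ≡ suc ρ → k ∉ₗ E → Dense (k ∷ E)
  add-dense {E} {k} d sz k∉ = record
    { uniq = Unique-∷ k∉ uniq ; unif = λ { (here refl) → sz ; (there e∈) → unif e∈ }
    ; deg = λ v → ≤-trans (deg v) (count-more v) ; enough = m≤n⇒m≤1+n enough }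
    where
    open Dense d
    count-more : ∀ v → count (v ∈?_) E ≤ count (v ∈?_) (k ∷ E)
    count-more v with v ∈? k
    ... | yes _ = n≤1+n _
    ... | no _ = ≤-refl

  -- If the path uses `k`, taking that link out of the cycle through the special link leaves a `Gap`
  -- over `E`, which `no-gap` excludes. Otherwise `k` is simply dropped from the free edges.
  remove-edge : ∀ {E k} → Dense E → Hamᴱ (k ∷ E) → ¬ ¬ Hamᴱ E
  remove-edge {E} {k} d (p , q , ls , F , (c , j , uses) , vs) ¬ham with ∈-++⁻ (labels ls) (∈-resp-↭ (↭-sym uses) (here refl))
  ... | inj₂ k∈ with ∈-map⁻ just k∈
  ...   | _ , k∈F , refl with ∈-∃++ k∈F
  ...   | F₁ , F₂ , refl = ¬ham (p , q , ls , F₁ ++ F₂ , (c , j , drop-∷ (↭-trans (↭-sym out) uses)) , vs)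
    where
    open ↭Solver
    out : labels ls ++ map just (F₁ ++ k ∷ F₂) ↭ just k ∷ labels ls ++ map just (F₁ ++ F₂)
    out rewrite map-++ (just {A = Subset n}) F₁ (k ∷ F₂) | map-++ (just {A = Subset n}) F₁ F₂ =
      solve 4 (λ l f k g → l ⊕ (f ⊕ (k ⊕ g)) ⊜ k ⊕ (l ⊕ (f ⊕ g))) ↭-refl (labels ls) (map just F₁) [ just k ] (map just F₂)
  remove-edge {E} {k} d (p , q , ls , F , (c , j , uses) , vs) ¬ham | inj₁ k∈ with ∈-map⁻ label k∈
  ... | (a ⟨ _ ⟩ b) , l∈ , refl with ∈-∃++ l∈
  ... | l₁ , l₂ , refl with split-at l₁ c
  ... | c₁ , _ , c₂ = Contradiction.no-gap K {w = b} {u = a} {ls = l₂ ++ q ⟨ nothing ⟩ p ∷ l₁} {F = F}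
      (c₂ ⋆ j ∷ c₁ , ↭-trans perm₁ vs , drop-∷ (↭-trans perm₂ (↭-trans (prep nothing uses) (Perm.swap nothing (just k) ↭-refl))))
    where
    open ↭Solver
    open Dense d
    K : Counterexample
    K = record { m = m ; δ = δ ; x = x ; y = y ; E = E ; uniq = uniq ; unif = unif ; ¬ham = ¬ham ; deg = deg ; 2≤ρ = 2≤ρ ; ρ<n = ρ<n
               ; n≤ = n≤ ; C<δ = C<δ ; n≤δ+r = n≤δ+r ; ρ≤δ = ρ≤δ ; enough = enough ; slack = slack }
    perm₁ : b ∷ heads (l₂ ++ q ⟨ nothing ⟩ p ∷ l₁) ↭ p ∷ heads (l₁ ++ a ⟨ just k ⟩ b ∷ l₂)
    perm₁ rewrite heads-++ l₂ (q ⟨ nothing ⟩ p ∷ l₁) | heads-++ l₁ (a ⟨ just k ⟩ b ∷ l₂) =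
      solve 4 (λ b r p l → b ⊕ (r ⊕ (p ⊕ l)) ⊜ p ⊕ (l ⊕ (b ⊕ r))) ↭-refl [ b ] (heads l₂) [ p ] (heads l₁)
    perm₂ : just k ∷ labels (l₂ ++ q ⟨ nothing ⟩ p ∷ l₁) ++ map just F ↭ nothing ∷ labels (l₁ ++ a ⟨ just k ⟩ b ∷ l₂) ++ map just F
    perm₂ rewrite labels-++ l₂ (q ⟨ nothing ⟩ p ∷ l₁) | labels-++ l₁ (a ⟨ just k ⟩ b ∷ l₂) =
      solve 5 (λ k r s l F → k ⊕ ((r ⊕ (s ⊕ l)) ⊕ F) ⊜ s ⊕ ((l ⊕ (k ⊕ r)) ⊕ F)) ↭-refl [ just k ] (labels l₂) [ nothing ] (labels l₁) (map just F)

  -- Sets already present are skipped, so that the edges remain distinct at every stage and each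
  -- removal starts from a simple hypergraph.
  add : List (Subset n) → List (Subset n) → List (Subset n)
  add [] E = E
  add (k ∷ Ks) E with Any.any? (k ≟ˢ_) E
  ... | yes _ = add Ks E
  ... | no _ = add Ks (k ∷ E)

  add-⊆ : ∀ Ks {E e} → e ∈ₗ E → e ∈ₗ add Ks E
  add-⊆ [] e∈ = e∈
  add-⊆ (k ∷ Ks) {E} e∈ with Any.any? (k ≟ˢ_) E
  ... | yes _ = add-⊆ Ks e∈
  ... | no _ = add-⊆ Ks (there e∈)

  ∈-add : ∀ Ks {E k} → k ∈ₗ Ks → k ∈ₗ add Ks E
  ∈-add (k ∷ Ks) {E} (here refl) with Any.any? (k ≟ˢ_) E
  ... | yes k∈ = add-⊆ Ks k∈
  ... | no _ = add-⊆ Ks (here refl)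
  ∈-add (k ∷ Ks) {E} (there p) with Any.any? (k ≟ˢ_) E
  ... | yes _ = ∈-add Ks p
  ... | no _ = ∈-add Ks p

  remove-edges : ∀ Ks {E} → Dense E → (∀ {k} → k ∈ₗ Ks → ∣ k ∣ ≡ suc ρ) → Hamᴱ (add Ks E) → ¬ ¬ Hamᴱ E
  remove-edges [] d _ h ¬h = ¬h h
  remove-edges (k ∷ Ks) {E} d sz h ¬h with Any.any? (k ≟ˢ_) E
  ... | yes _ = remove-edges Ks d (sz ∘ there) h ¬h
  ... | no k∉ = remove-edges Ks (add-dense d (sz (here refl)) k∉) (sz ∘ there) h λ h′ → remove-edge d h′ ¬h

  sublist : ∀ {Ks E : List (Subset n)} → Unique Ks → (∀ {k} → k ∈ₗ Ks → k ∈ₗ E) → ∃ λ F → Ks ++ F ↭ E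
  sublist {[]} _ _ = _ , ↭-refl
  sublist {k ∷ Ks} u@(_ ∷ uKs) sub with ∈-∃++ (sub (here refl))
  ... | as , bs , refl = let F , perm = sublist {E = as ++ bs} uKs sub′ in F , ↭-trans (prep k perm) (↭-sym (shift k as bs))
    where
    sub′ : ∀ {v} → v ∈ₗ Ks → v ∈ₗ as ++ bs
    sub′ v∈ with ∈-resp-↭ (shift k as bs) (sub (there v∈))
    ... | here refl = absurd (∉-head u v∈)
    ... | there p = p

  dense-ham : ∀ {E} → x ≢ y → Dense E → ¬ ¬ Hamᴱ E
  dense-ham {E} x≢y d with pick₂ (∈-allFin x) (∈-allFin y) x≢y
  ... | vs , perm = go vs perm
    where
    go : ∀ vs → allFin n ↭ x ∷ y ∷ vs → ¬ ¬ Hamᴱ E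
    go [] perm _ = contradiction (≤-trans ρ<n (≤-reflexive (trans (sym length-allFin) (↭-length perm)))) (<⇒≱ (s≤s (s≤s (≤-trans (s≤s z≤n) 2≤ρ))))
    go (_ ∷ []) perm _ = contradiction (≤-trans ρ<n (≤-reflexive (trans (sym length-allFin) (↭-length perm)))) (<⇒≱ (s≤s (s≤s 2≤ρ)))
    go (b ∷ c ∷ vs) perm = remove-edges Ks d (proj₁ ∘ sized) ham
      where
      order : x ∷ b ∷ c ∷ vs ++ [ y ] ↭ allFin n
      order = ↭-trans (prep x (↭-++-comm (b ∷ c ∷ vs) [ y ])) (↭-sym perm)
      gapᵏ : ∃ λ k → suc (suc ρ) + k ≡ n
      gapᵏ = m≤n⇒∃[o]m+o≡n ρ<n
      open Complete.Labelled (Complete.labelled x y {suc ρ} (proj₁ gapᵏ) x b c vs y (m≤n⇒m≤1+n 2≤ρ) (Unique-resp-↭ (↭-sym order) Unique-allFin)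
        (trans (↭-length order) (trans length-allFin (trans (sym (proj₂ gapᵏ)) (+-comm (suc (suc ρ)) (proj₁ gapᵏ))))) (s≤s 2≤ρ))
      F = proj₁ (sublist unique (∈-add Ks {E}))
      ham : Hamᴱ (add Ks E)
      ham = x , y , links , F , (chain , inj₂ (refl , refl) ,
        subst (λ l → l ++ map just F ↭ map just (add Ks E)) (sym labels≡)
          (subst (_↭ map just (add Ks E)) (map-++ just Ks F) (↭-map⁺ just (proj₂ (sublist unique (∈-add Ks {E})))))) ,
        subst (λ h → x ∷ h ↭ allFin n) (sym heads≡) order

-- A hamiltonian walk is found by running through all lists of n − 1 steps: the argument by contradiction
-- only yields ¬ ¬ Ham.
module Walks {n : ℕ} (E : List (Subset n)) where
  Step : Set
  Step = Subset n × Fin n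

  Walk : Fin n → List Step → Fin n → Set
  Walk a [] c = a ≡ c
  Walk a ((e , b) ∷ s) c = (a ∈ e × b ∈ e) × Walk b s c

  walk? : ∀ a s c → Dec (Walk a s c)
  walk? a [] c = a F.≟ c
  walk? a ((e , b) ∷ s) c = ((a ∈? e) ×-dec (b ∈? e)) ×-dec walk? b s c

  -- The step lists are taken from words of length n - 1, so distinctness makes a walk visit all n
  -- vertices.
  HamWalk : Fin n → Fin n → List Step → Set
  HamWalk x y s = Walk x s y × Unique (x ∷ map proj₂ s) × Unique (map proj₁ s)

  hamWalk? : ∀ x y s → Dec (HamWalk x y s)
  hamWalk? x y s = walk? x s y ×-dec (DecUnique.unique? F._≟_ (x ∷ map proj₂ s) ×-dec DecUnique.unique? _≟ˢ_ (map proj₁ s))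
    where import Data.List.Relation.Unary.Unique.DecPropositional as DecUnique

  steps : List Step
  steps = concatMap (λ e → map (e ,_) (allFin n)) E

  words : ℕ → List (List Step)
  words zero = [ [] ]
  words (suc k) = concatMap (λ s → map (s ∷_) (words k)) steps

  ∈-concatMap : ∀ {A B : Set} {f : A → List B} {a b xs} → a ∈ₗ xs → b ∈ₗ f a → b ∈ₗ concatMap f xs
  ∈-concatMap {f = f} {xs = x ∷ xs} (here refl) b∈ = ∈-++⁺ˡ b∈
  ∈-concatMap {f = f} {xs = x ∷ xs} (there a∈) b∈ = ∈-++⁺ʳ (f x) (∈-concatMap a∈ b∈)

  ∈-concatMap⁻ : ∀ {A B : Set} {f : A → List B} {b} xs → b ∈ₗ concatMap f xs → ∃ λ a → a ∈ₗ xs × b ∈ₗ f a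
  ∈-concatMap⁻ {f = f} (x ∷ xs) b∈ with ∈-++⁻ (f x) b∈
  ... | inj₁ p = x , here refl , p
  ... | inj₂ p = let a , a∈ , q = ∈-concatMap⁻ xs p in a , there a∈ , q

  ∈-words : ∀ s → (∀ {e} → e ∈ₗ map proj₁ s → e ∈ₗ E) → s ∈ₗ words (length s)
  ∈-words [] _ = here refl
  ∈-words ((e , b) ∷ s) sub = ∈-concatMap {xs = steps}
    (∈-concatMap {xs = E} (sub (here refl)) (∈-map⁺ (e ,_) (∈-allFin b)))
    (∈-map⁺ ((e , b) ∷_) (∈-words s (sub ∘ there)))

  words-sound : ∀ k {s} → s ∈ₗ words k → length s ≡ k × (∀ {e} → e ∈ₗ map proj₁ s → e ∈ₗ E)
  words-sound zero (here refl) = refl , λ ()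
  words-sound (suc k) s∈ with ∈-concatMap⁻ steps s∈
  ... | st , st∈ , p with ∈-map⁻ (st ∷_) p | ∈-concatMap⁻ E st∈
  ... | s , s∈′ , refl | e , e∈ , q with ∈-map⁻ (e ,_) q | words-sound k s∈′
  ... | b , _ , refl | len , sub = cong suc len , λ { (here refl) → e∈ ; (there r) → sub r }

  module _ (x y : Fin n) where
    open Chains x y
    open States E

    toSteps : ∀ {a ls c F} → Chain a ls c → labels ls ++ map just F ↭ map just E →
              ∃ λ s → Walk a s c × map proj₂ s ≡ heads ls × map (just ∘ proj₁) s ≡ labels ls
    toSteps {F = F} c uses = go c λ l∈ → ∈-resp-↭ uses (∈-++⁺ˡ l∈)
      where
      go : ∀ {a ls c} → Chain a ls c → (∀ {ℓ} → ℓ ∈ₗ labels ls → ℓ ∈ₗ map just E) →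
           ∃ λ s → Walk a s c × map proj₂ s ≡ heads ls × map (just ∘ proj₁) s ≡ labels ls
      go [] _ = [] , refl , refl , refl
      go (_∷_ {ℓ = just e} {b} j c) sub with go c (sub ∘ there)
      ... | s , w , hs , lb = (e , b) ∷ s , (j , w) , cong (b ∷_) hs , cong (just e ∷_) lb
      go (_∷_ {ℓ = nothing} j c) sub with ∈-map⁻ just (sub (here refl))
      ... | _ , _ , ()

    -- A `Ham` may run from `y` to `x`; it is then reversed.
    Ham⇒walk : Unique E → Ham → Any (HamWalk x y) (words (ℕ.pred n))
    Ham⇒walk uE (p , q , ls , F , L@(_ , j , _) , vs) = oriented j L vs
      where
      from : ∀ {p q ls} → p ≡ x → q ≡ y → Line p q ls F → p ∷ heads ls ↭ allFin n → Any (HamWalk x y) (words (ℕ.pred n))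
      from refl refl (c , _ , uses) vs with toSteps {F = F} c uses
      ... | s , w , hs , lb = lose (subst (λ k → s ∈ₗ words k) len (∈-words s sub)) (w ,
            subst (λ h → Unique (x ∷ h)) (sym hs) (Unique-resp-↭ (↭-sym vs) Unique-allFin) ,
            Unique.map⁻ (subst Unique (trans (sym lb) (map-∘ s)) (Unique-++ˡ _ (Unique-resp-↭ (↭-sym uses) (Unique.map⁺ just-injective uE)))))
        where
        sub : ∀ {e} → e ∈ₗ map proj₁ s → e ∈ₗ E
        sub {e} e∈ with ∈-map⁻ just (∈-resp-↭ uses (∈-++⁺ˡ (subst (just e ∈ₗ_) (trans (sym (map-∘ s)) lb) (∈-map⁺ just e∈))))
        ... | _ , e∈E , refl = e∈E
        len : length s ≡ ℕ.pred n
        len = trans (sym (length-map proj₂ s)) (trans (cong length hs) (cong ℕ.pred (trans (↭-length vs) (length-allFin {n}))))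
      oriented : ∀ {p q ls} → Joins q nothing p → Line p q ls F → p ∷ heads ls ↭ allFin n → Any (HamWalk x y) (words (ℕ.pred n))
      oriented {ls = ls} (inj₁ (q≡x , p≡y)) (c , j , uses) vs = from q≡x p≡y
        (rev-chain c , Joins-sym nothing j , ↭-trans (↭-++⁺ʳ _ (labels-rev ls)) uses) (↭-trans (heads-rev c) vs)
      oriented (inj₂ (q≡y , p≡x)) L vs = from p≡x q≡y L vs

-- Berge paths, and the numerical conditions in the three cases

module _ {n r : ℕ} (H : UniformHypergraph n r) where
  open Walks (edges H)

  at : Fin n → (s : List Step) → Fin (suc (length s)) → Fin n
  at a s F.zero = a
  at a ((_ , b) ∷ s) (F.suc i) = at b s i

  via : (s : List Step) → Fin (length s) → Subset n
  via ((e , _) ∷ s) F.zero = e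
  via (_ ∷ s) (F.suc i) = via s i

  at-∈ : ∀ a s i → at a s i ∈ₗ a ∷ map proj₂ s
  at-∈ a s F.zero = here refl
  at-∈ a ((_ , b) ∷ s) (F.suc i) = there (at-∈ b s i)

  via-∈ : ∀ s i → via s i ∈ₗ map proj₁ s
  via-∈ (_ ∷ s) F.zero = here refl
  via-∈ (_ ∷ s) (F.suc i) = there (via-∈ s i)

  at-injective : ∀ a s → Unique (a ∷ map proj₂ s) → ∀ {i j} → at a s i ≡ at a s j → i ≡ j
  at-injective a s u {F.zero} {F.zero} eq = refl
  at-injective a ((_ , b) ∷ s) u {F.zero} {F.suc j} eq = absurd (∉-head u (subst (_∈ₗ _) (sym eq) (at-∈ b s j)))
  at-injective a ((_ , b) ∷ s) u {F.suc i} {F.zero} eq = absurd (∉-head u (subst (_∈ₗ _) eq (at-∈ b s i)))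
  at-injective a ((_ , b) ∷ s) (_ ∷ u) {F.suc i} {F.suc j} eq = cong F.suc (at-injective b s u eq)

  via-injective : ∀ s → Unique (map proj₁ s) → ∀ {i j} → via s i ≡ via s j → i ≡ j
  via-injective (_ ∷ s) u {F.zero} {F.zero} eq = refl
  via-injective (_ ∷ s) u {F.zero} {F.suc j} eq = absurd (∉-head u (subst (_∈ₗ _) (sym eq) (via-∈ s j)))
  via-injective (_ ∷ s) u {F.suc i} {F.zero} eq = absurd (∉-head u (subst (_∈ₗ _) eq (via-∈ s i)))
  via-injective (_ ∷ s) (_ ∷ u) {F.suc i} {F.suc j} eq = cong F.suc (via-injective s u eq)

  via-left : ∀ a s c → Walk a s c → ∀ i → at a s (inject₁ i) ∈ via s i
  via-left a ((e , b) ∷ s) c ((ae , _) , w) F.zero = ae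
  via-left a ((e , b) ∷ s) c (_ , w) (F.suc i) = via-left b s c w i

  via-right : ∀ a s c → Walk a s c → ∀ i → at a s (F.suc i) ∈ via s i
  via-right a ((e , b) ∷ s) c ((_ , be) , w) F.zero = be
  via-right a ((e , b) ∷ s) c (_ , w) (F.suc i) = via-right b s c w i

  at-last : ∀ a s c → Walk a s c → at a s (fromℕ (length s)) ≡ c
  at-last a [] c w = w
  at-last a ((_ , b) ∷ s) c (_ , w) = at-last b s c w

  at-surjective : ∀ a s {v} → v ∈ₗ a ∷ map proj₂ s → ∃ λ i → at a s i ≡ v
  at-surjective a s (here refl) = F.zero , refl
  at-surjective a ((_ , b) ∷ s) (there v∈) with at-surjective b s v∈
  ... | i , eq = F.suc i , eq

  walk⇒path : ∀ {x y s} → length s ≡ ℕ.pred n → (∀ {e} → e ∈ₗ map proj₁ s → e ∈ₗ edges H) → HamWalk x y s → HamiltonianPath H x y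
  walk⇒path {x} {y} {s} len sub (w , uv , ue) = length s , record
      { vert = at x s ; edge = via s ; vertInj = at-injective x s uv ; edgeInj = via-injective s ue
      ; edgeInH = sub ∘ via-∈ s ; leftIn = via-left x s y w ; rightIn = via-right x s y w } ,
    refl , at-last x s y w , λ v → at-surjective x s (complete v)
    where
    complete : ∀ v → v ∈ₗ x ∷ map proj₂ s
    complete v with Any.any? (v F.≟_) (x ∷ map proj₂ s)
    ... | yes p = p
    ... | no v∉ = contradiction (length-⊆ {ys = allFin n} (Unique-∷ v∉ uv) λ _ → ∈-allFin _)
          (<⇒≱ (s≤s (≤-trans (≤-reflexive length-allFin) (≤-trans (≤-suc-pred n) (≤-reflexive (cong suc (trans (sym len) (sym (length-map proj₂ s)))))))))
      where
      ≤-suc-pred : ∀ k → k ≤ suc (ℕ.pred k)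
      ≤-suc-pred zero = z≤n
      ≤-suc-pred (suc k) = ≤-refl

  hamiltonian-path : ∀ x y → ¬ ¬ Chains.States.Ham x y (edges H) → HamiltonianPath H x y
  hamiltonian-path x y ¬¬ham with decidable-stable (Any.any? (hamWalk? x y) (words (ℕ.pred n))) (λ ¬walk → ¬¬ham (¬walk ∘ Ham⇒walk x y (simple H)))
  ... | walk with find walk
  ... | s , s∈ , hw = let len , sub = words-sound (ℕ.pred n) s∈ in walk⇒path len sub hw

  -- The incidences of vertices and edges are counted twice. This supplies the lower bound n - 1 on
  -- the number of edges.
  handshake : ∀ {k} → MinDegreeAtLeast H k → n * k ≤ length (edges H) * r
  handshake {k} h = begin
    n * k                                                  ≡⟨ cong (_* k) (sym (length-allFin {n})) ⟩
    length (allFin n) * k                                  ≤⟨ sum-≥ (allFin n) (λ {v} _ → h v) ⟩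
    sum (map (λ v → count (v ∈?_) (edges H)) (allFin n))   ≡⟨ double-count _∈?_ (allFin n) (edges H) ⟩
    sum (map (λ e → count (_∈? e) (allFin n)) (edges H))   ≤⟨ sum-≤ (edges H) (λ {e} e∈ → ≤-reflexive (trans (count-∈ e Unique-allFin (λ _ → ∈-allFin _)) (All.lookup (uniform H) e∈))) ⟩
    length (edges H) * r ∎
    where open ≤-Reasoning

-- In `slack` the first alternative means r ≤ m. In the other cases C(m, ρ) is at most 1 and the
-- degree exceeds it by at least two.
record Bounds (n ρ m δ : ℕ) : Set where
  field
    2≤ρ   : 2 ≤ ρ
    ρ<n   : suc ρ < n
    n≤    : n ≤ suc (2 * m)
    C<δ   : m C ρ < δ
    n≤δ+r : n ≤ δ + suc ρ
    ρ≤δ   : ρ ≤ δ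
    slack : ρ < m ⊎ suc (m C ρ) < δ

bounds⇒connected : ∀ {n ρ m δ} → Bounds n ρ m δ → (H : UniformHypergraph n (suc ρ)) → MinDegreeAtLeast H δ →
                   n ≤ suc (length (edges H)) → HamiltonianConnected H
bounds⇒connected {m = m} B H h enough x y x≢y = hamiltonian-path H x y
    (Closing.dense-ham {m = m} x y 2≤ρ ρ<n n≤ C<δ n≤δ+r ρ≤δ slack x≢y record
      { uniq = simple H ; unif = All.lookup (uniform H) ; deg = h ; enough = enough })
  where open Bounds B

n≤1+2[n/2] : ∀ n → n ≤ suc (2 * (n / 2))
n≤1+2[n/2] n = begin
  n                       ≡⟨ m≡m%n+[m/n]*n n 2 ⟩
  n % 2 + n / 2 * 2       ≤⟨ +-mono-≤ (s≤s⁻¹ (m%n<n n 2)) (≤-reflexive (*-comm (n / 2) 2)) ⟩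
  suc (2 * (n / 2)) ∎
  where open ≤-Reasoning

2[n/2]≤n : ∀ n → 2 * (n / 2) ≤ n
2[n/2]≤n n = ≤-trans (≤-reflexive (*-comm 2 (n / 2))) (≤-trans (m≤n+m _ (n % 2)) (≤-reflexive (sym (m≡m%n+[m/n]*n n 2))))

module Small {n ρ m} (2≤ρ : 2 ≤ ρ) (n≤ : n ≤ suc (2 * m)) (r≤m : suc ρ ≤ m) (2m≤n : 2 * m ≤ n) where
  m≤C : m ≤ m C ρ
  m≤C = C-linear m ρ (≤-trans (s≤s z≤n) 2≤ρ) r≤m

  -- For r = m both summands are at least m. For r < m the first is at least 2 (m - 1), by `C-step`
  -- and `C-linear`.
  2m≤C+r : 2 * m ≤ m C ρ + suc ρ
  2m≤C+r = go m r≤m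
    where
    open ≤-Reasoning
    go : ∀ m → suc ρ ≤ m → 2 * m ≤ m C ρ + suc ρ
    go (suc m) (s≤s ρ≤m) with m≤n⇒m<n∨m≡n ρ≤m
    ... | inj₂ refl = begin
          2 * suc m             ≡⟨ cong (suc m +_) (+-identityʳ (suc m)) ⟩
          suc m + suc m         ≤⟨ +-monoˡ-≤ (suc m) (C-linear (suc m) m (≤-trans (s≤s z≤n) 2≤ρ) ≤-refl) ⟩
          suc m C m + suc m ∎
    ... | inj₁ ρ<m = begin
          2 * suc m             ≡⟨ l m ⟩
          (m + m) + 2           ≤⟨ +-mono-≤ (≤-trans (+-monoˡ-≤ m (C-linear m ρ (≤-trans (s≤s z≤n) 2≤ρ) ρ<m)) (C-step m ρ 2≤ρ ρ≤m)) (m≤n⇒m≤1+n 2≤ρ) ⟩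
          suc m C ρ + suc ρ ∎
      where
      l : ∀ m → 2 * suc m ≡ (m + m) + 2
      l = solve-∀

  bounds : Bounds n ρ m (m C ρ + 1)
  bounds = record
    { 2≤ρ = 2≤ρ
    ; ρ<n = ≤-trans (s≤s r≤m) (≤-trans (≤-trans (+-monoˡ-≤ m 1≤m) (≤-reflexive (cong (m +_) (sym (+-identityʳ m))))) 2m≤n)
    ; n≤ = n≤
    ; C<δ = ≤-reflexive (+-comm 1 (m C ρ))
    ; n≤δ+r = ≤-trans n≤ (≤-trans (s≤s 2m≤C+r) (≤-reflexive (l (m C ρ) ρ)))
    ; ρ≤δ = ≤-trans (n≤1+n ρ) (≤-trans r≤m (≤-trans m≤C (m≤m+n _ 1)))
    ; slack = inj₁ r≤m }
    where
    1≤m : 1 ≤ m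
    1≤m = ≤-trans (s≤s z≤n) r≤m
    l : ∀ c ρ → suc (c + suc ρ) ≡ c + 1 + suc ρ
    l = solve-∀

  enough : ∀ {N} → n * (m C ρ + 1) ≤ N * suc ρ → n ≤ suc N
  enough {N} h = m≤n⇒m≤1+n (*-cancelʳ-≤ n N (suc ρ) (≤-trans (*-monoʳ-≤ n (≤-trans r≤m (≤-trans m≤C (m≤m+n _ 1)))) h))

module Large {n ρ m} (n<2r : n < 2 * suc ρ) (r<n : suc ρ < n) (6≤n : 6 ≤ n) (n≤ : n ≤ suc (2 * m)) (2m≤n : 2 * m ≤ n) where
  m≤ρ : m ≤ ρ
  m≤ρ = s≤s⁻¹ (*-cancelˡ-< 2 m (suc ρ) (≤-<-trans 2m≤n n<2r))

  3≤m : 3 ≤ m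
  3≤m with 3 ≤? m
  ... | yes p = p
  ... | no ¬p = contradiction (≤-trans 6≤n (≤-trans n≤ (s≤s (*-monoʳ-≤ 2 (s≤s⁻¹ (≰⇒> ¬p)))))) (<⇒≱ ≤-refl)

  3≤ρ : 3 ≤ ρ
  3≤ρ = ≤-trans 3≤m m≤ρ

  C≤1 : m C ρ ≤ 1
  C≤1 with m≤n⇒m<n∨m≡n m≤ρ
  ... | inj₁ lt = ≤-trans (≤-reflexive (k>n⇒nCk≡0 lt)) z≤n
  ... | inj₂ refl = ≤-reflexive (nCn≡1 m)

  bounds : Bounds n ρ m ρ
  bounds = record
    { 2≤ρ = ≤-trans (n≤1+n 2) 3≤ρ ; ρ<n = r<n ; n≤ = n≤ ; C<δ = ≤-trans (s≤s C≤1) (≤-trans (n≤1+n 2) 3≤ρ)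
    ; n≤δ+r = s≤s⁻¹ (≤-trans n<2r (≤-reflexive (l ρ))) ; ρ≤δ = ≤-refl ; slack = inj₂ (≤-trans (s≤s (s≤s C≤1)) 3≤ρ) }
    where
    l : ∀ ρ → 2 * suc ρ ≡ suc (ρ + suc ρ)
    l = solve-∀

  -- With at most n - 2 edges, the incidences would give nρ + 2r ≤ nr, that is 2r ≤ n.
  enough : ∀ {N} → n * ρ ≤ N * suc ρ → n ≤ suc N
  enough {N} h with n ≤? suc N
  ... | yes p = p
  ... | no ¬p = contradiction (+-cancelˡ-≤ (n * ρ) (2 * suc ρ) n (begin
        n * ρ + 2 * suc ρ          ≤⟨ +-monoˡ-≤ (2 * suc ρ) h ⟩
        N * suc ρ + 2 * suc ρ      ≡⟨ sym (*-distribʳ-+ (suc ρ) N 2) ⟩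
        (N + 2) * suc ρ            ≤⟨ *-monoˡ-≤ (suc ρ) (≤-trans (≤-reflexive (+-comm N 2)) (≰⇒> ¬p)) ⟩
        n * suc ρ                  ≡⟨ *-suc n ρ ⟩
        n + n * ρ                  ≡⟨ +-comm n (n * ρ) ⟩
        n * ρ + n ∎)) (<⇒≱ n<2r)
        where open ≤-Reasoning

-- The whole vertex set is the only possible edge. This rules out r = n in the second case, where
-- the degree is at least 2.
degree-≤-1 : ∀ {n} (H : UniformHypergraph n n) v → degree H v ≤ 1
degree-≤-1 H v = ≤-trans (length-filter (v ∈?_) (edges H)) (go (edges H) (simple H) (All.map ∣p∣≡n⇒p≡⊤ (uniform H)))
  where
  go : ∀ es → Unique es → All (_≡ ⊤) es → length es ≤ 1
  go [] _ _ = z≤n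
  go (_ ∷ []) _ _ = ≤-refl
  go (_ ∷ _ ∷ _) ((e≢f ∷ _) ∷ _) (refl ∷ refl ∷ _) = absurd (e≢f refl)

theorem3 : (n r : ℕ) → 3 ≤ r → r ≤ n → (H : UniformHypergraph n r) →
    ((2 * r ≤ n × MinDegreeAtLeast H ((n / 2) C (r ∸ 1) + 1))
    ⊎ ((n < 2 * r × 6 ≤ n) × MinDegreeAtLeast H (r ∸ 1))
    ⊎ ((r ≡ 3 × n ≡ 5) × MinDegreeAtLeast H 3)) →
    HamiltonianConnected H
theorem3 n (suc ρ) (s≤s 2≤ρ) _ H (inj₁ (2r≤n , h)) = bounds⇒connected bounds H h (enough (handshake H h))
  where open Small {m = n / 2} 2≤ρ (n≤1+2[n/2] n) (s≤s⁻¹ (*-cancelˡ-< 2 (suc ρ) (suc (n / 2)) (≤-trans (s≤s (≤-trans 2r≤n (n≤1+2[n/2] n))) (≤-reflexive (sym (*-suc 2 (n / 2))))))) (2[n/2]≤n n)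
theorem3 n (suc ρ) (s≤s 2≤ρ) r≤n H (inj₂ (inj₁ ((n<2r , 6≤n) , h))) with m≤n⇒m<n∨m≡n r≤n
... | inj₁ r<n = bounds⇒connected bounds H h (enough (handshake H h))
  where open Large {m = n / 2} n<2r r<n 6≤n (n≤1+2[n/2] n) (2[n/2]≤n n)
... | inj₂ refl = contradiction (≤-trans 2≤ρ (≤-trans (h F.zero) (degree-≤-1 H F.zero))) (<⇒≱ ≤-refl)
theorem3 n r _ _ H (inj₂ (inj₂ ((refl , refl) , h))) = bounds⇒connected bounds H h
    (s≤s (≤-trans (n≤1+n 4) (*-cancelʳ-≤ 5 (length (edges H)) 3 (handshake H h))))
  where
  bounds : Bounds 5 2 2 3
  bounds = record
    { 2≤ρ = ≤-refl ; ρ<n = n≤1+n 4 ; n≤ = ≤-refl ; C<δ = n≤1+n 2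
    ; n≤δ+r = n≤1+n 5 ; ρ≤δ = n≤1+n 2 ; slack = inj₂ ≤-refl }
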